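{- Let $q=p^n$, where $p$ is a prime and $n$ is a positive integer, and let $X$ be an extremal Peisert-type graph defined over $\mathbb{F}_{q^2}$. (1) If $n=1$ and $p\ge 3$, then $X$ is of type $(\frac{p+3}{2},p)$, and $X$ is unique up to isomorphism (any two extremal Peisert-type graphs defined over $\mathbb{F}_{p^2}$ are isomorphic). (2) If $n>1$, then $X$ is of type $(p^{n-k}+1,q)$, where $k$ is the largest proper divisor of $n$.
   Context: Let $q$ be a prime power. For an abelian group $G$ and $S\subseteq G\setminus\{0\}$ with $S=-S$, $\operatorname{Cay}(G,S)$ is the graph with vertex set $G$ in which $g\sim h$ iff $g-h\in S$. A Peisert-type graph of type $(m,q)$ (also called a Peisert-type graph defined over $\mathbb{F}_{q^2}$) is a graph $\operatorname{Cay}(\mathbb{F}_{q^2}^+,S)$ where $S=c_1\mathbb{F}_q^*\cup\cdots\cup c_m\mathbb{F}_q^*$ is a union of $m\le q$ distinct cosets of $\mathbb{F}_q^*$ in $\mathbb{F}_{q^2}^*$. Such a graph has clique number $q$; a maximum clique is a clique of size $q$. The canonical cliques are the sets $x+c_i\mathbb{F}_q$ with $x\in\mathbb{F}_{q^2}$, $1\le i\le m$. The graph has the strict-EKR property if every maximum clique is canonical. A Peisert-type graph of type $(m,q)$ is extremal if it does not have the strict-EKR property while every Peisert-type graph of type $(m-1,q)$ has the strict-EKR property. -}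

module Defs where

open import Level using (0ℓ)
open import Data.Nat using (ℕ; zero; suc; _∸_; _≤_)
open import Data.Fin using (Fin)
open import Data.Product using (Σ; ∃; _×_; _,_)
open import Relation.Nullary using (¬_; Dec)
open import Relation.Binary.PropositionalEquality using (_≡_; _≢_)
open import Algebra.Structures using (IsCommutativeRing)
open import Function.Bundles using (_↔_; Inverse)

record FiniteField (size : ℕ) : Set₁ where
  infixl 7 _*_
  infixl 6 _+_ _-_
  field
    Carrier : Set
    _+_ _*_ : Carrier → Carrier → Carrier
    -_      : Carrier → Carrier
    0# 1#   : Carrier
    isCommutativeRing : IsCommutativeRing _≡_ _+_ _*_ -_ 0# 1#
    0≢1     : 0# ≢ 1#
    inverse : ∀ x → x ≢ 0# → ∃ λ y → x * y ≡ 1#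
    _≟_     : (x y : Carrier) → Dec (x ≡ y)
    enum    : Carrier ↔ Fin size

  _-_ : Carrier → Carrier → Carrier
  x - y = x + (- y)

  _^_ : Carrier → ℕ → Carrier
  x ^ zero  = 1#
  x ^ suc k = x * (x ^ k)

module _ (q : ℕ) (K : FiniteField (q Data.Nat.* q)) where
  open FiniteField K

  InFq : Carrier → Set
  InFq a = a ^ q ≡ a

  InFq* : Carrier → Set
  InFq* a = InFq a × a ≢ 0#

  -- c : Fin m → K gives m coset representatives; the data of a
  -- Peisert-type graph of type (m,q): nonzero, pairwise distinct cosets of F_q^*, m ≤ q.
  record PeisertData (m : ℕ) : Set where
    field
      c        : Fin m → Carrier
      m≤q      : m ≤ q
      nonzero  : ∀ i → c i ≢ 0#
      distinct : ∀ i j → i ≢ j → ¬ (∃ λ a → InFq* a × c i ≡ c j * a)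

  InS : ∀ {m} → PeisertData m → Carrier → Set
  InS D s = ∃ λ i → ∃ λ a → InFq* a × s ≡ PeisertData.c D i * a

  Adj : ∀ {m} → PeisertData m → Carrier → Carrier → Set
  Adj D x y = InS D (x - y)

  -- a clique of size q (= maximum clique), given as an injective family
  record MaxClique {m} (D : PeisertData m) : Set where
    field
      v      : Fin q → Carrier
      inj    : ∀ i j → v i ≡ v j → i ≡ j
      clique : ∀ i j → i ≢ j → Adj D (v i) (v j)

  -- canonical clique: contained in (hence equal to) x + c_i F_q
  Canonical : ∀ {m} (D : PeisertData m) → MaxClique D → Set
  Canonical D C = ∃ λ x → ∃ λ i → ∀ j →
    ∃ λ a → InFq a × MaxClique.v C j ≡ x + PeisertData.c D i * a

  StrictEKR : ∀ {m} → PeisertData m → Set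
  StrictEKR D = ∀ (C : MaxClique D) → Canonical D C

  Extremal : ∀ {m} → PeisertData m → Set
  Extremal {m} D = ¬ StrictEKR D × (∀ (D' : PeisertData (m ∸ 1)) → StrictEKR D')

  Isomorphic : ∀ {m m'} → PeisertData m → PeisertData m' → Set
  Isomorphic D D' = Σ (Carrier ↔ Carrier) λ f →
    ∀ x y → (Adj D x y → Adj D' (Inverse.to f x) (Inverse.to f y))
          × (Adj D' (Inverse.to f x) (Inverse.to f y) → Adj D x y)

module Submission where

-- Write form u c = u c^q − u^q c, an alternating 𝔽_q-bilinear form on 𝔽_{q²} with form u c = 0 iff
-- u ∈ c 𝔽_q. For a q-clique U and a vector d let h_d = ∏_{u ∈ U} (X − form u d). All roots satisfy
-- ω^q = −ω, and h_d = X^q + X when no difference of U is parallel to d. Along a pencil e + y d the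
-- coefficient of Xⁱ in h is a polynomial in y of degree at most q − i that vanishes at all but m − 1 of
-- the y ∈ 𝔽_q, so its leading coefficient, the coefficient of Xⁱ in h_d, is 0 for m ≤ i < q (Rédei).
-- Since h_d divides (X^q + X) h_d′, it divides G (1 − G′), where G = X^q + X − h_d has degree < m.
--
-- If 2m − 2 ≤ q this forces h_d′ = 0 for every direction d occurring in U. For q prime U is then a line,
-- so m ≥ (p + 3)/2. For q = pⁿ the derivative of every h is constant, which makes all nonempty lines of
-- a given direction meet U equally often, s = pᵉ times, so h_d = rˢ with r squarefree. Then
-- r = X^{q/s} − G₀ divides X + G₀ˢ; for the direction with s minimal the cofactor is constant, and
-- comparing coefficients shows that q/s is a power of s. Hence e ∣ n and m ≥ q/s + 1.
-- The bounds are attained by the graph of the trace map and by a union of squares on two lines.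
--
-- For q = p = 2k + 1 and m = k + 2 the quotient of G (1 − G′) by h_d is constant, which leaves only two
-- shapes of h_d. A second pencil argument finds two directions with a line through k + 1 points of U, so
-- U lies on two lines and the directions are these two and the slopes in one coset of the squares; any
-- two such configurations differ by a linear map.

-- Extremality is used on both sides. Minimality rules out every non-strict graph of type m - 1;
-- since the constructed graphs can be padded to any larger type up to q, this bounds m from above.
-- Minimality also forces the clique to use all m cosets, because a coset without an edge of the
-- clique could be deleted. Without this the alternative G = 0 could not be discarded for a given
-- direction. The alternating form replaces a choice of coordinates: the subfield is available only
-- as the set of fixed points of the q-th power map, and the form treats all directions alike. The
-- price is that its values lie in the kernel of the trace to the subfield and not in the subfield
-- itself, so quotients of two values are what serves as a scalar. For n > 1 the polynomial argument
-- runs under 2m ≤ q. This is harmless: 2m > q already gives m > q/pᵏ for every k ≥ 1. Failure of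
-- strictness is a negation and hands over no clique, so only decidable conclusions are drawn from
-- it; this is why a normal form is searched for by enumeration.

open import Defs
open import Algebra.Bundles using (CommutativeRing; CommutativeMonoid)
import Algebra.Properties.CommutativeMonoid.Sum
import Algebra.Properties.CommutativeSemiring.Exp
import Algebra.Properties.Semiring.Exp
import Algebra.Properties.Semiring.Mult
open import Data.Empty using (⊥-elim; ⊥)
open import Data.Fin as Fin using (Fin; toℕ; inject₁; fromℕ; zero; suc; punchIn; punchOut)
import Data.Fin.Properties as Fin
open import Data.List using (List; []; _∷_; length; _++_; filter; map; tabulate; allFin; lookup)
open import Data.List.Membership.Propositional using (_∈_; find)
open import Data.List.Membership.Propositional.Properties using (∈-filter⁻; ∈-tabulate⁺; ∈-tabulate⁻; ∈-map⁺; ∈-allFin; ∈-filter⁺; ∈-∃++; ∈-++⁺ʳ; ∈-++⁻; ∈-lookup)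
open import Data.List.Properties using (length-map; filter-reject; length-filter; length-tabulate; map-tabulate; tabulate-cong; length-++)
open import Data.List.Relation.Unary.All as All using (All; []; _∷_)
import Data.List.Relation.Unary.All.Properties as All
open import Data.List.Relation.Unary.All.Properties using (all-filter)
open import Data.List.Relation.Unary.AllPairs as AllPairs using ([]; _∷_; AllPairs)
import Data.List.Relation.Unary.AllPairs.Properties as AllPairs
open import Data.List.Relation.Unary.Any as Any using (here; there)
open import Data.List.Relation.Unary.Any.Properties using (lookup-index)
open import Data.List.Relation.Unary.Unique.Propositional using (Unique)
import Data.List.Relation.Unary.Unique.Propositional.Properties as Unique
open import Data.Nat as ℕ using (ℕ; zero; suc)
open import Data.Nat.Combinatorics using (nCn≡1; k![n∸k]!∣n!) renaming (_C_ to _choose_)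
open import Data.Nat.Combinatorics.Specification using (nCk≡n!/k![n-k]!)
open import Data.Nat.Coprimality using (prime⇒coprime; coprime-Bézout)
import Data.Nat.DivMod as DM
open import Data.Nat.Divisibility using (_∣_; divides; ∣⇒≤; m∣m*n; ∣1⇒≡1; ∣m+n∣m⇒∣n; ∣-trans; _∣?_; 1∣_)
import Data.Nat.GCD as GCD
open import Data.Nat.Induction using (<-rec)
open import Data.Nat.Primality using (Prime; euclidsLemma; ¬prime[0]; ¬prime[1]; prime⇒nonTrivial; prime⇒irreducible)
import Data.Nat.Properties as ℕₚ
open import Data.Nat.Solver using (module +-*-Solver)
open import Data.Product using (_,_; proj₁; proj₂; ∃)
open import Data.Sum using (inj₁; inj₂; _⊎_)
open import Function using (_∘_; _↔_; Inverse; mk↔ₛ′)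
open import Function.Construct.Composition using (_↔-∘_)
open import Function.Construct.Symmetry using (↔-sym)
open import Level using (0ℓ)
open import Relation.Binary.Definitions using (tri<; tri≈; tri>)
import Relation.Binary.Reasoning.Setoid
open import Relation.Nullary using (yes; no; ¬_; contradiction; Dec)
open import Relation.Nullary.Decidable using (¬?; _×-dec_; _⊎-dec_)
open import Relation.Unary using (Decidable)
open import Relation.Binary.PropositionalEquality as ≡ using (_≡_)

-- Ring solving over an abstract commutative ring.

-- Integer coefficients let the ring solver recognise cancellations over an abstract ring.
module IntegerSolver {c ℓ} (R : CommutativeRing c ℓ) where
  open CommutativeRing R
  open import Data.Integer.Base as ℤ using (ℤ; +_; -[1+_]; _⊖_)
  import Data.Integer.Properties as ℤₚ
  open import Data.Maybe.Base using (Maybe; just; nothing)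
  open import Algebra.Solver.Ring.AlmostCommutativeRing
  open import Algebra.Properties.Semiring.Mult.TCOptimised semiring using (_×_; 1+×; ×-homo-+; ×1-homo-*)
  open import Algebra.Properties.Ring ring
  open import Algebra.Properties.AbelianGroup +-abelianGroup using (⁻¹-∙-comm)
  open import Relation.Binary.Reasoning.Setoid setoid

  ⟦_⟧ℤ : ℤ → Carrier
  ⟦ + n ⟧ℤ = n × 1#
  ⟦ -[1+ n ] ⟧ℤ = - (suc n × 1#)

  private

    neg-homo : ∀ x → ⟦ ℤ.- x ⟧ℤ ≈ - ⟦ x ⟧ℤ
    neg-homo (+ zero) = sym -0#≈0#
    neg-homo (+ suc n) = refl
    neg-homo -[1+ n ] = sym (-‿involutive _)

    cancel : ∀ a x y → (a + x) + - (a + y) ≈ x + - y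
    cancel a x y = begin
      (a + x) + - (a + y)    ≈⟨ +-congˡ (⁻¹-∙-comm a y) ⟨
      (a + x) + (- a + - y)  ≈⟨ +-congʳ (+-comm a x) ⟩
      (x + a) + (- a + - y)  ≈⟨ +-assoc x a _ ⟩
      x + (a + (- a + - y))  ≈⟨ +-congˡ (+-assoc a (- a) (- y)) ⟨
      x + ((a + - a) + - y)  ≈⟨ +-congˡ (+-congʳ (-‿inverseʳ a)) ⟩
      x + (0# + - y)         ≈⟨ +-congˡ (+-identityˡ _) ⟩
      x + - y                ∎

    ⊖-homo : ∀ m n → ⟦ m ⊖ n ⟧ℤ ≈ (m × 1#) + - (n × 1#)
    ⊖-homo m zero = begin
      m × 1# ≈⟨ +-identityʳ _ ⟨
      m × 1# + 0# ≈⟨ +-congˡ -0#≈0# ⟨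
      m × 1# + - 0# ∎
    ⊖-homo zero (suc n) = sym (+-identityˡ _)
    ⊖-homo (suc m) (suc n) = begin
      ⟦ suc m ⊖ suc n ⟧ℤ ≡⟨ ≡.cong ⟦_⟧ℤ (ℤₚ.[1+m]⊖[1+n]≡m⊖n m n) ⟩
      ⟦ m ⊖ n ⟧ℤ ≈⟨ ⊖-homo m n ⟩
      (m × 1#) + - (n × 1#) ≈⟨ cancel 1# _ _ ⟨
      (1# + m × 1#) + - (1# + n × 1#) ≈⟨ +-cong (1+× m 1#) (-‿cong (1+× n 1#)) ⟨
      (suc m × 1#) + - (suc n × 1#) ∎

    add-homo : ∀ x y → ⟦ x ℤ.+ y ⟧ℤ ≈ ⟦ x ⟧ℤ + ⟦ y ⟧ℤ
    add-homo (+ m) (+ n) = ×-homo-+ 1# m n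
    add-homo (+ m) -[1+ n ] = ⊖-homo m (suc n)
    add-homo -[1+ m ] (+ n) = trans (⊖-homo n (suc m)) (+-comm _ _)
    add-homo -[1+ m ] -[1+ n ] = begin
      - (suc (suc (m ℕ.+ n)) × 1#) ≡⟨ ≡.cong (λ k → - (suc k × 1#)) (≡.sym (+-suc m n)) ⟩
      - ((suc m ℕ.+ suc n) × 1#) ≈⟨ -‿cong (×-homo-+ 1# (suc m) (suc n)) ⟩
      - (suc m × 1# + suc n × 1#) ≈⟨ ⁻¹-∙-comm _ _ ⟨
      - (suc m × 1#) + - (suc n × 1#) ∎
      where open import Data.Nat.Properties using (+-suc)

    pos-mul : ∀ m n → ⟦ + m ℤ.* + n ⟧ℤ ≈ (m × 1#) * (n × 1#)
    pos-mul m n = trans (reflexive (≡.cong ⟦_⟧ℤ (≡.sym (ℤₚ.pos-* m n)))) (×1-homo-* m n)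

    mul-homo : ∀ x y → ⟦ x ℤ.* y ⟧ℤ ≈ ⟦ x ⟧ℤ * ⟦ y ⟧ℤ
    mul-homo (+ m) (+ n) = pos-mul m n
    mul-homo (+ m) -[1+ n ] = begin
      ⟦ + m ℤ.* -[1+ n ] ⟧ℤ ≡⟨ ≡.cong ⟦_⟧ℤ (≡.sym (ℤₚ.neg-distribʳ-* (+ m) (+ suc n))) ⟩
      ⟦ ℤ.- (+ m ℤ.* + suc n) ⟧ℤ ≈⟨ neg-homo (+ m ℤ.* + suc n) ⟩
      - ⟦ + m ℤ.* + suc n ⟧ℤ ≈⟨ -‿cong (pos-mul m (suc n)) ⟩
      - ((m × 1#) * (suc n × 1#)) ≈⟨ -‿distribʳ-* _ _ ⟩
      (m × 1#) * - (suc n × 1#) ∎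
    mul-homo -[1+ m ] (+ n) = begin
      ⟦ -[1+ m ] ℤ.* + n ⟧ℤ ≡⟨ ≡.cong ⟦_⟧ℤ (≡.sym (ℤₚ.neg-distribˡ-* (+ suc m) (+ n))) ⟩
      ⟦ ℤ.- (+ suc m ℤ.* + n) ⟧ℤ ≈⟨ neg-homo (+ suc m ℤ.* + n) ⟩
      - ⟦ + suc m ℤ.* + n ⟧ℤ ≈⟨ -‿cong (pos-mul (suc m) n) ⟩
      - ((suc m × 1#) * (n × 1#)) ≈⟨ -‿distribˡ-* _ _ ⟩
      - (suc m × 1#) * (n × 1#) ∎
    mul-homo -[1+ m ] -[1+ n ] = begin
      ⟦ + suc m ℤ.* + suc n ⟧ℤ ≈⟨ pos-mul (suc m) (suc n) ⟩
      (suc m × 1#) * (suc n × 1#) ≈⟨ -‿involutive _ ⟨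
      - - ((suc m × 1#) * (suc n × 1#)) ≈⟨ -‿cong (-‿distribʳ-* _ _) ⟩
      - ((suc m × 1#) * - (suc n × 1#)) ≈⟨ -‿distribˡ-* _ _ ⟩
      - (suc m × 1#) * - (suc n × 1#) ∎

  morphism : ℤ.+-*-rawRing -Raw-AlmostCommutative⟶ fromCommutativeRing R
  morphism = record
    { ⟦_⟧ = ⟦_⟧ℤ ; +-homo = add-homo ; *-homo = mul-homo ; -‿homo = neg-homo
    ; 0-homo = refl ; 1-homo = refl }

  private
    coeff≟ : ∀ x y → Maybe (⟦ x ⟧ℤ ≈ ⟦ y ⟧ℤ)
    coeff≟ x y with x ℤₚ.≟ y
    ... | yes x≡y = just (reflexive (≡.cong ⟦_⟧ℤ x≡y))
    ... | no _ = nothing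

  open import Algebra.Solver.Ring ℤ.+-*-rawRing (fromCommutativeRing R) morphism coeff≟ public
    using (Polynomial; solve; _:=_; _:+_; _:*_; _:-_; :-_; con)

  :0 :1 : ∀ {n} → Polynomial n
  :0 = con (+ 0)
  :1 = con (+ 1)

-- Additivity of the Frobenius map.

prime∤! : ∀ {p} → Prime p → ∀ j → j ℕ.< p → ¬ (p ∣ j ℕ.!)
prime∤! pp zero 0<p p∣1 = ¬prime[1] (≡.subst Prime (∣1⇒≡1 p∣1) pp)
prime∤! pp (suc j) j<p p∣ with euclidsLemma (suc j) (j ℕ.!) pp p∣
... | inj₁ p∣sj = contradiction (∣⇒≤ p∣sj) (ℕₚ.<⇒≱ j<p)
... | inj₂ p∣j! = prime∤! pp j (ℕₚ.<-trans (ℕₚ.n<1+n j) j<p) p∣j!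

prime∣C : ∀ {p} → Prime p → ∀ k → 0 ℕ.< k → k ℕ.< p → p ∣ p choose k
prime∣C {p@(suc p-1)} pp k 0<k k<p with euclidsLemma (p choose k) (k ℕ.! ℕ.* (p ℕ.∸ k) ℕ.!) pp p∣prod
  where
  instance _ = k ℕₚ.!* (p ℕ.∸ k) !≢0
  prod≡p! : (p choose k) ℕ.* (k ℕ.! ℕ.* (p ℕ.∸ k) ℕ.!) ≡ p ℕ.!
  prod≡p! = ≡.trans (≡.cong (ℕ._* (k ℕ.! ℕ.* (p ℕ.∸ k) ℕ.!)) (nCk≡n!/k![n-k]! (ℕₚ.<⇒≤ k<p)))
                    (DM.m/n*n≡m (k![n∸k]!∣n! (ℕₚ.<⇒≤ k<p)))
  p∣prod : p ∣ (p choose k) ℕ.* (k ℕ.! ℕ.* (p ℕ.∸ k) ℕ.!)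
  p∣prod = ≡.subst (p ∣_) (≡.sym prod≡p!) (m∣m*n (p-1 ℕ.!))
... | inj₁ d = d
... | inj₂ d with euclidsLemma (k ℕ.!) ((p ℕ.∸ k) ℕ.!) pp d
...   | inj₁ e = contradiction e (prime∤! pp k k<p)
...   | inj₂ e = contradiction e (prime∤! pp (p ℕ.∸ k) (ℕₚ.∸-monoʳ-< {p} 0<k (ℕₚ.<⇒≤ k<p)))

module Frobenius {c ℓ} (R : CommutativeRing c ℓ) where
  open CommutativeRing R
  open import Algebra.Properties.Semiring.Mult semiring using (_×_; ×-assocˡ; ×-congʳ; ×-assoc-*; ×-congˡ; ×-homo-1; ×-cong)
  open import Algebra.Properties.Semiring.Exp semiring using (_^_; ^-congˡ; ^-congʳ; ^-assocʳ)
  open import Algebra.Properties.CommutativeSemiring.Binomial commutativeSemiring using (theorem; binomialTerm)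
  open import Algebra.Properties.Monoid.Sum +-monoid using (sum; sum-init-last; sum-cong-≋; sum-replicate-zero)
  open import Relation.Binary.Reasoning.Setoid setoid

  char-multiple : ∀ {p m} → p × 1# ≈ 0# → p ∣ m → ∀ x → m × x ≈ 0#
  char-multiple {p} {m} char (divides k ≡.refl) x = begin
    (k ℕ.* p) × x      ≈⟨ ×-congˡ {x} (ℕₚ.*-comm k p) ⟩
    (p ℕ.* k) × x      ≈⟨ ×-assocˡ x p k ⟨
    p × (k × x)        ≈⟨ ×-congʳ p (*-identityˡ _) ⟨
    p × (1# * (k × x)) ≈⟨ ×-assoc-* p 1# _ ⟨
    (p × 1#) * (k × x) ≈⟨ *-congʳ char ⟩
    0# * (k × x)       ≈⟨ zeroˡ _ ⟩
    0#                 ∎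

  -- The inner binomial coefficients are divisible by p. The ring is arbitrary because the result is
  -- applied to the field as well as to the power series over it.
  ^p-homo-+ : ∀ {p} → Prime p → p × 1# ≈ 0# → ∀ x y → (x + y) ^ p ≈ x ^ p + y ^ p
  ^p-homo-+ {p@(suc (suc r))} pp char x y = begin
    (x + y) ^ p
      ≈⟨ theorem p x y ⟩
    t Fin.zero + sum (λ i → t (Fin.suc i))
      ≈⟨ +-congˡ (sum-init-last (λ i → t (Fin.suc i))) ⟩
    t Fin.zero + (sum (λ i → t (Fin.suc (inject₁ i))) + t (Fin.suc (fromℕ (suc r))))
      ≈⟨ +-congˡ (+-cong (trans (sum-cong-≋ middle) (sum-replicate-zero (suc r))) last) ⟩
    t Fin.zero + (0# + x ^ p)
      ≈⟨ +-cong first (+-identityˡ _) ⟩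
    y ^ p + x ^ p
      ≈⟨ +-comm _ _ ⟩
    x ^ p + y ^ p ∎
    where
    t = binomialTerm x y p
    first : t Fin.zero ≈ y ^ p
    first = trans (×-homo-1 _) (*-identityˡ _)
    last : t (Fin.suc (fromℕ (suc r))) ≈ x ^ p
    last = begin
      (p choose toℕ (fromℕ p)) × (x ^ toℕ (fromℕ p) * y ^ (p ℕ.∸ toℕ (fromℕ p)))
        ≡⟨ ≡.cong (λ k → (p choose k) × (x ^ k * y ^ (p ℕ.∸ k))) (Fin.toℕ-fromℕ p) ⟩
      (p choose p) × (x ^ p * y ^ (p ℕ.∸ p))
        ≡⟨ ≡.cong₂ (λ a b → a × (x ^ p * y ^ b)) (nCn≡1 p) (ℕₚ.n∸n≡0 p) ⟩
      1 × (x ^ p * 1#)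
        ≈⟨ trans (×-homo-1 _) (*-identityʳ _) ⟩
      x ^ p ∎
    middle : ∀ i → t (Fin.suc (inject₁ i)) ≈ 0#
    middle i = char-multiple char
      (prime∣C pp _ (ℕ.s≤s ℕ.z≤n) (ℕ.s≤s (≡.subst (ℕ._< suc r) (≡.sym (Fin.toℕ-inject₁ i)) (Fin.toℕ<n i)))) _
  ^p-homo-+ {suc zero} pp = contradiction pp ¬prime[1]
  ^p-homo-+ {zero} pp = contradiction pp ¬prime[0]

  ^pᵉ-homo-+ : ∀ {p} → Prime p → p × 1# ≈ 0# → ∀ e x y → (x + y) ^ (p ℕ.^ e) ≈ x ^ (p ℕ.^ e) + y ^ (p ℕ.^ e)
  ^pᵉ-homo-+ {p} pp char zero x y = trans (*-identityʳ _) (sym (+-cong (*-identityʳ _) (*-identityʳ _)))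
  ^pᵉ-homo-+ {p} pp char (suc e) x y = begin
    (x + y) ^ (p ℕ.* p ℕ.^ e)                      ≈⟨ ^-assocʳ _ p _ ⟨
    ((x + y) ^ p) ^ (p ℕ.^ e)                      ≈⟨ ^-congˡ (p ℕ.^ e) (^p-homo-+ pp char x y) ⟩
    (x ^ p + y ^ p) ^ (p ℕ.^ e)                    ≈⟨ ^pᵉ-homo-+ pp char e _ _ ⟩
    (x ^ p) ^ (p ℕ.^ e) + (y ^ p) ^ (p ℕ.^ e)      ≈⟨ +-cong (^-assocʳ x p _) (^-assocʳ y p _) ⟩
    x ^ (p ℕ.* p ℕ.^ e) + y ^ (p ℕ.* p ℕ.^ e)      ∎

open import Data.Product using (_×_)
open import Relation.Binary.PropositionalEquality using (_≢_; refl; sym; trans; cong; cong₂; subst; module ≡-Reasoning)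

-- Arithmetic in a finite field.

module FieldBasics {N : ℕ} (K : FiniteField N) where
  open FiniteField K public

  commRing : CommutativeRing 0ℓ 0ℓ
  commRing = record { isCommutativeRing = isCommutativeRing }

  open CommutativeRing commRing public using
    ( +-assoc; +-comm; +-identityˡ; +-identityʳ; *-assoc; *-comm; *-identityˡ; *-identityʳ
    ; distribˡ; distribʳ; zeroˡ; zeroʳ; -‿inverseˡ; -‿inverseʳ )
  open IntegerSolver commRing public using (solve; _:=_; _:+_; _:*_; _:-_; :-_; :0; :1)
  module Mult = Algebra.Properties.Semiring.Mult (CommutativeRing.semiring commRing)
  module Exp = Algebra.Properties.Semiring.Exp (CommutativeRing.semiring commRing)
  module CExp = Algebra.Properties.CommutativeSemiring.Exp (CommutativeRing.commutativeSemiring commRing)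

  ι : ℕ → Carrier
  ι n = n Mult.× 1#

  ι-+ : ∀ m n → ι (m ℕ.+ n) ≡ ι m + ι n
  ι-+ = Mult.×-homo-+ 1#

  ι-* : ∀ m n → ι (m ℕ.* n) ≡ ι m * ι n
  ι-* = Mult.×1-homo-*

  ^≡Exp : ∀ x n → x ^ n ≡ x Exp.^ n
  ^≡Exp x zero = refl
  ^≡Exp x (suc n) = cong (x *_) (^≡Exp x n)

  ^-+ : ∀ x m n → x ^ (m ℕ.+ n) ≡ x ^ m * x ^ n
  ^-+ x m n rewrite ^≡Exp x (m ℕ.+ n) | ^≡Exp x m | ^≡Exp x n = Exp.^-homo-* x m n

  ^-* : ∀ x m n → x ^ (m ℕ.* n) ≡ (x ^ m) ^ n
  ^-* x m n rewrite ^≡Exp x (m ℕ.* n) | ^≡Exp (x ^ m) n | ^≡Exp x m = sym (Exp.^-assocʳ x m n)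

  *-^ : ∀ x y n → (x * y) ^ n ≡ x ^ n * y ^ n
  *-^ x y n rewrite ^≡Exp (x * y) n | ^≡Exp x n | ^≡Exp y n = CExp.^-distrib-* x y n

  1^ : ∀ n → 1# ^ n ≡ 1#
  1^ zero = refl
  1^ (suc n) = trans (*-identityˡ _) (1^ n)

  0^ : ∀ n → 0 ℕ.< n → 0# ^ n ≡ 0#
  0^ (suc n) _ = zeroˡ _

  inv : ∀ x → x ≢ 0# → Carrier
  inv x x≢0 = proj₁ (inverse x x≢0)

  *-inv : ∀ x (x≢0 : x ≢ 0#) → x * inv x x≢0 ≡ 1#
  *-inv x x≢0 = proj₂ (inverse x x≢0)

  *-cancelˡ : ∀ {x y z} → x ≢ 0# → x * y ≡ x * z → y ≡ z
  *-cancelˡ {x} {y} {z} x≢0 eq = begin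
    y                     ≡⟨ lem y ⟩
    inv x x≢0 * (x * y)   ≡⟨ cong (inv x x≢0 *_) eq ⟩
    inv x x≢0 * (x * z)   ≡⟨ lem z ⟨
    z                     ∎
    where
    open ≡-Reasoning
    lem : ∀ w → w ≡ inv x x≢0 * (x * w)
    lem w = trans (sym (*-identityˡ w)) (trans (cong (_* w) (trans (sym (*-inv x x≢0)) (*-comm _ _))) (*-assoc _ _ _))

  *≡0 : ∀ {x y} → x * y ≡ 0# → x ≡ 0# ⊎ y ≡ 0#
  *≡0 {x} {y} eq with x ≟ 0#
  ... | yes x≡0 = inj₁ x≡0
  ... | no x≢0 = inj₂ (*-cancelˡ x≢0 (trans eq (sym (zeroʳ x))))

  *≢0 : ∀ {x y} → x ≢ 0# → y ≢ 0# → x * y ≢ 0#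
  *≢0 x≢0 y≢0 eq with *≡0 eq
  ... | inj₁ e = x≢0 e
  ... | inj₂ e = y≢0 e

  ^≢0 : ∀ {x} n → x ≢ 0# → x ^ n ≢ 0#
  ^≢0 zero x≢0 e = 0≢1 (sym e)
  ^≢0 (suc n) x≢0 = *≢0 x≢0 (^≢0 n x≢0)

  ^≡0 : ∀ {x} n → x ^ n ≡ 0# → x ≡ 0#
  ^≡0 {x} n eq with x ≟ 0#
  ... | yes e = e
  ... | no x≢0 = contradiction eq (^≢0 n x≢0)

  inv* : ∀ x (x≢0 : x ≢ 0#) → inv x x≢0 * x ≡ 1#
  inv* x x≢0 = trans (*-comm _ _) (*-inv x x≢0)

  -≡0 : ∀ {x y} → x - y ≡ 0# → x ≡ y
  -≡0 {x} {y} eq = trans (solve 2 (λ x y → x := (x :- y) :+ y) refl x y) (trans (cong (_+ y) eq) (+-identityˡ y))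

  -self : ∀ x → x - x ≡ 0#
  -self = -‿inverseʳ

  sub-zero : ∀ x → x - 0# ≡ x
  sub-zero = solve 1 (λ x → x :- :0 := x) refl

  neg≡0 : ∀ {x} → - x ≡ 0# → x ≡ 0#
  neg≡0 {x} e = trans (solve 1 (λ x → x := :- (:- x)) refl x) (trans (cong -_ e) (solve 0 (:- :0 := :0) refl))
  1≢0 : 1# ≢ 0#
  1≢0 e = 0≢1 (sym e)

-- Formal power series and their derivative.

module PowerSeries {N : ℕ} (K : FiniteField N) where
  open FieldBasics K

  -- Polynomials are coefficient sequences for which a degree bound is proved separately. Sums,
  -- products and derivatives then need no normal form, and the ring solver applies to them.
  Ser : Set
  Ser = ℕ → Carrier

  infix 4 _≈_
  -- A record instead of a bare pointwise equality, so that both series can be inferred from the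
  -- type of a proof.
  record _≈_ (P Q : Ser) : Set where
    constructor pointwise
    field at : ∀ i → P i ≡ Q i
  open _≈_ public

  infixl 6 _⊕_
  infixl 7 _⊗_
  infix 8 ⊖_

  -- The recursion expands the left factor as P = P 0 + X P⁺ and avoids sums over pairs of indices.
  _⊕_ _⊗_ : Ser → Ser → Ser
  (P ⊕ Q) i = P i + Q i
  (P ⊗ Q) zero = P 0 * Q 0
  (P ⊗ Q) (suc i) = P 0 * Q (suc i) + ((P ∘ suc) ⊗ Q) i

  ⊖_ : Ser → Ser
  (⊖ P) i = - P i

  const : Carrier → Ser
  const a zero = a
  const a (suc i) = 0#

  0S 1S X : Ser
  0S i = 0#
  1S = const 1#
  X zero = 0#
  X (suc i) = const 1# i

  ⊗-pointwise : ∀ {P P′ Q Q′} → P ≈ P′ → Q ≈ Q′ → ∀ i → (P ⊗ Q) i ≡ (P′ ⊗ Q′) i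
  ⊗-pointwise P≈ Q≈ zero = cong₂ _*_ (at P≈ 0) (at Q≈ 0)
  ⊗-pointwise P≈ Q≈ (suc i) =
    cong₂ _+_ (cong₂ _*_ (at P≈ 0) (at Q≈ (suc i))) (⊗-pointwise (pointwise (at P≈ ∘ suc)) Q≈ i)

  -- Mirror image of the defining recursion, expanding the right factor; the two together give
  -- commutativity.
  ⊗-unfoldʳ : ∀ P Q i → (P ⊗ Q) (suc i) ≡ P (suc i) * Q 0 + (P ⊗ (Q ∘ suc)) i
  ⊗-unfoldʳ P Q zero = +-comm _ _
  ⊗-unfoldʳ P Q (suc i) = begin
    P 0 * Q (suc (suc i)) + ((P ∘ suc) ⊗ Q) (suc i)
      ≡⟨ cong (P 0 * Q (suc (suc i)) +_) (⊗-unfoldʳ (P ∘ suc) Q i) ⟩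
    P 0 * Q (suc (suc i)) + (P (suc (suc i)) * Q 0 + ((P ∘ suc) ⊗ (Q ∘ suc)) i)
      ≡⟨ solve 3 (λ a b c → a :+ (b :+ c) := b :+ (a :+ c)) refl _ _ _ ⟩
    P (suc (suc i)) * Q 0 + (P 0 * Q (suc (suc i)) + ((P ∘ suc) ⊗ (Q ∘ suc)) i) ∎
    where open ≡-Reasoning

  ⊗-comm-at : ∀ P Q i → (P ⊗ Q) i ≡ (Q ⊗ P) i
  ⊗-comm-at P Q zero = *-comm _ _
  ⊗-comm-at P Q (suc i) =
    trans (cong₂ _+_ (*-comm _ _) (⊗-comm-at (P ∘ suc) Q i)) (sym (⊗-unfoldʳ Q P i))

  ⊗-distribʳ-at : ∀ P Q R i → ((P ⊕ Q) ⊗ R) i ≡ (P ⊗ R) i + (Q ⊗ R) i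
  ⊗-distribʳ-at P Q R zero = distribʳ _ _ _
  ⊗-distribʳ-at P Q R (suc i) =
    trans (cong₂ _+_ (distribʳ _ _ _) (⊗-distribʳ-at (P ∘ suc) (Q ∘ suc) R i))
          (solve 4 (λ a b c d → (a :+ b) :+ (c :+ d) := (a :+ c) :+ (b :+ d)) refl _ _ _ _)

  scale-⊗ : ∀ a P Q i → ((λ j → a * P j) ⊗ Q) i ≡ a * (P ⊗ Q) i
  scale-⊗ a P Q zero = *-assoc _ _ _
  scale-⊗ a P Q (suc i) =
    trans (cong₂ _+_ (*-assoc _ _ _) (scale-⊗ a (P ∘ suc) Q i)) (sym (distribˡ _ _ _))

  ⊗-assoc-at : ∀ P Q R i → ((P ⊗ Q) ⊗ R) i ≡ (P ⊗ (Q ⊗ R)) i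
  ⊗-assoc-at P Q R zero = *-assoc _ _ _
  ⊗-assoc-at P Q R (suc i) = begin
    P 0 * Q 0 * R (suc i) + ((λ j → P 0 * Q (suc j) + ((P ∘ suc) ⊗ Q) j) ⊗ R) i
      ≡⟨ cong (P 0 * Q 0 * R (suc i) +_) (⊗-distribʳ-at (λ j → P 0 * Q (suc j)) ((P ∘ suc) ⊗ Q) R i) ⟩
    P 0 * Q 0 * R (suc i) + (((λ j → P 0 * Q (suc j)) ⊗ R) i + (((P ∘ suc) ⊗ Q) ⊗ R) i)
      ≡⟨ cong (P 0 * Q 0 * R (suc i) +_) (cong₂ _+_ (scale-⊗ (P 0) (Q ∘ suc) R i) (⊗-assoc-at (P ∘ suc) Q R i)) ⟩
    P 0 * Q 0 * R (suc i) + (P 0 * ((Q ∘ suc) ⊗ R) i + ((P ∘ suc) ⊗ (Q ⊗ R)) i)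
      ≡⟨ solve 5 (λ a b c d e → a :* b :* c :+ (a :* d :+ e) := a :* (b :* c :+ d) :+ e) refl _ _ _ _ _ ⟩
    P 0 * (Q ⊗ R) (suc i) + ((P ∘ suc) ⊗ (Q ⊗ R)) i ∎
    where open ≡-Reasoning

  0⊗ : ∀ Q i → (0S ⊗ Q) i ≡ 0#
  0⊗ Q zero = zeroˡ _
  0⊗ Q (suc i) = trans (cong₂ _+_ (zeroˡ _) (0⊗ Q i)) (+-identityˡ _)

  const-⊗ : ∀ a Q i → (const a ⊗ Q) i ≡ a * Q i
  const-⊗ a Q zero = refl
  const-⊗ a Q (suc i) = trans (cong (a * Q (suc i) +_) (0⊗ Q i)) (+-identityʳ _)

  X⊗-suc : ∀ P i → (X ⊗ P) (suc i) ≡ P i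
  X⊗-suc P i = trans (cong₂ _+_ (zeroˡ _) (trans (const-⊗ 1# P i) (*-identityˡ _))) (+-identityˡ _)

  X⊗-zero : ∀ P → (X ⊗ P) 0 ≡ 0#
  X⊗-zero P = zeroˡ _

  serRing : CommutativeRing 0ℓ 0ℓ
  serRing = record
    { Carrier = Ser ; _≈_ = _≈_ ; _+_ = _⊕_ ; _*_ = _⊗_ ; -_ = ⊖_ ; 0# = 0S ; 1# = 1S
    ; isCommutativeRing = record
      { isRing = record
        { +-isAbelianGroup = record
          { isGroup = record
            { isMonoid = record
              { isSemigroup = record
                { isMagma = record
                  { isEquivalence = record
                    { refl = pointwise λ _ → refl
                    ; sym = λ e → pointwise λ i → sym (at e i)
                    ; trans = λ e f → pointwise λ i → trans (at e i) (at f i) }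
                  ; ∙-cong = λ e f → pointwise λ i → cong₂ _+_ (at e i) (at f i) }
                ; assoc = λ P Q R → pointwise λ i → +-assoc _ _ _ }
              ; identity = (λ P → pointwise λ i → +-identityˡ _) , (λ P → pointwise λ i → +-identityʳ _) }
            ; inverse = (λ P → pointwise λ i → -‿inverseˡ _) , (λ P → pointwise λ i → -‿inverseʳ _)
            ; ⁻¹-cong = λ e → pointwise λ i → cong -_ (at e i) }
          ; comm = λ P Q → pointwise λ i → +-comm _ _ }
        ; *-cong = λ e f → pointwise (⊗-pointwise e f)
        ; *-assoc = λ P Q R → pointwise (⊗-assoc-at P Q R)
        ; *-identity = (λ P → pointwise (1⊗ P)) , (λ P → pointwise λ i → trans (⊗-comm-at P 1S i) (1⊗ P i))
        ; distrib = (λ P Q R → pointwise λ i → trans (⊗-comm-at P (Q ⊕ R) i)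
                       (trans (⊗-distribʳ-at Q R P i) (cong₂ _+_ (⊗-comm-at Q P i) (⊗-comm-at R P i))))
                  , (λ P Q R → pointwise (⊗-distribʳ-at Q R P)) }
      ; *-comm = λ P Q → pointwise (⊗-comm-at P Q) } }
    where
    open import Data.Product using (_,_)
    1⊗ : ∀ P i → (1S ⊗ P) i ≡ P i
    1⊗ P i = trans (const-⊗ 1# P i) (*-identityˡ _)

  module S = CommutativeRing serRing
  module ≈-Reasoning = Relation.Binary.Reasoning.Setoid S.setoid
  open IntegerSolver serRing public using () renaming
    (solve to solveS; _:=_ to _⩴_; _:+_ to _⊞_; _:*_ to _⊠_; _:-_ to _⊟_; :-_ to ⊟_; :0 to 𝟘; :1 to 𝟙)
  module SExp = Algebra.Properties.Semiring.Exp S.semiring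
  module SMult = Algebra.Properties.Semiring.Mult S.semiring
  open SExp public using () renaming (_^_ to _↑_)

  -- θ is the Euler operator X d/dX. It keeps indices in place, so its product rule follows by
  -- induction along the recursion of `_⊗_`; the derivative D is θ shifted by one place.
  θ D : Ser → Ser
  θ P i = ι i * P i
  D P i = ι (suc i) * P (suc i)

  θ-⊗-at : ∀ P Q i → θ (P ⊗ Q) i ≡ (θ P ⊗ Q) i + (P ⊗ θ Q) i
  θ-⊗-at P Q zero = solve 2 (λ a b → :0 :* (a :* b) := (:0 :* a) :* b :+ a :* (:0 :* b)) refl _ _
  θ-⊗-at P Q (suc i) = begin
    (1# + ι i) * (P 0 * Q (suc i) + (P⁺ ⊗ Q) i)
      ≡⟨ solve 4 (λ n a b c → (:1 :+ n) :* (a :* b :+ c) := a :* ((:1 :+ n) :* b) :+ (c :+ n :* c)) refl (ι i) (P 0) (Q (suc i)) ((P⁺ ⊗ Q) i) ⟩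
    P 0 * ((1# + ι i) * Q (suc i)) + ((P⁺ ⊗ Q) i + ι i * (P⁺ ⊗ Q) i)
      ≡⟨ cong (λ z → P 0 * ((1# + ι i) * Q (suc i)) + ((P⁺ ⊗ Q) i + z)) (θ-⊗-at P⁺ Q i) ⟩
    P 0 * θ Q (suc i) + ((P⁺ ⊗ Q) i + ((θ P⁺ ⊗ Q) i + (P⁺ ⊗ θ Q) i))
      ≡⟨ solve 6 (λ x y z a b c → x :+ (a :+ (b :+ c)) := ((:0 :* y) :* z :+ (b :+ a)) :+ (x :+ c)) refl _ (P 0) (Q (suc i)) _ _ _ ⟩
    (0# * P 0 * Q (suc i) + ((θ P⁺ ⊗ Q) i + (P⁺ ⊗ Q) i)) + (P 0 * θ Q (suc i) + (P⁺ ⊗ θ Q) i)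
      ≡⟨ cong (λ z → (0# * P 0 * Q (suc i) + z) + (P 0 * θ Q (suc i) + (P⁺ ⊗ θ Q) i)) (sym (trans (⊗-pointwise {Q = Q} θP⁺ S.refl i) (⊗-distribʳ-at (θ P⁺) P⁺ Q i))) ⟩
    (θ P ⊗ Q) (suc i) + (P ⊗ θ Q) (suc i) ∎
    where
    open ≡-Reasoning
    P⁺ = P ∘ suc
    θP⁺ : (θ P ∘ suc) ≈ θ P⁺ ⊕ P⁺
    θP⁺ = pointwise λ j → solve 2 (λ n a → (:1 :+ n) :* a := n :* a :+ a) refl (ι j) (P (suc j))

  D-⊗ : ∀ P Q → D (P ⊗ Q) ≈ (D P ⊗ Q) ⊕ (P ⊗ D Q)
  D-⊗ P Q = pointwise λ i → begin
    θ (P ⊗ Q) (suc i)                                                  ≡⟨ θ-⊗-at P Q (suc i) ⟩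
    (0# * P 0 * Q (suc i) + (D P ⊗ Q) i) + (P ⊗ θ Q) (suc i)           ≡⟨ cong ((0# * P 0 * Q (suc i) + (D P ⊗ Q) i) +_) (⊗-unfoldʳ P (θ Q) i) ⟩
    (0# * P 0 * Q (suc i) + (D P ⊗ Q) i) + (P (suc i) * (0# * Q 0) + (P ⊗ D Q) i)
      ≡⟨ solve 6 (λ a b c d x y → (:0 :* a :* b :+ x) :+ (c :* (:0 :* d) :+ y) := x :+ y) refl _ _ _ _ _ _ ⟩
    (D P ⊗ Q) i + (P ⊗ D Q) i ∎
    where open ≡-Reasoning

  D-⊕ : ∀ P Q → D (P ⊕ Q) ≈ D P ⊕ D Q
  D-⊕ P Q = pointwise λ i → distribˡ _ _ _

  D-⊖ : ∀ P → D (⊖ P) ≈ ⊖ D P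
  D-⊖ P = pointwise λ i → solve 2 (λ a b → a :* :- b := :- (a :* b)) refl _ _

  D-const : ∀ a → D (const a) ≈ 0S
  D-const a = pointwise λ i → zeroʳ _

  D-cong : ∀ {P Q} → P ≈ Q → D P ≈ D Q
  D-cong e = pointwise λ i → cong (ι (suc i) *_) (at e (suc i))

  D-X : D X ≈ 1S
  D-X = pointwise λ { zero → trans (*-identityʳ _) (+-identityʳ _) ; (suc i) → zeroʳ _ }

-- Counting in lists, and arithmetic of prime powers.

module _ {A : Set} {P : A → Set} (P? : Decidable P) where

  length-filter-¬ : ∀ L → length (filter P? L) ℕ.+ length (filter (λ x → ¬? (P? x)) L) ≡ length L
  length-filter-¬ [] = refl
  length-filter-¬ (x ∷ L) with P? x
  ... | yes _ = cong suc (length-filter-¬ L)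
  ... | no _ = trans (ℕₚ.+-suc _ _) (cong suc (length-filter-¬ L))

  module _ {Q : A → Set} (Q? : Decidable Q) where

    filter-filter : ∀ L → (∀ x → x ∈ L → Q x → P x) → filter Q? (filter P? L) ≡ filter Q? L
    filter-filter [] h = refl
    filter-filter (x ∷ L) h with P? x
    ... | yes _ with Q? x
    ...   | yes _ = cong (x ∷_) (filter-filter L (λ y y∈ → h y (there y∈)))
    ...   | no _ = filter-filter L (λ y y∈ → h y (there y∈))
    filter-filter (x ∷ L) h | no ¬p with Q? x
    ...   | yes q = contradiction (h x (here refl) q) ¬p
    ...   | no _ = filter-filter L (λ y y∈ → h y (there y∈))

nonZero : ∀ {m} → 1 ℕ.< m → ℕ.NonZero m
nonZero 1<m = ℕ.>-nonZero (ℕₚ.<-trans ℕₚ.0<1+n 1<m)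

^-cancelʳ-≡ : ∀ p {a b} → 1 ℕ.< p → p ℕ.^ a ≡ p ℕ.^ b → a ≡ b
^-cancelʳ-≡ p {a} {b} 1<p e with ℕₚ.<-cmp a b
... | tri< a<b _ _ = contradiction e (ℕₚ.<⇒≢ (ℕₚ.^-monoʳ-< p 1<p a<b))
... | tri≈ _ a≡b _ = a≡b
... | tri> _ _ b<a = contradiction (sym e) (ℕₚ.<⇒≢ (ℕₚ.^-monoʳ-< p 1<p b<a))

divisor-of-prime-power : ∀ {p} → Prime p → ∀ n d e → d ℕ.* e ≡ p ℕ.^ n →
  ∃ λ k → k ℕ.≤ n × d ≡ p ℕ.^ k × e ≡ p ℕ.^ (n ℕ.∸ k)
divisor-of-prime-power pp zero d e eq = 0 , ℕ.z≤n , ℕₚ.m*n≡1⇒m≡1 d e eq , ℕₚ.m*n≡1⇒n≡1 d e eq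
divisor-of-prime-power {p} pp (suc n) d e eq with euclidsLemma d e pp (divides (p ℕ.^ n) (trans eq (ℕₚ.*-comm p _)))
... | inj₁ (divides d′ refl) with divisor-of-prime-power pp n d′ e (ℕₚ.*-cancelˡ-≡ _ _ p {{p≢0}}
        (trans (trans (sym (ℕₚ.*-assoc p d′ e)) (cong (ℕ._* e) (ℕₚ.*-comm p d′))) eq))
  where p≢0 = ℕ.>-nonZero (ℕₚ.<-trans ℕₚ.0<1+n (ℕ.nonTrivial⇒n>1 p {{prime⇒nonTrivial pp}}))
...   | k , k≤n , refl , e≡ = suc k , ℕ.s≤s k≤n , ℕₚ.*-comm (p ℕ.^ k) p , e≡
divisor-of-prime-power {p} pp (suc n) d e eq | inj₂ (divides e′ refl) with divisor-of-prime-power pp n d e′ (ℕₚ.*-cancelʳ-≡ _ _ p {{p≢0}}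
        (trans (ℕₚ.*-assoc d e′ p) (trans eq (ℕₚ.*-comm p _))))
  where p≢0 = ℕ.>-nonZero (ℕₚ.<-trans ℕₚ.0<1+n (ℕ.nonTrivial⇒n>1 p {{prime⇒nonTrivial pp}}))
...   | k , k≤n , d≡ , refl = k , ℕₚ.m≤n⇒m≤1+n k≤n , d≡ ,
          trans (ℕₚ.*-comm (p ℕ.^ (n ℕ.∸ k)) p) (cong (p ℕ.^_) (sym (ℕₚ.+-∸-assoc 1 k≤n)))

argmin : ∀ {n} (f : Fin (suc n) → ℕ) → ∃ λ i → ∀ j → f i ℕ.≤ f j
argmin {zero} f = zero , λ { zero → ℕₚ.≤-refl }
argmin {suc n} f with argmin (f ∘ suc)
... | i , h with f zero ℕ.≤? f (suc i)
...   | yes f0≤ = zero , λ { zero → ℕₚ.≤-refl ; (suc j) → ℕₚ.≤-trans f0≤ (h j) }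
...   | no f0≰ = suc i , λ { zero → ℕₚ.<⇒≤ (ℕₚ.≰⇒> f0≰) ; (suc j) → h j }

-- Applied to the lines through one point of the clique, which have no other point in common: m
-- lines with at least ν further points each need m ν further points.
disjoint-filters : ∀ {A : Set} m ν {P : Fin m → A → Set} (P? : ∀ k → Decidable (P k)) (L : List A) →
  (∀ x → x ∈ L → ∀ j k → P j x → P k x → j ≡ k) → (∀ k → ν ℕ.≤ length (filter (P? k) L)) → m ℕ.* ν ℕ.≤ length L
disjoint-filters zero ν P? L dis big = ℕ.z≤n
disjoint-filters (suc m) ν P? L dis big = ℕₚ.≤-trans
  (ℕₚ.+-mono-≤ (big zero) (disjoint-filters m ν (P? ∘ suc) rest dis′ big′))
  (ℕₚ.≤-reflexive (length-filter-¬ (P? zero) L))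
  where
  rest = filter (λ x → ¬? (P? zero x)) L
  rest⊆ : ∀ {x} → x ∈ rest → x ∈ L
  rest⊆ x∈ = proj₁ (∈-filter⁻ (λ x → ¬? (P? zero x)) {xs = L} x∈)
  dis′ : ∀ x → x ∈ rest → ∀ j k → _ → _ → j ≡ k
  dis′ x x∈ j k Pj Pk = Fin.suc-injective (dis x (rest⊆ x∈) (suc j) (suc k) Pj Pk)
  big′ : ∀ k → ν ℕ.≤ length (filter (P? (suc k)) rest)
  big′ k = subst (λ l → ν ℕ.≤ length l)
    (sym (filter-filter (λ x → ¬? (P? zero x)) (P? (suc k)) L (λ x x∈ Pk P0 → contradiction (dis x x∈ zero (suc k) P0 Pk) λ ())))
    (big (suc k))

length-filter-unique : ∀ {A : Set} {P : A → Set} (P? : Decidable P) L → Unique L →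
  (∀ x y → x ∈ L → y ∈ L → P x → P y → x ≡ y) → length (filter P? L) ℕ.≤ 1
length-filter-unique P? [] u h = ℕ.z≤n
length-filter-unique {P = P} P? (x ∷ L) (x∉ ∷ u) h with P? x
... | no _ = length-filter-unique P? L u (λ y z y∈ z∈ → h y z (there y∈) (there z∈))
... | yes px = ℕ.s≤s (ℕₚ.≤-reflexive (none L (λ y y∈ py → All.lookup x∉ y∈ (h x y (here refl) (there y∈) px py))))
  where
  none : ∀ M → (∀ y → y ∈ M → ¬ P y) → length (filter P? M) ≡ 0
  none [] _ = refl
  none (y ∷ M) ¬P with P? y
  ... | yes py = contradiction py (¬P y (here refl))
  ... | no _ = none M (λ z z∈ → ¬P z (there z∈))

-- With s = σ + 2, m = r + 2 and q = sQ the first two hypotheses give (s + 1)(m − 1) < 2q.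
degree-estimate : ∀ σ r Q → suc (suc r) ℕ.* suc σ ℕ.< suc (suc σ) ℕ.* Q → suc (suc r) ℕ.+ suc (suc r) ℕ.≤ suc (suc σ) ℕ.* Q →
  ∀ i l → suc (suc σ) ℕ.* i ℕ.< suc (suc r) → Q ℕ.+ l ℕ.< suc (suc r) → i ℕ.+ l ℕ.< Q
degree-estimate σ r Q small double i l si< Ql< with i ℕ.+ l ℕ.<? Q
... | Relation.Nullary.yes p = p
... | Relation.Nullary.no ≰ = contradiction total (ℕₚ.<⇒≱ strict)
  where
  s m : ℕ
  s = suc (suc σ)
  m = suc (suc r)
  Q≤ : Q ℕ.≤ i ℕ.+ l
  Q≤ = ℕₚ.≮⇒≥ ≰
  -- 2sQ ≤ s(i + l) + sQ = si + s(Q + l) ≤ (s + 1)(m − 1)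
  total : s ℕ.* Q ℕ.+ s ℕ.* Q ℕ.≤ suc r ℕ.+ s ℕ.* suc r
  total = ℕₚ.≤-trans (ℕₚ.+-monoˡ-≤ (s ℕ.* Q) (ℕₚ.*-monoʳ-≤ s Q≤))
    (ℕₚ.≤-trans (ℕₚ.≤-reflexive (solve 4 (λ s i l Q → s :* (i :+ l) :+ s :* Q := s :* i :+ s :* (Q :+ l)) refl s i l Q))
      (ℕₚ.+-mono-≤ (ℕₚ.≤-pred si<) (ℕₚ.*-monoʳ-≤ s (ℕₚ.≤-pred Ql<))))
    where open +-*-Solver
  strict : suc r ℕ.+ s ℕ.* suc r ℕ.< s ℕ.* Q ℕ.+ s ℕ.* Q
  -- The two hypotheses add up to (s + 1) m + 1 ≤ 2sQ, so the slack `suc σ + 2` is s + 1.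
  strict = ℕₚ.≤-trans (ℕₚ.≤-trans (ℕₚ.m≤m+n _ (suc σ ℕ.+ 2))
    (ℕₚ.≤-reflexive (solve 2 (λ σ r → (con 1 :+ ((con 1 :+ r) :+ (con 2 :+ σ) :* (con 1 :+ r))) :+ (con 1 :+ σ :+ con 2)
      := (con 1 :+ (con 2 :+ r) :* (con 1 :+ σ)) :+ ((con 2 :+ r) :+ (con 2 :+ r))) refl σ r)))
    (ℕₚ.+-mono-≤ small double)
    where open +-*-Solver

-- Polynomials: degree, evaluation and roots.

module Polynomials {N : ℕ} (K : FiniteField N) where
  open FieldBasics K
  open PowerSeries K

  -- A strict bound: the degree is smaller than d.
  Deg : Ser → ℕ → Set
  Deg P d = ∀ i → d ℕ.≤ i → P i ≡ 0#

  Finite : Ser → Set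
  Finite P = ∃ (Deg P)

  ⊗-zero-at : ∀ P Q i → (∀ a b → a ℕ.+ b ≡ i → P a * Q b ≡ 0#) → (P ⊗ Q) i ≡ 0#
  ⊗-zero-at P Q zero h = h 0 0 refl
  ⊗-zero-at P Q (suc i) h =
    trans (cong₂ _+_ (h 0 (suc i) refl) (⊗-zero-at (P ∘ suc) Q i (λ a b e → h (suc a) b (cong suc e)))) (+-identityˡ _)

  ⊗-single-at : ∀ P Q i j → (∀ a b → a ℕ.+ b ≡ i ℕ.+ j → a ≢ i → P a * Q b ≡ 0#) → (P ⊗ Q) (i ℕ.+ j) ≡ P i * Q j
  ⊗-single-at P Q zero zero h = refl
  ⊗-single-at P Q zero (suc j) h =
    trans (cong (P 0 * Q (suc j) +_) (⊗-zero-at (P ∘ suc) Q j (λ a b e → h (suc a) b (cong suc e) λ ()))) (+-identityʳ _)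
  ⊗-single-at P Q (suc i) j h =
    trans (cong₂ _+_ (h 0 (suc (i ℕ.+ j)) refl λ ())
                     (⊗-single-at (P ∘ suc) Q i j (λ a b e a≢i → h (suc a) b (cong suc e) (a≢i ∘ ℕₚ.suc-injective))))
          (+-identityˡ _)

  Deg-cong : ∀ {P Q d} → P ≈ Q → Deg P d → Deg Q d
  Deg-cong e h i d≤i = trans (sym (at e i)) (h i d≤i)

  Deg-mono : ∀ {P d d′} → d ℕ.≤ d′ → Deg P d → Deg P d′
  Deg-mono d≤d′ h i d′≤i = h i (ℕₚ.≤-trans d≤d′ d′≤i)

  Deg-⊕ : ∀ {P Q d} → Deg P d → Deg Q d → Deg (P ⊕ Q) d
  Deg-⊕ hP hQ i d≤i = trans (cong₂ _+_ (hP i d≤i) (hQ i d≤i)) (+-identityˡ _)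

  -0≡0 : - 0# ≡ 0#
  -0≡0 = solve 0 (:- :0 := :0) refl

  Deg-⊖ : ∀ {P d} → Deg P d → Deg (⊖ P) d
  Deg-⊖ hP i d≤i = trans (cong -_ (hP i d≤i)) -0≡0

  Deg-0S : ∀ {d} → Deg 0S d
  Deg-0S i _ = refl

  Deg-const : ∀ {a} → Deg (const a) 1
  Deg-const (suc i) _ = refl

  Deg-X : Deg X 2
  Deg-X (suc zero) (ℕ.s≤s ())
  Deg-X (suc (suc i)) _ = refl

  X-other : ∀ {i} → i ≢ 1 → X i ≡ 0#
  X-other {zero} _ = refl
  X-other {suc zero} ne = contradiction refl ne
  X-other {suc (suc i)} _ = refl

  Deg-D : ∀ {P d} → Deg P (suc d) → Deg (D P) d
  Deg-D hP i d≤i = trans (cong (ι (suc i) *_) (hP (suc i) (ℕ.s≤s d≤i))) (zeroʳ _)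

  private
    too-large : ∀ {a b x y d} → a ℕ.+ b ℕ.≤ suc d → d ℕ.≤ x ℕ.+ y → a ℕ.≤ x ⊎ b ℕ.≤ y
    too-large {a} {b} {x} {y} {d} ab≤ d≤ with a ℕ.≤? x | b ℕ.≤? y
    ... | yes p | _ = inj₁ p
    ... | no _ | yes q = inj₂ q
    ... | no a≰x | no b≰y = contradiction
      (ℕₚ.≤-trans (ℕₚ.≤-trans (ℕₚ.≤-reflexive (cong suc (sym (ℕₚ.+-suc x y)))) (ℕₚ.+-mono-≤ (ℕₚ.≰⇒> a≰x) (ℕₚ.≰⇒> b≰y))) ab≤)
      (ℕₚ.<⇒≱ (ℕ.s≤s (ℕ.s≤s d≤)))

  zeroed : ∀ {a b : Carrier} → a ≡ 0# ⊎ b ≡ 0# → a * b ≡ 0#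
  zeroed {b = b} (inj₁ e) = trans (cong (_* b) e) (zeroˡ _)
  zeroed {a = a} (inj₂ e) = trans (cong (a *_) e) (zeroʳ _)

  Deg-⊗ : ∀ {P Q a b d} → Deg P a → Deg Q b → a ℕ.+ b ℕ.≤ suc d → Deg (P ⊗ Q) d
  Deg-⊗ {P} {Q} {a} {b} {d} hP hQ ab≤ i d≤i = ⊗-zero-at P Q i vanish
    where
    vanish : ∀ x y → x ℕ.+ y ≡ i → P x * Q y ≡ 0#
    vanish x y refl with too-large {a} {b} {x} {y} {d} ab≤ d≤i
    ... | inj₁ p = zeroed (inj₁ (hP x p))
    ... | inj₂ q = zeroed (inj₂ (hQ y q))

  ⊗-top : ∀ {P Q i j} → Deg P (suc i) → Deg Q (suc j) → (P ⊗ Q) (i ℕ.+ j) ≡ P i * Q j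
  ⊗-top {P} {Q} {i} {j} hP hQ = ⊗-single-at P Q i j vanish
    where
    vanish : ∀ a b → a ℕ.+ b ≡ i ℕ.+ j → a ≢ i → P a * Q b ≡ 0#
    vanish a b e a≢i with ℕₚ.<-cmp a i
    ... | tri> _ _ i<a = zeroed (inj₁ (hP a i<a))
    ... | tri≈ _ a≡i _ = contradiction a≡i a≢i
    ... | tri< a<i _ _ = zeroed (inj₂ (hQ b (ℕₚ.≰⇒> λ b≤j → ℕₚ.<⇒≢ (ℕₚ.+-mono-<-≤ a<i b≤j) e)))

  Finite-⊗ : ∀ {P Q} → Finite P → Finite Q → Finite (P ⊗ Q)
  Finite-⊗ (a , hP) (b , hQ) = a ℕ.+ b , Deg-⊗ hP hQ (ℕₚ.n≤1+n _)

  Finite-⊕ : ∀ {P Q} → Finite P → Finite Q → Finite (P ⊕ Q)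
  Finite-⊕ (a , hP) (b , hQ) = a ℕ.⊔ b , Deg-⊕ (Deg-mono (ℕₚ.m≤m⊔n a b) hP) (Deg-mono (ℕₚ.m≤n⊔m a b) hQ)

  Finite-⊖ : ∀ {P} → Finite P → Finite (⊖ P)
  Finite-⊖ (a , hP) = a , Deg-⊖ hP

  Finite-D : ∀ {P} → Finite P → Finite (D P)
  Finite-D (a , hP) = a , Deg-D (Deg-mono (ℕₚ.n≤1+n a) hP)

  Finite-↑ : ∀ {P} n → Finite P → Finite (P ↑ n)
  Finite-↑ zero _ = 1 , Deg-const
  Finite-↑ (suc n) hP = Finite-⊗ hP (Finite-↑ n hP)

  abstract
    zero-or-top : ∀ {P} d → Deg P d → P ≈ 0S ⊎ ∃ λ i → i ℕ.< d × P i ≢ 0# × Deg P (suc i)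
    zero-or-top zero hP = inj₁ (pointwise λ i → hP i ℕ.z≤n)
    zero-or-top {P} (suc d) hP with P d ≟ 0#
    ... | no Pd≢0 = inj₂ (d , ℕₚ.n<1+n d , Pd≢0 , hP)
    ... | yes Pd≡0 with zero-or-top d hP′
      where
      hP′ : Deg P d
      hP′ i d≤i with ℕₚ.m≤n⇒m<n∨m≡n d≤i
      ... | inj₁ d<i = hP i d<i
      ... | inj₂ refl = Pd≡0
    ...   | inj₁ P≈0 = inj₁ P≈0
    ...   | inj₂ (i , i<d , ne , h) = inj₂ (i , ℕₚ.m<n⇒m<1+n i<d , ne , h)

  abstract
    ⊗-domain : ∀ {P Q} → Finite P → Finite Q → P ⊗ Q ≈ 0S → P ≈ 0S ⊎ Q ≈ 0S
    ⊗-domain {P} {Q} (a , hP) (b , hQ) e with zero-or-top a hP | zero-or-top b hQ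
    ... | inj₁ p | _ = inj₁ p
    ... | inj₂ _ | inj₁ q = inj₂ q
    ... | inj₂ (i , _ , Pi≢0 , hi) | inj₂ (j , _ , Qj≢0 , hj) =
      contradiction (trans (sym (⊗-top {P} {Q} hi hj)) (at e (i ℕ.+ j))) (*≢0 Pi≢0 Qj≢0)

  -- Leading coefficients multiply and R is monic. The form T ≤ n + i of the bound avoids
  -- subtraction and includes the case T ≤ n, where C is zero.
  Deg-cofactor : ∀ {R C n T} → Deg R (suc n) → R n ≡ 1# → Finite C → Deg (R ⊗ C) T → ∀ i → T ℕ.≤ n ℕ.+ i → C i ≡ 0#
  Deg-cofactor {R} {C} {n} {T} hR Rn (a , hC) hRC i T≤ with zero-or-top a hC
  ... | inj₁ C≈0 = at C≈0 i
  ... | inj₂ (t , _ , Ct≢0 , ht) with suc t ℕ.≤? i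
  ...   | yes t<i = ht i t<i
  ...   | no t≮i = contradiction
    (trans (sym (trans (⊗-top {R} {C} hR ht) (trans (cong (_* C t) Rn) (*-identityˡ _))))
           (hRC (n ℕ.+ t) (ℕₚ.≤-trans T≤ (ℕₚ.+-monoʳ-≤ n (ℕₚ.≮⇒≥ t≮i)))))
    Ct≢0

  ev : ℕ → Ser → Carrier → Carrier
  ev zero P x = 0#
  ev (suc d) P x = P 0 + x * ev d (P ∘ suc) x

  ev-cong : ∀ d {P Q} x → P ≈ Q → ev d P x ≡ ev d Q x
  ev-cong zero x e = refl
  ev-cong (suc d) x e = cong₂ (λ a b → a + x * b) (at e 0) (ev-cong d x (pointwise (at e ∘ suc)))

  ev-zero : ∀ d {P} x → (∀ i → P i ≡ 0#) → ev d P x ≡ 0#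
  ev-zero zero x h = refl
  ev-zero (suc d) x h =
    trans (cong₂ (λ a b → a + x * b) (h 0) (ev-zero d x (h ∘ suc))) (trans (+-identityˡ _) (zeroʳ _))

  ev-⊕ : ∀ d P Q x → ev d (P ⊕ Q) x ≡ ev d P x + ev d Q x
  ev-⊕ zero P Q x = sym (+-identityˡ _)
  ev-⊕ (suc d) P Q x = trans (cong (λ z → P 0 + Q 0 + x * z) (ev-⊕ d (P ∘ suc) (Q ∘ suc) x))
    (solve 5 (λ a b c d x → (a :+ b) :+ x :* (c :+ d) := (a :+ x :* c) :+ (b :+ x :* d)) refl _ _ _ _ _)

  ev-scale : ∀ d a P x → ev d (λ i → a * P i) x ≡ a * ev d P x
  ev-scale zero a P x = sym (zeroʳ a)
  ev-scale (suc d) a P x = trans (cong (λ z → a * P 0 + x * z) (ev-scale d a (P ∘ suc) x))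
    (solve 4 (λ a p x y → a :* p :+ x :* (a :* y) := a :* (p :+ x :* y)) refl _ _ _ _)

  ev-bound : ∀ {d d′ P} x → d ℕ.≤ d′ → Deg P d → ev d′ P x ≡ ev d P x
  ev-bound {d′ = d′} x ℕ.z≤n hP = ev-zero d′ x (λ i → hP i ℕ.z≤n)
  ev-bound {P = P} x (ℕ.s≤s d≤d′) hP = cong (λ z → P 0 + x * z) (ev-bound x d≤d′ (λ i d≤i → hP (suc i) (ℕ.s≤s d≤i)))

  ev-⊗ : ∀ d e P Q x → Deg P d → Deg Q e → ev (d ℕ.+ e) (P ⊗ Q) x ≡ ev d P x * ev e Q x
  ev-⊗ zero e P Q x hP hQ =
    trans (ev-zero e x (λ i → ⊗-zero-at P Q i (λ a b _ → zeroed (inj₁ (hP a ℕ.z≤n))))) (sym (zeroˡ _))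
  ev-⊗ (suc d) e P Q x hP hQ = begin
    ev (suc (d ℕ.+ e)) (P ⊗ Q) x
      ≡⟨ cong (λ z → P 0 * Q 0 + x * z) (ev-⊕ (d ℕ.+ e) (λ i → P 0 * Q (suc i)) (P⁺ ⊗ Q) x) ⟩
    P 0 * Q 0 + x * (ev (d ℕ.+ e) (λ i → P 0 * Q (suc i)) x + ev (d ℕ.+ e) (P⁺ ⊗ Q) x)
      ≡⟨ cong₂ (λ y z → P 0 * Q 0 + x * (y + z)) (ev-scale (d ℕ.+ e) (P 0) (Q ∘ suc) x) (ev-⊗ d e P⁺ Q x (λ i h → hP (suc i) (ℕ.s≤s h)) hQ) ⟩
    P 0 * Q 0 + x * (P 0 * ev (d ℕ.+ e) (Q ∘ suc) x + ev d P⁺ x * ev e Q x)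
      ≡⟨ solve 6 (λ p q x y z w → p :* q :+ x :* (p :* y :+ z :* w) := p :* (q :+ x :* y) :+ x :* z :* w) refl _ _ _ _ _ _ ⟩
    P 0 * ev (suc (d ℕ.+ e)) Q x + x * ev d P⁺ x * ev e Q x
      ≡⟨ cong (λ z → P 0 * z + x * ev d P⁺ x * ev e Q x) (ev-bound x (ℕₚ.m≤n⇒m≤1+n (ℕₚ.m≤n+m e d)) hQ) ⟩
    P 0 * ev e Q x + x * ev d P⁺ x * ev e Q x
      ≡⟨ distribʳ _ _ _ ⟨
    ev (suc d) P x * ev e Q x ∎
    where
    open ≡-Reasoning
    P⁺ = P ∘ suc

  -- A relation rather than a function, since `ev` gives the value only for a valid degree bound.
  -- Each derivation carries a bound of its own, and `Ev-unique` shows that the value does not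
  -- depend on it.
  record Ev (P : Ser) (x v : Carrier) : Set where
    constructor evaluates
    field
      bound : ℕ
      deg   : Deg P bound
      value : ev bound P x ≡ v

  Ev-unique : ∀ {P Q x v w} → P ≈ Q → Ev P x v → Ev Q x w → v ≡ w
  Ev-unique {P} {Q} {x} e (evaluates d hP refl) (evaluates d′ hQ refl) =
    trans (sym (ev-bound x (ℕₚ.m≤m⊔n d d′) hP))
          (trans (ev-cong (d ℕ.⊔ d′) x e) (ev-bound x (ℕₚ.m≤n⊔m d d′) hQ))

  Ev-Deg : ∀ {P x v d} → Deg P d → Ev P x v → ev d P x ≡ v
  Ev-Deg hP E = Ev-unique S.refl (evaluates _ hP refl) E

  Ev-cong : ∀ {P Q x v} → P ≈ Q → Ev P x v → Ev Q x v
  Ev-cong {x = x} e (evaluates d hP v) = evaluates d (Deg-cong e hP) (trans (ev-cong d x (S.sym e)) v)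

  Ev-value : ∀ {P x v w} → v ≡ w → Ev P x v → Ev P x w
  Ev-value refl E = E

  Ev-⊕ : ∀ {P Q x v w} → Ev P x v → Ev Q x w → Ev (P ⊕ Q) x (v + w)
  Ev-⊕ {P} {Q} {x} (evaluates d hP refl) (evaluates d′ hQ refl) = evaluates (d ℕ.⊔ d′)
    (Deg-⊕ (Deg-mono (ℕₚ.m≤m⊔n d d′) hP) (Deg-mono (ℕₚ.m≤n⊔m d d′) hQ))
    (trans (ev-⊕ (d ℕ.⊔ d′) P Q x) (cong₂ _+_ (ev-bound x (ℕₚ.m≤m⊔n d d′) hP) (ev-bound x (ℕₚ.m≤n⊔m d d′) hQ)))

  Ev-⊗ : ∀ {P Q x v w} → Ev P x v → Ev Q x w → Ev (P ⊗ Q) x (v * w)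
  Ev-⊗ {P} {Q} {x} (evaluates d hP refl) (evaluates d′ hQ refl) =
    evaluates (d ℕ.+ d′) (Deg-⊗ hP hQ (ℕₚ.n≤1+n _)) (ev-⊗ d d′ P Q x hP hQ)

  Ev-const : ∀ a {x} → Ev (const a) x a
  Ev-const a {x} = evaluates 1 Deg-const (trans (cong (a +_) (zeroʳ x)) (+-identityʳ a))

  Ev-⊖ : ∀ {P x v} → Ev P x v → Ev (⊖ P) x (- v)
  Ev-⊖ {P} {x} {v} E = Ev-cong (pointwise λ i → trans (const-⊗ (- 1#) P i) (solve 1 (λ a → :- :1 :* a := :- a) refl _))
    (Ev-value (solve 1 (λ a → :- :1 :* a := :- a) refl v) (Ev-⊗ (Ev-const (- 1#)) E))

  Ev-X : ∀ {x} → Ev X x x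
  Ev-X {x} = evaluates 2 Deg-X (solve 1 (λ x → :0 :+ x :* (:1 :+ x :* :0) := x) refl x)

  Ev-↑ : ∀ {P x v} n → Ev P x v → Ev (P ↑ n) x (v ^ n)
  Ev-↑ zero E = Ev-const 1#
  Ev-↑ (suc n) E = Ev-⊗ E (Ev-↑ n E)

  lin : Carrier → Ser
  lin a = X ⊕ ⊖ const a

  Deg-lin : ∀ {a} → Deg (lin a) 2
  Deg-lin = Deg-⊕ Deg-X (Deg-⊖ (Deg-mono (ℕₚ.n≤1+n 1) Deg-const))

  Ev-lin : ∀ a {x} → Ev (lin a) x (x - a)
  Ev-lin a = Ev-⊕ Ev-X (Ev-⊖ (Ev-const a))

  lin-⊗ : ∀ a P → lin a ⊗ P ≈ X ⊗ P ⊕ ⊖ (const a ⊗ P)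
  lin-⊗ a P = solveS 3 (λ x a p → (x ⊞ ⊟ a) ⊠ p ⩴ x ⊠ p ⊞ ⊟ (a ⊠ p)) S.refl X (const a) P

  lin-⊗-zero : ∀ a P → (lin a ⊗ P) 0 ≡ - (a * P 0)
  lin-⊗-zero a P = trans (at (lin-⊗ a P) 0) (trans (cong (_+ - (a * P 0)) (X⊗-zero P)) (+-identityˡ _))

  lin-⊗-suc : ∀ a P i → (lin a ⊗ P) (suc i) ≡ P i - a * P (suc i)
  lin-⊗-suc a P i = trans (at (lin-⊗ a P) (suc i)) (cong₂ (λ u v → u + - v) (X⊗-suc P i) (const-⊗ a P (suc i)))

  abstract
    -- Synthetic division: the coefficients of the quotient are the values at a of the tails of P,
    -- as Horner's scheme produces them.
    divide-lin : ∀ a {P d} → Deg P (suc d) → ∃ λ Q → Deg Q d × P ≈ lin a ⊗ Q ⊕ const (ev (suc d) P a)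
    divide-lin a {P} {d} hP = Q , degQ , pointwise eq
      where
      Q : Ser
      Q i = ev d (λ j → P (suc i ℕ.+ j)) a
      degQ : Deg Q d
      degQ i d≤i = ev-zero d a (λ j → hP (suc i ℕ.+ j) (ℕₚ.≤-trans (ℕ.s≤s d≤i) (ℕₚ.m≤m+n (suc i) j)))
      step : ∀ i → Q i ≡ P (suc i) + a * Q (suc i)
      step i = trans (sym (ev-bound a (ℕₚ.n≤1+n d) (λ j d≤j → hP (suc i ℕ.+ j) (ℕ.s≤s (ℕₚ.≤-trans d≤j (ℕₚ.m≤n+m j i))))))
        (cong₂ (λ u v → u + a * v) (cong P (cong suc (ℕₚ.+-identityʳ i)))
          (ev-cong d a (pointwise λ j → cong P (cong suc (ℕₚ.+-suc i j)))))
      eq : ∀ i → P i ≡ (lin a ⊗ Q ⊕ const (ev (suc d) P a)) i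
      eq zero = trans (solve 3 (λ p a q → p := :- (a :* q) :+ (p :+ a :* q)) refl (P 0) a (Q 0))
                      (cong (_+ (P 0 + a * Q 0)) (sym (lin-⊗-zero a Q)))
      eq (suc i) = trans (solve 3 (λ p a q → p := (p :+ a :* q) :- a :* q :+ :0) refl (P (suc i)) a (Q (suc i)))
                      (cong (_+ 0#) (trans (cong (_- a * Q (suc i)) (sym (step i))) (sym (lin-⊗-suc a Q i))))

  abstract
    factor-root : ∀ {P a d} → Deg P (suc d) → Ev P a 0# → ∃ λ Q → Deg Q d × P ≈ lin a ⊗ Q
    factor-root {P} {a} {d} hP E with divide-lin a hP
    ... | Q , hQ , e = Q , hQ , S.trans e (pointwise λ
      { zero → trans (cong ((lin a ⊗ Q) 0 +_) (Ev-Deg hP E)) (+-identityʳ _) ; (suc i) → +-identityʳ _ })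

  prod : List Carrier → Ser
  prod [] = 1S
  prod (a ∷ L) = lin a ⊗ prod L

  Deg-prod : ∀ L → Deg (prod L) (suc (length L))
  Deg-prod [] = Deg-const
  Deg-prod (a ∷ L) = Deg-⊗ Deg-lin (Deg-prod L) ℕₚ.≤-refl

  prod-monic : ∀ L → prod L (length L) ≡ 1#
  prod-monic [] = refl
  prod-monic (a ∷ L) = trans (⊗-top {lin a} {prod L} Deg-lin (Deg-prod L))
    (trans (cong₂ _*_ (solve 0 (:1 :+ :- :0 := :1) refl) (prod-monic L)) (*-identityˡ _))

  abstract
    factor-roots : ∀ {P e} L → Unique L → All (λ x → Ev P x 0#) L → Deg P (length L ℕ.+ e) →
                   ∃ λ Q → Deg Q e × P ≈ prod L ⊗ Q
    factor-roots {P} [] _ _ hP = P , hP , S.sym (S.*-identityˡ P)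
    factor-roots {P} {e} (a ∷ L) (a∉L ∷ uL) (Ea ∷ EL) hP with factor-root hP Ea
    ... | Q , hQ , P≈ with factor-roots L uL (All.zipWith root (a∉L , EL)) hQ
      where
      root : ∀ {x} → a ≢ x × Ev P x 0# → Ev Q x 0#
      root {x} (a≢x , E) with *≡0 (Ev-unique (S.sym P≈) (Ev-⊗ (Ev-lin a {x}) (evaluates _ hQ refl)) E)
      ... | inj₁ x-a≡0 = contradiction (sym (-≡0 x-a≡0)) a≢x
      ... | inj₂ Q≡0 = evaluates _ hQ Q≡0
    ...   | R , hR , Q≈ = R , hR , S.trans P≈ (S.trans (S.*-congˡ Q≈) (S.sym (S.*-assoc _ _ _)))

  too-many-roots : ∀ {P d} L → Unique L → All (λ x → Ev P x 0#) L → Deg P d → d ℕ.≤ length L → P ≈ 0S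
  too-many-roots {P} {d} L uL EL hP d≤ with factor-roots {e = 0} L uL EL (Deg-mono (ℕₚ.≤-trans d≤ (ℕₚ.m≤m+n _ 0)) hP)
  ... | Q , hQ , e = S.trans e (S.trans (S.*-congˡ (pointwise λ i → hQ i ℕ.z≤n)) (S.zeroʳ _))

  root-bound : ∀ {P d i} L → Unique L → All (λ x → Ev P x 0#) L → Deg P (suc d) → P i ≢ 0# → length L ℕ.≤ d
  root-bound {P} {d} {i} L uL EL hP Pi≢0 with suc d ℕ.≤? length L
  ... | yes d< = contradiction (at (too-many-roots L uL EL hP d<) i) Pi≢0
  ... | no d≮ = ℕₚ.≮⇒≥ d≮

  prod-insert : ∀ ys x zs → prod (ys ++ x ∷ zs) ≈ lin x ⊗ prod (ys ++ zs)
  prod-insert [] x zs = S.refl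
  prod-insert (y ∷ ys) x zs = S.trans (S.*-congˡ (prod-insert ys x zs))
    (solveS 3 (λ a b c → a ⊠ (b ⊠ c) ⩴ b ⊠ (a ⊠ c)) S.refl (lin y) (lin x) (prod (ys ++ zs)))

  D-lin : ∀ a → D (lin a) ≈ 1S
  D-lin a = S.trans (D-⊕ X (⊖ const a)) (S.trans (S.+-cong D-X (S.trans (D-⊖ (const a)) (S.-‿cong (D-const a))))
    (solveS 0 (𝟙 ⊞ ⊟ 𝟘 ⩴ 𝟙) S.refl))

  D-lin-⊗ : ∀ a P → D (lin a ⊗ P) ≈ P ⊕ lin a ⊗ D P
  D-lin-⊗ a P = S.trans (D-⊗ (lin a) P) (S.+-congʳ (S.trans (S.*-congʳ (D-lin a)) (S.*-identityˡ P)))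

  abstract
    -- Each summand of the derivative of the product misses one factor X - a, and Φ restores it
    -- because a is a root of Φ. Entries of L may be repeated.
    prod∣Φ⊗D : ∀ {Φ} → Finite Φ → ∀ L → All (λ x → Ev Φ x 0#) L → ∃ λ C → Finite C × Φ ⊗ D (prod L) ≈ prod L ⊗ C
    prod∣Φ⊗D finΦ [] [] = 0S , (0 , Deg-0S) , S.trans (S.*-congˡ (D-const 1#)) (S.trans (S.zeroʳ _) (S.sym (S.zeroʳ _)))
    prod∣Φ⊗D {Φ} (d , hΦ) (a ∷ L) (Ea ∷ EL) with factor-root (Deg-mono (ℕₚ.n≤1+n d) hΦ) Ea | prod∣Φ⊗D (d , hΦ) L EL
    ... | Ψ , hΨ , Φ≈ | C , finC , eC = Ψ ⊕ C , Finite-⊕ (d , hΨ) finC , (begin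
      Φ ⊗ D (lin a ⊗ prod L)                       ≈⟨ S.*-congˡ (D-lin-⊗ a (prod L)) ⟩
      Φ ⊗ (prod L ⊕ lin a ⊗ D (prod L))            ≈⟨ solveS 4 (λ f h l d → f ⊠ (h ⊞ l ⊠ d) ⩴ f ⊠ h ⊞ l ⊠ (f ⊠ d)) S.refl Φ (prod L) (lin a) (D (prod L)) ⟩
      Φ ⊗ prod L ⊕ lin a ⊗ (Φ ⊗ D (prod L))        ≈⟨ S.+-cong (S.*-congʳ Φ≈) (S.*-congˡ eC) ⟩
      (lin a ⊗ Ψ) ⊗ prod L ⊕ lin a ⊗ (prod L ⊗ C)  ≈⟨ solveS 4 (λ l s h c → (l ⊠ s) ⊠ h ⊞ l ⊠ (h ⊠ c) ⩴ (l ⊠ h) ⊠ (s ⊞ c)) S.refl (lin a) Ψ (prod L) C ⟩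
      (lin a ⊗ prod L) ⊗ (Ψ ⊕ C)                   ∎)
      where open ≈-Reasoning

-- Coefficients along a pencil, orders at zero, and prime power exponents.

module RootPolynomials {N : ℕ} (K : FiniteField N) where
  open FieldBasics K
  open PowerSeries K
  open Polynomials K

  affine : Carrier × Carrier → Ser
  affine (a , b) = const b ⊕ const a ⊗ X

  affine-⊗ : ∀ a b P → affine (a , b) ⊗ P ≈ const b ⊗ P ⊕ const a ⊗ (X ⊗ P)
  affine-⊗ a b P = solveS 4 (λ a b x p → (b ⊞ a ⊠ x) ⊠ p ⩴ b ⊠ p ⊞ a ⊠ (x ⊠ p)) S.refl (const a) (const b) X P

  affine-⊗-zero : ∀ a b P → (affine (a , b) ⊗ P) 0 ≡ b * P 0
  affine-⊗-zero a b P = trans (at (affine-⊗ a b P) 0)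
    (trans (cong (b * P 0 +_) (trans (cong (a *_) (X⊗-zero P)) (zeroʳ a))) (+-identityʳ _))

  affine-⊗-suc : ∀ a b P i → (affine (a , b) ⊗ P) (suc i) ≡ b * P (suc i) + a * P i
  affine-⊗-suc a b P i = trans (at (affine-⊗ a b P) (suc i))
    (cong₂ _+_ (const-⊗ b P (suc i)) (trans (const-⊗ a (X ⊗ P) (suc i)) (cong (a *_) (X⊗-suc P i))))

  value : Carrier → Carrier × Carrier → Carrier
  value y (a , b) = b + a * y

  Ev-affine : ∀ ab {y} → Ev (affine ab) y (value y ab)
  Ev-affine (a , b) = Ev-⊕ (Ev-const b) (Ev-⊗ (Ev-const a) Ev-X)

  -- The coefficient of Xⁱ in ∏ (X − (b + a Y)), as a polynomial in Y.
  coeffY : List (Carrier × Carrier) → ℕ → Ser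
  coeffY [] i = const (1S i)
  coeffY (l ∷ L) zero = ⊖ (affine l ⊗ coeffY L 0)
  coeffY (l ∷ L) (suc i) = coeffY L i ⊕ ⊖ (affine l ⊗ coeffY L (suc i))

  Ev-coeffY : ∀ L i y → Ev (coeffY L i) y (prod (map (value y) L) i)
  Ev-coeffY [] i y = Ev-const (1S i)
  Ev-coeffY (l ∷ L) zero y =
    Ev-value (sym (lin-⊗-zero (value y l) (prod (map (value y) L)))) (Ev-⊖ (Ev-⊗ (Ev-affine l) (Ev-coeffY L 0 y)))
  Ev-coeffY (l ∷ L) (suc i) y =
    Ev-value (sym (lin-⊗-suc (value y l) (prod (map (value y) L)) i))
      (Ev-⊕ (Ev-coeffY L i y) (Ev-⊖ (Ev-⊗ (Ev-affine l) (Ev-coeffY L (suc i) y))))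

  private
    neg-zero : ∀ {a b x y} → x ≡ 0# → y ≡ 0# → - (b * x + a * y) ≡ 0#
    neg-zero {a} {b} refl refl = solve 2 (λ a b → :- (b :* :0 :+ a :* :0) := :0) refl a b

  abstract
    coeffY-degree : ∀ L i j → length L ℕ.< i ℕ.+ j → coeffY L i j ≡ 0#
    coeffY-degree [] zero (suc j) _ = refl
    coeffY-degree [] (suc i) zero _ = refl
    coeffY-degree [] (suc i) (suc j) _ = refl
    coeffY-degree ((a , b) ∷ L) zero (suc j) (ℕ.s≤s h) =
      trans (cong -_ (affine-⊗-suc a b (coeffY L 0) j))
        (neg-zero (coeffY-degree L 0 (suc j) (ℕₚ.m≤n⇒m≤1+n h)) (coeffY-degree L 0 j h))
    coeffY-degree ((a , b) ∷ L) (suc i) zero (ℕ.s≤s h) =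
      trans (cong₂ (λ u v → u + - v) (coeffY-degree L i 0 h) (affine-⊗-zero a b (coeffY L (suc i))))
        (trans (cong (λ u → 0# + - (b * u)) (coeffY-degree L (suc i) 0 (ℕₚ.m≤n⇒m≤1+n h)))
          (solve 1 (λ b → :0 :+ :- (b :* :0) := :0) refl b))
    coeffY-degree ((a , b) ∷ L) (suc i) (suc j) (ℕ.s≤s h) =
      trans (cong₂ (λ u v → u + - v) (coeffY-degree L i (suc j) h) (affine-⊗-suc a b (coeffY L (suc i)) j))
        (trans (+-identityˡ _) (neg-zero (coeffY-degree L (suc i) (suc j) (ℕₚ.m≤n⇒m≤1+n h))
          (coeffY-degree L (suc i) j (subst (length L ℕ.<_) (ℕₚ.+-suc i j) h))))

  abstract
    -- The part of highest total degree of ∏ (X - b - a Y) is ∏ (X - a Y). Setting Y = 1 there gives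
    -- the member of the pencil at infinity.
    coeffY-top : ∀ L i j → i ℕ.+ j ≡ length L → coeffY L i j ≡ prod (map proj₁ L) i
    coeffY-top [] zero zero _ = refl
    coeffY-top ((a , b) ∷ L) zero (suc j) e = trans (cong -_ (affine-⊗-suc a b (coeffY L 0) j))
      (trans (cong₂ (λ u v → - (b * u + a * v)) (coeffY-degree L 0 (suc j) (ℕₚ.≤-reflexive (sym e))) (coeffY-top L 0 j (ℕₚ.suc-injective e)))
        (trans (solve 3 (λ a b c → :- (b :* :0 :+ a :* c) := :- (a :* c)) refl a b _) (sym (lin-⊗-zero a (prod (map proj₁ L))))))
    coeffY-top ((a , b) ∷ L) (suc i) zero e =
      trans (cong₂ (λ u v → u + - v) (coeffY-top L i 0 (ℕₚ.suc-injective e))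
        (trans (affine-⊗-zero a b (coeffY L (suc i)))
          (cong (b *_) (coeffY-degree L (suc i) 0 (ℕₚ.≤-reflexive (sym e))))))
        (trans (solve 3 (λ a b c → c :+ :- (b :* :0) := c :- a :* :0) refl a b (prod (map proj₁ L) i))
          (trans (cong (λ u → prod (map proj₁ L) i - a * u) (sym top)) (sym (lin-⊗-suc a (prod (map proj₁ L)) i))))
      where
      top : prod (map proj₁ L) (suc i) ≡ 0#
      top = Deg-prod (map proj₁ L) (suc i) (ℕₚ.≤-reflexive (cong suc (trans (length-map proj₁ L)
        (sym (trans (sym (ℕₚ.+-identityʳ i)) (ℕₚ.suc-injective e))))))
    coeffY-top ((a , b) ∷ L) (suc i) (suc j) e =
      trans (cong₂ (λ u v → u + - v) (coeffY-top L i (suc j) (ℕₚ.suc-injective e))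
        (trans (affine-⊗-suc a b (coeffY L (suc i)) j)
          (cong₂ (λ u v → b * u + a * v) (coeffY-degree L (suc i) (suc j) (ℕₚ.≤-reflexive (sym e)))
            (coeffY-top L (suc i) j (trans (sym (ℕₚ.+-suc i j)) (ℕₚ.suc-injective e))))))
        (trans (solve 4 (λ a b c d → c :+ :- (b :* :0 :+ a :* d) := c :- a :* d) refl a b _ _)
          (sym (lin-⊗-suc a (prod (map proj₁ L)) i)))

  lacunary-coefficient : ∀ L Z i → Unique Z → All (λ y → prod (map (value y) L) i ≡ 0#) Z →
    length L ℕ.< i ℕ.+ length Z → i ℕ.≤ length L → prod (map proj₁ L) i ≡ 0#
  lacunary-coefficient L Z i uZ vanish big i≤ = trans (sym (coeffY-top L i (length L ℕ.∸ i) (ℕₚ.m+[n∸m]≡n i≤)))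
    (at (too-many-roots Z uZ (All.map (λ {y} e → Ev-value e (Ev-coeffY L i y)) vanish)
          (λ j Z≤j → coeffY-degree L i j (ℕₚ.≤-trans big (ℕₚ.+-monoʳ-≤ i Z≤j))) ℕₚ.≤-refl) (length L ℕ.∸ i))

  record Order (P : Ser) (n : ℕ) : Set where
    constructor order
    field
      below : ∀ i → i ℕ.< n → P i ≡ 0#
      nonzero-at : P n ≢ 0#
  open Order public

  Order-unique : ∀ {P Q m n} → P ≈ Q → Order P m → Order Q n → m ≡ n
  Order-unique {m = m} {n} e oP oQ with ℕₚ.<-cmp m n
  ... | tri< m<n _ _ = contradiction (trans (at e m) (below oQ m m<n)) (nonzero-at oP)
  ... | tri≈ _ m≡n _ = m≡n
  ... | tri> _ _ n<m = contradiction (trans (sym (at e n)) (below oP n n<m)) (nonzero-at oQ)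

  Order-affine-⊗ : ∀ {a b P n} → b ≢ 0# → Order P n → Order (affine (a , b) ⊗ P) n
  Order-affine-⊗ {a} {b} {P} {n} b≢0 o = order low high
    where
    prev : ∀ i → i ℕ.≤ n → (affine (a , b) ⊗ P) i ≡ b * P i
    prev zero _ = affine-⊗-zero a b P
    prev (suc i) i<n = trans (affine-⊗-suc a b P i)
      (trans (cong (λ z → b * P (suc i) + a * z) (below o i i<n)) (solve 2 (λ x a → x :+ a :* :0 := x) refl _ a))
    low : ∀ i → i ℕ.< n → (affine (a , b) ⊗ P) i ≡ 0#
    low i i<n = trans (prev i (ℕₚ.<⇒≤ i<n)) (zeroed (inj₂ (below o i i<n)))
    high : (affine (a , b) ⊗ P) n ≢ 0#
    high e = *≢0 b≢0 (nonzero-at o) (trans (sym (prev n ℕₚ.≤-refl)) e)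

  Order-affine₀-⊗ : ∀ {a P n} → a ≢ 0# → Order P n → Order (affine (a , 0#) ⊗ P) (suc n)
  Order-affine₀-⊗ {a} {P} {n} a≢0 o = order low high
    where
    prev : ∀ i → (affine (a , 0#) ⊗ P) (suc i) ≡ a * P i
    prev i = trans (affine-⊗-suc a 0# P i) (solve 2 (λ x y → :0 :* x :+ y := y) refl _ _)
    low : ∀ i → i ℕ.< suc n → (affine (a , 0#) ⊗ P) i ≡ 0#
    low zero _ = trans (affine-⊗-zero a 0# P) (zeroˡ _)
    low (suc i) (ℕ.s≤s i<n) = trans (prev i) (zeroed (inj₂ (below o i i<n)))
    high : (affine (a , 0#) ⊗ P) (suc n) ≢ 0#
    high e = *≢0 a≢0 (nonzero-at o) (trans (sym (prev n)) e)

  affineProd : List (Carrier × Carrier) → Ser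
  affineProd [] = 1S
  affineProd (l ∷ L) = affine l ⊗ affineProd L

  zeros : List (Carrier × Carrier) → ℕ
  zeros L = length (filter (λ l → proj₂ l ≟ 0#) L)

  -- A factor b + a X has order 1 at zero if b = 0 and order 0 otherwise. In this way the number of
  -- coincidences becomes an invariant of a polynomial.
  Order-affineProd : ∀ L → All (λ l → proj₂ l ≡ 0# → proj₁ l ≢ 0#) L → Order (affineProd L) (zeros L)
  Order-affineProd [] [] = order (λ i ()) 1≢0
  Order-affineProd ((a , b) ∷ L) (h ∷ hL) with b ≟ 0#
  ... | yes refl = Order-affine₀-⊗ (h refl) (Order-affineProd L hL)
  ... | no b≢0 = Order-affine-⊗ b≢0 (Order-affineProd L hL)

  Deg-affine : ∀ l → Deg (affine l) 2
  Deg-affine (a , b) = Deg-⊕ (Deg-mono (ℕₚ.n≤1+n 1) Deg-const) (Deg-⊗ (Deg-const {a}) Deg-X ℕₚ.≤-refl)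

  Deg-affineProd : ∀ L → Deg (affineProd L) (suc (length L))
  Deg-affineProd [] = Deg-const
  Deg-affineProd (l ∷ L) = Deg-⊗ (Deg-affine l) (Deg-affineProd L) ℕₚ.≤-refl

  count : Carrier → List Carrier → ℕ
  count x L = length (filter (λ y → y ≟ x) L)

  remove : Carrier → List Carrier → List Carrier
  remove x L = filter (λ y → ¬? (y ≟ x)) L

  private module SCE = Algebra.Properties.CommutativeSemiring.Exp S.commutativeSemiring

  prod-remove : ∀ x L → prod L ≈ lin x ↑ count x L ⊗ prod (remove x L)
  prod-remove x [] = S.sym (S.*-identityˡ _)
  prod-remove x (y ∷ L) with y ≟ x
  ... | yes refl = S.trans (S.*-congˡ (prod-remove x L)) (S.sym (S.*-assoc _ _ _))
  ... | no _ = S.trans (S.*-congˡ (prod-remove x L))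
    (solveS 3 (λ a b c → a ⊠ (b ⊠ c) ⩴ b ⊠ (a ⊠ c)) S.refl (lin y) (lin x ↑ count x L) (prod (remove x L)))

  count-remove : ∀ x y L → y ≢ x → count y (remove x L) ≡ count y L
  count-remove x y L y≢x = cong length (filter-filter (λ z → ¬? (z ≟ x)) (λ z → z ≟ y) L (λ z _ z≡y z≡x → y≢x (trans (sym z≡y) z≡x)))

  abstract
    prod-uniform : ∀ μ L → (∀ x → x ∈ L → count x L ≡ μ) →
      ∃ λ R → Unique R × All (_∈ L) R × length L ≡ μ ℕ.* length R × prod L ≈ prod R ↑ μ
    prod-uniform μ L h = go (length L) L ℕₚ.≤-refl h
      where
      -- n bounds the length, since the recursive call is made on a filtered list.
      go : ∀ n L → length L ℕ.≤ n → (∀ x → x ∈ L → count x L ≡ μ) →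
        ∃ λ R → Unique R × All (_∈ L) R × length L ≡ μ ℕ.* length R × prod L ≈ prod R ↑ μ
      go n [] _ h = [] , [] , [] , sym (ℕₚ.*-zeroʳ μ) , S.sym (one μ)
        where
        one : ∀ m → 1S ↑ m ≈ 1S
        one zero = S.refl
        one (suc m) = S.trans (S.*-identityˡ _) (one m)
      go (suc n) (x ∷ L) (ℕ.s≤s len) h
        with go n L′ (ℕₚ.≤-trans shorter len) h′
        where
        L′ : List Carrier
        L′ = remove x L
        shorter : length L′ ℕ.≤ length L
        shorter = length-filter (λ y → ¬? (y ≟ x)) L
        removed : remove x (x ∷ L) ≡ L′
        removed = filter-reject (λ y → ¬? (y ≟ x)) (λ ne → ne refl)
        h′ : ∀ y → y ∈ L′ → count y L′ ≡ μ
        h′ y y∈ with ∈-filter⁻ (λ z → ¬? (z ≟ x)) {xs = L} y∈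
        ... | y∈L , y≢x = trans (cong (count y) (sym removed)) (trans (count-remove x y (x ∷ L) y≢x) (h y (there y∈L)))
      ... | R , uR , R⊆ , len≡ , prod≈ = x ∷ R , All.map (λ {y} y∈ x≡y → proj₂ (split y∈) (sym x≡y)) R⊆ ∷ uR ,
            here refl ∷ All.map (there ∘ proj₁ ∘ split) R⊆ , lengths , products
        where
        split : ∀ {y} → y ∈ remove x L → y ∈ L × y ≢ x
        split y∈ = ∈-filter⁻ (λ z → ¬? (z ≟ x)) {xs = L} y∈
        removed : remove x (x ∷ L) ≡ remove x L
        removed = filter-reject (λ y → ¬? (y ≟ x)) (λ ne → ne refl)
        lengths : suc (length L) ≡ μ ℕ.* suc (length R)
        lengths = trans (sym (length-filter-¬ (λ y → y ≟ x) (x ∷ L)))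
          (trans (cong₂ ℕ._+_ (h x (here refl)) (trans (cong length removed) len≡)) (sym (ℕₚ.*-suc μ (length R))))
        products : prod (x ∷ L) ≈ prod (x ∷ R) ↑ μ
        products = S.trans (prod-remove x (x ∷ L))
          (S.trans (S.*-cong (S.reflexive (cong (lin x ↑_) (h x (here refl)))) (S.trans (S.reflexive (cong prod removed)) prod≈))
            (S.sym (SCE.^-distrib-* (lin x) (prod R) μ)))

  X↑-⊗ : ∀ s Q j → (X ↑ s ⊗ Q) (s ℕ.+ j) ≡ Q j
  X↑-⊗ zero Q j = at (S.*-identityˡ Q) j
  X↑-⊗ (suc s) Q j = trans (at (S.*-assoc X (X ↑ s) Q) (suc (s ℕ.+ j))) (trans (X⊗-suc (X ↑ s ⊗ Q) (s ℕ.+ j)) (X↑-⊗ s Q j))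

  X↑-⊗-low : ∀ s Q j → j ℕ.< s → (X ↑ s ⊗ Q) j ≡ 0#
  X↑-⊗-low (suc s) Q zero _ = trans (at (S.*-assoc X (X ↑ s) Q) 0) (X⊗-zero (X ↑ s ⊗ Q))
  X↑-⊗-low (suc s) Q (suc j) (ℕ.s≤s j<s) =
    trans (at (S.*-assoc X (X ↑ s) Q) (suc j)) (trans (X⊗-suc (X ↑ s ⊗ Q) j) (X↑-⊗-low s Q j j<s))

  X↑-top : ∀ s → (X ↑ s) s ≡ 1#
  X↑-top s = trans (sym (at (S.*-identityʳ (X ↑ s)) s)) (trans (cong (X ↑ s ⊗ 1S) (sym (ℕₚ.+-identityʳ s))) (X↑-⊗ s 1S 0))

  X↑-other : ∀ s j → j ≢ s → (X ↑ s) j ≡ 0#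
  X↑-other s j j≢s with ℕₚ.<-cmp j s
  ... | tri< j<s _ _ = trans (sym (at (S.*-identityʳ (X ↑ s)) j)) (X↑-⊗-low s 1S j j<s)
  ... | tri≈ _ e _ = contradiction e j≢s
  ... | tri> _ _ s<j with ℕₚ.m≤n⇒∃[o]m+o≡n s<j
  ...   | o , refl = trans (sym (at (S.*-identityʳ (X ↑ s)) (suc s ℕ.+ o)))
            (trans (cong (X ↑ s ⊗ 1S) (sym (ℕₚ.+-suc s o))) (X↑-⊗ s 1S (suc o)))

  Deg-X↑ : ∀ s → Deg (X ↑ s) (suc s)
  Deg-X↑ s i s<i = X↑-other s i (ℕₚ.>⇒≢ s<i)

  const-* : ∀ a b → const a ⊗ const b ≈ const (a * b)
  const-* a b = pointwise λ { zero → refl ; (suc i) → trans (const-⊗ a (const b) (suc i)) (zeroʳ a) }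

  const-+ : ∀ a b → const a ⊕ const b ≈ const (a + b)
  const-+ a b = pointwise λ { zero → refl ; (suc i) → +-identityˡ 0# }

  const-sub : ∀ a b → const (a - b) ≈ const a ⊕ ⊖ const b
  const-sub a b = pointwise λ { zero → refl ; (suc i) → sym (-self 0#) }

  const-zero : ∀ {a} → a ≡ 0# → const a ≈ 0S
  const-zero e = pointwise λ { zero → e ; (suc i) → refl }

  const-↑ : ∀ a n → const a ↑ n ≈ const (a ^ n)
  const-↑ a zero = S.refl
  const-↑ a (suc n) = S.trans (S.*-congˡ (const-↑ a n)) (const-* a (a ^ n))

  ×1S : ∀ n → n SMult.× 1S ≈ const (ι n)
  ×1S zero = pointwise λ { zero → refl ; (suc i) → refl }
  ×1S (suc n) = S.trans (S.+-congˡ (×1S n)) (pointwise λ { zero → refl ; (suc i) → +-identityˡ _ })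

  module PrimePower {p : ℕ} (pp : Prime p) (char : ι p ≡ 0#) (e : ℕ) where
    s : ℕ
    s = p ℕ.^ e

    charS : p SMult.× 1S ≈ 0S
    charS = S.trans (×1S p) (pointwise λ { zero → char ; (suc i) → refl })

    ↑s-homo : ∀ P Q → (P ⊕ Q) ↑ s ≈ P ↑ s ⊕ Q ↑ s
    ↑s-homo = Frobenius.^pᵉ-homo-+ serRing pp charS e

    -- Frobenius applied to P = P 0 + X P⁺. Iterated, it says that the s-th power has the
    -- coefficients (P i)ˢ at the multiples s i and zeros elsewhere.
    ↑s-unfold : ∀ P → P ↑ s ≈ const (P 0 ^ s) ⊕ X ↑ s ⊗ (P ∘ suc) ↑ s
    ↑s-unfold P = begin
      P ↑ s                                        ≈⟨ SExp.^-congˡ s split ⟩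
      (const (P 0) ⊕ X ⊗ (P ∘ suc)) ↑ s            ≈⟨ ↑s-homo _ _ ⟩
      const (P 0) ↑ s ⊕ (X ⊗ (P ∘ suc)) ↑ s        ≈⟨ S.+-cong (const-↑ (P 0) s) (SCE.^-distrib-* X (P ∘ suc) s) ⟩
      const (P 0 ^ s) ⊕ X ↑ s ⊗ (P ∘ suc) ↑ s      ∎
      where
      open ≈-Reasoning
      split : P ≈ const (P 0) ⊕ X ⊗ (P ∘ suc)
      split = pointwise λ
        { zero → trans (sym (+-identityʳ _)) (cong (P 0 +_) (sym (X⊗-zero (P ∘ suc))))
        ; (suc i) → trans (sym (X⊗-suc (P ∘ suc) i)) (sym (+-identityˡ _)) }

    ↑s-multiple : 0 ℕ.< s → ∀ P i → (P ↑ s) (s ℕ.* i) ≡ P i ^ s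
    ↑s-multiple 0<s P zero = trans (cong (P ↑ s) (ℕₚ.*-zeroʳ s)) (trans (at (↑s-unfold P) 0)
      (trans (cong (P 0 ^ s +_) (X↑-⊗-low s ((P ∘ suc) ↑ s) 0 0<s)) (+-identityʳ _)))
    ↑s-multiple 0<s P (suc i) = trans (cong (P ↑ s) (ℕₚ.*-suc s i)) (trans (at (↑s-unfold P) (s ℕ.+ s ℕ.* i))
      (trans (cong₂ _+_ (Deg-const (s ℕ.+ s ℕ.* i) (ℕₚ.≤-trans 0<s (ℕₚ.m≤m+n s _))) (X↑-⊗ s _ (s ℕ.* i)))
        (trans (+-identityˡ _) (↑s-multiple 0<s (P ∘ suc) i))))

    private
      ↑s-remainder : ∀ P r i → 0 ℕ.< r → r ℕ.< s → (P ↑ s) (s ℕ.* i ℕ.+ r) ≡ 0#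
      ↑s-remainder P r zero 0<r r<s = trans (cong (P ↑ s) (cong (ℕ._+ r) (ℕₚ.*-zeroʳ s)))
        (trans (at (↑s-unfold P) r) (trans (cong₂ _+_ (Deg-const r 0<r) (X↑-⊗-low s _ r r<s)) (+-identityʳ _)))
      ↑s-remainder P r (suc i) 0<r r<s =
        trans (cong (P ↑ s) (trans (cong (ℕ._+ r) (ℕₚ.*-suc s i)) (ℕₚ.+-assoc s _ r)))
        (trans (at (↑s-unfold P) (s ℕ.+ (s ℕ.* i ℕ.+ r)))
        (trans (cong₂ _+_ (Deg-const (s ℕ.+ (s ℕ.* i ℕ.+ r)) (ℕₚ.≤-trans 0<r (ℕₚ.≤-trans (ℕₚ.m≤n+m r (s ℕ.* i)) (ℕₚ.m≤n+m _ s)))) (X↑-⊗ s _ (s ℕ.* i ℕ.+ r)))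
        (trans (+-identityˡ _) (↑s-remainder (P ∘ suc) r i 0<r r<s))))

    ↑s-nonmultiple : 0 ℕ.< s → ∀ P j → ¬ (s ∣ j) → (P ↑ s) j ≡ 0#
    ↑s-nonmultiple 0<s P j s∤j = trans (cong (P ↑ s) split) (↑s-remainder P (j DM.% s) (j DM./ s) 0<r (DM.m%n<n j s))
      where
      instance _ = ℕ.>-nonZero 0<s
      split : j ≡ s ℕ.* (j DM./ s) ℕ.+ j DM.% s
      split = trans (DM.m≡m%n+[m/n]*n j s) (trans (ℕₚ.+-comm (j DM.% s) _) (cong (ℕ._+ j DM.% s) (ℕₚ.*-comm (j DM./ s) s)))
      0<r : 0 ℕ.< j DM.% s
      0<r = ℕₚ.n≢0⇒n>0 λ r≡0 → s∤j (divides (j DM./ s) (trans (DM.m≡m%n+[m/n]*n j s) (cong (ℕ._+ (j DM./ s) ℕ.* s) r≡0)))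

-- Multiple roots.

module RootMultiplicity {N : ℕ} (K : FiniteField N) where
  open FieldBasics K
  open PowerSeries K
  open Polynomials K
  open RootPolynomials K

  Ev-total : ∀ {P d x} → Deg P d → Ev P x (ev d P x)
  Ev-total hP = evaluates _ hP refl

  monic-prod : ∀ {P} L → Unique L → All (λ x → Ev P x 0#) L → Deg P (suc (length L)) → P (length L) ≡ 1# → P ≈ prod L
  monic-prod {P} L uL roots hP monic = go (factor-roots {P} {1} L uL roots (Deg-mono (ℕₚ.≤-reflexive (ℕₚ.+-comm 1 (length L))) hP))
    where
    go : (∃ λ Q → Deg Q 1 × P ≈ prod L ⊗ Q) → P ≈ prod L
    go (Q , hQ , e) = S.trans e (S.trans (S.*-congˡ {prod L} (pointwise λ { zero → Q0 ; (suc i) → hQ (suc i) (ℕ.s≤s ℕ.z≤n) })) (S.*-identityʳ _))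
      where
      Q0 : Q 0 ≡ 1#
      Q0 = begin
        Q 0                                ≡⟨ *-identityˡ _ ⟨
        1# * Q 0                           ≡⟨ cong (_* Q 0) (sym (prod-monic L)) ⟩
        prod L (length L) * Q 0            ≡⟨ ⊗-top {prod L} {Q} {length L} (Deg-prod L) hQ ⟨
        (prod L ⊗ Q) (length L ℕ.+ 0)      ≡⟨ at e _ ⟨
        P (length L ℕ.+ 0)                 ≡⟨ cong P (ℕₚ.+-identityʳ _) ⟩
        P (length L)                       ≡⟨ monic ⟩
        1#                                 ∎
        where open ≡-Reasoning

  Ev-prod-root : ∀ {x} L → x ∈ L → Ev (prod L) x 0#
  Ev-prod-root (x ∷ L) (here refl) = Ev-value (zeroed (inj₁ (-self x))) (Ev-⊗ (Ev-lin x) (Ev-total (Deg-prod L)))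
  Ev-prod-root {x} (y ∷ L) (there x∈) = Ev-value (zeroʳ _) (Ev-⊗ (Ev-lin y {x}) (Ev-prod-root L x∈))

  -- A repeated entry would be a common root of the product and of its derivative.
  simple-roots⇒unique : ∀ L → (∀ x → x ∈ L → ¬ Ev (D (prod L)) x 0#) → Unique L
  simple-roots⇒unique [] h = []
  simple-roots⇒unique (x ∷ L) h = All.tabulate (λ { {y} y∈ refl → h y (here refl) (double y∈) }) ∷ simple-roots⇒unique L simple
    where
    derivative : ∀ {z v w} → Ev (prod L) z v → Ev (D (prod L)) z w → Ev (D (lin x ⊗ prod L)) z (v + (z - x) * w)
    derivative E F = Ev-cong (S.sym (D-lin-⊗ x (prod L))) (Ev-⊕ E (Ev-⊗ (Ev-lin x) F))
    double : x ∈ L → Ev (D (lin x ⊗ prod L)) x 0#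
    double x∈ = Ev-value (trans (+-identityˡ _) (zeroed (inj₁ (-self x)))) (derivative (Ev-prod-root L x∈) (Ev-total (Deg-D (Deg-prod L))))
    simple : ∀ y → y ∈ L → ¬ Ev (D (prod L)) y 0#
    simple y y∈ E = h y (there y∈) (Ev-value (trans (+-identityˡ _) (zeroʳ _)) (derivative (Ev-prod-root L y∈) E))

  Ev-affineProd-root : ∀ {y} L l → l ∈ L → value y l ≡ 0# → Ev (affineProd L) y 0#
  Ev-affineProd-root (l ∷ L) l (here refl) e = Ev-value (zeroed (inj₁ e)) (Ev-⊗ (Ev-affine l) (Ev-total (Deg-affineProd L)))
  Ev-affineProd-root (l′ ∷ L) l (there l∈) e = Ev-value (zeroʳ _) (Ev-⊗ (Ev-affine l′) (Ev-affineProd-root L l l∈ e))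

  count-tabulate : ∀ {n} (f : Fin n → Carrier) x → count x (tabulate f) ≡ length (filter (λ i → f i ≟ x) (allFin _))
  count-tabulate {n} f x = trans (cong (count x) (sym (map-tabulate (λ i → i) f))) (go (allFin n))
    where
    go : ∀ L → count x (map f L) ≡ length (filter (λ i → f i ≟ x) L)
    go [] = refl
    go (i ∷ L) with f i ≟ x
    ... | yes _ = cong suc (go L)
    ... | no _ = go L

module CountRoots {N : ℕ} (K : FiniteField N) where
  open FieldBasics K
  open PowerSeries K
  open Polynomials K
  open RootPolynomials K

  lin↑-degree : ∀ a j → Deg (lin a ↑ j) (suc j)
  lin↑-degree a zero = Deg-const
  lin↑-degree a (suc j) = Deg-⊗ Deg-lin (lin↑-degree a j) ℕₚ.≤-refl

  lin-one : ∀ a → lin a 1 ≡ 1#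
  lin-one a = solve 0 (:1 :+ :- :0 := :1) refl

  lin↑-top : ∀ a j → (lin a ↑ j) j ≡ 1#
  lin↑-top a zero = refl
  lin↑-top a (suc j) = trans (⊗-top {lin a} {lin a ↑ j} Deg-lin (lin↑-degree a j)) (trans (cong₂ _*_ (lin-one a) (lin↑-top a j)) (*-identityˡ _))

  -- This coefficient determines the translation that matches a given polynomial in its two highest
  -- terms.
  lin↑-second : ∀ a j → (lin a ↑ suc j) j ≡ - (ι (suc j) * a)
  lin↑-second a zero = trans (lin-⊗-zero a 1S) (solve 1 (λ a → :- (a :* :1) := :- ((:1 :+ :0) :* a)) refl a)
  lin↑-second a (suc j) = trans (lin-⊗-suc a (lin a ↑ suc j) j) (trans (cong₂ (λ u w → u - a * w) (lin↑-second a j) (lin↑-top a (suc j)))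
    (solve 2 (λ n a → :- (n :* a) :- a :* :1 := :- ((:1 :+ n) :* a)) refl (ι (suc j)) a))

  D-lin↑ : ∀ a j → D (lin a ↑ suc j) ≈ const (ι (suc j)) ⊗ lin a ↑ j
  D-lin↑ a zero = S.trans (D-lin-⊗ a 1S) (S.trans (S.+-congˡ (S.trans (S.*-congˡ (D-const 1#)) (S.zeroʳ _)))
    (pointwise λ { zero → solve 0 (:1 :+ :0 := (:1 :+ :0) :* :1) refl
                 ; (suc i) → trans (+-identityˡ _) (sym (trans (const-⊗ _ 1S (suc i)) (zeroʳ _))) }))
  D-lin↑ a (suc j) = begin
    D (lin a ⊗ lin a ↑ suc j)                                            ≈⟨ D-lin-⊗ a (lin a ↑ suc j) ⟩
    lin a ↑ suc j ⊕ lin a ⊗ D (lin a ↑ suc j)                            ≈⟨ S.+-congˡ (S.*-congˡ (D-lin↑ a j)) ⟩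
    lin a ↑ suc j ⊕ lin a ⊗ (const (ι (suc j)) ⊗ lin a ↑ j)              ≈⟨ solveS 3 (λ y n u → y ⊠ u ⊞ y ⊠ (n ⊠ u) ⩴ (𝟙 ⊞ n) ⊠ (y ⊠ u)) S.refl (lin a) (const (ι (suc j))) (lin a ↑ j) ⟩
    (1S ⊕ const (ι (suc j))) ⊗ lin a ↑ suc j                             ≈⟨ S.*-congʳ (pointwise λ { zero → refl ; (suc i) → +-identityˡ _ }) ⟩
    const (ι (suc (suc j))) ⊗ lin a ↑ suc j                              ∎
    where open ≈-Reasoning

  D-scale : ∀ a P → D (const a ⊗ P) ≈ const a ⊗ D P
  D-scale a P = S.trans (D-⊗ (const a) P) (S.trans (S.+-congʳ (S.trans (S.*-congʳ (D-const a)) (S.zeroˡ P))) (S.+-identityˡ _))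

  Finite-lin↑ : ∀ a j → Finite (lin a ↑ j)
  Finite-lin↑ a j = Finite-↑ j (2 , Deg-lin)

  lin≉0 : ∀ a → ¬ (lin a ≈ 0S)
  lin≉0 a e = 1≢0 (trans (solve 0 (:1 := :1 :+ :- :0) refl) (at e 1))

  lin↑-cancel : ∀ a j {P Q} → Finite P → Finite Q → lin a ↑ j ⊗ P ≈ lin a ↑ j ⊗ Q → P ≈ Q
  lin↑-cancel a zero finP finQ e = S.trans (S.sym (S.*-identityˡ _)) (S.trans e (S.*-identityˡ _))
  lin↑-cancel a (suc j) {P} {Q} finP finQ e = lin↑-cancel a j finP finQ (difference
    (⊗-domain (2 , Deg-lin) (Finite-⊕ (Finite-⊗ (Finite-lin↑ a j) finP) (Finite-⊖ (Finite-⊗ (Finite-lin↑ a j) finQ))) zero-product))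
    where
    A B : Ser
    A = lin a ↑ j ⊗ P
    B = lin a ↑ j ⊗ Q
    zero-product : lin a ⊗ (A ⊕ ⊖ B) ≈ 0S
    zero-product = S.trans (solveS 4 (λ l u p q → l ⊠ (u ⊠ p ⊟ u ⊠ q) ⩴ (l ⊠ u) ⊠ p ⊟ (l ⊠ u) ⊠ q) S.refl (lin a) (lin a ↑ j) P Q)
      (S.trans (S.+-congʳ e) (S.-‿inverseʳ _))
    difference : lin a ≈ 0S ⊎ A ⊕ ⊖ B ≈ 0S → A ≈ B
    difference (inj₁ z) = contradiction z (lin≉0 a)
    difference (inj₂ z) = pointwise λ i → -≡0 (at z i)

  abstract
    -- Otherwise cancelling the power of X - x that belongs to the entries equal to x leaves X - x
    -- as a divisor of the product over the other entries, whose value at x is nonzero.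
    multiplicity≤count : ∀ x j L {Q} → Finite Q → prod L ≈ lin x ↑ j ⊗ Q → j ℕ.≤ count x L
    multiplicity≤count x j L {Q} finQ e with j ℕ.≤? count x L
    ... | yes h = h
    ... | no ≰ = contradiction (Ev-unique cancelled (nonroot L) (Ev-⊗ (Ev-⊗ (Ev-lin x) (Ev-↑ o (Ev-lin x))) (evaluates _ (proj₂ finQ) refl)))
        (λ z → remaining≢0 L (trans z (zeroed (inj₁ (zeroed (inj₁ (-self x)))))))
      where
      k o : ℕ
      k = count x L
      o = j ℕ.∸ suc k
      j≡ : j ≡ k ℕ.+ suc o
      j≡ = trans (sym (ℕₚ.m+[n∸m]≡n (ℕₚ.≰⇒> ≰))) (sym (ℕₚ.+-suc k o))
      remaining : List Carrier → Carrier
      remaining [] = 1#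
      remaining (y ∷ L) with y ≟ x
      ... | yes _ = remaining L
      ... | no _ = (x - y) * remaining L
      nonroot : ∀ L → Ev (prod (remove x L)) x (remaining L)
      nonroot [] = Ev-const 1#
      nonroot (y ∷ L) with y ≟ x
      ... | yes _ = nonroot L
      ... | no _ = Ev-⊗ (Ev-lin y) (nonroot L)
      remaining≢0 : ∀ L → remaining L ≢ 0#
      remaining≢0 [] = 1≢0
      remaining≢0 (y ∷ L) with y ≟ x
      ... | yes _ = remaining≢0 L
      ... | no y≢x = *≢0 (λ z → y≢x (sym (-≡0 z))) (remaining≢0 L)
      cancelled : prod (remove x L) ≈ lin x ↑ suc o ⊗ Q
      cancelled = lin↑-cancel x k (_ , Deg-prod (remove x L)) (Finite-⊗ (Finite-lin↑ x (suc o)) finQ) (begin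
        lin x ↑ k ⊗ prod (remove x L)         ≈⟨ prod-remove x L ⟨
        prod L                                ≈⟨ e ⟩
        lin x ↑ j ⊗ Q                         ≈⟨ S.*-congʳ (S.trans (SExp.^-congʳ (lin x) j≡) (SExp.^-homo-* (lin x) k (suc o))) ⟩
        (lin x ↑ k ⊗ lin x ↑ suc o) ⊗ Q       ≈⟨ S.*-assoc _ _ _ ⟩
        lin x ↑ k ⊗ (lin x ↑ suc o ⊗ Q)       ∎)
        where open ≈-Reasoning

-- Sums and products over the whole field.

module FiniteSums {N : ℕ} (K : FiniteField N) where
  open FieldBasics K

  element : Fin N → Carrier
  element = Inverse.from enum

  element-injective : ∀ {i j} → element i ≡ element j → i ≡ j
  element-injective {i} {j} e = trans (sym (Inverse.strictlyInverseˡ enum i))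
    (trans (cong (Inverse.to enum) e) (Inverse.strictlyInverseˡ enum j))

  elements : List Carrier
  elements = map element (allFin N)

  abstract
    elements-unique : Unique elements
    elements-unique = Unique.map⁺ element-injective (Unique.allFin⁺ N)

  abstract
    elements-complete : ∀ x → x ∈ elements
    elements-complete x = subst (_∈ elements) (Inverse.strictlyInverseʳ enum x) (∈-map⁺ element (∈-allFin (Inverse.to enum x)))

  abstract
    length-elements : length elements ≡ N
    length-elements = trans (length-map element (allFin N)) (length-tabulate (λ i → i))

  module _ (M : CommutativeMonoid 0ℓ 0ℓ) where
    open Algebra.Properties.CommutativeMonoid.Sum M using (sum; sum-permute; sum-cong-≗)
    open CommutativeMonoid M using (_≈_) renaming (Carrier to C; trans to transM; reflexive to reflM)

    sum-bijection : (g : Carrier ↔ Carrier) (F : Carrier → C) →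
      sum (λ i → F (element i)) ≈ sum (λ i → F (Inverse.to g (element i)))
    sum-bijection g F = transM (sum-permute (F ∘ element) π)
      (reflM (sum-cong-≗ (λ i → cong F (Inverse.strictlyInverseʳ enum (Inverse.to g (element i))))))
      where
      π : Fin N ↔ Fin N
      π = enum ↔-∘ (g ↔-∘ ↔-sym enum)

  module Σ+ = Algebra.Properties.CommutativeMonoid.Sum (CommutativeRing.+-commutativeMonoid commRing)
  module Π* = Algebra.Properties.CommutativeMonoid.Sum (CommutativeRing.*-commutativeMonoid commRing)

  -- Translation by 1 permutes the field, but it adds `ι N` to the sum of all elements.
  ι-size : ι N ≡ 0#
  ι-size = begin
    ι N                       ≡⟨ solve 2 (λ s m → m := (s :+ m) :- s) refl S (ι N) ⟩
    (S + ι N) - S             ≡⟨ cong (_- S) (sym shifted) ⟩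
    S - S                     ≡⟨ -self S ⟩
    0#                        ∎
    where
    open ≡-Reasoning
    S = Σ+.sum element
    translate : Carrier ↔ Carrier
    translate = mk↔ₛ′ (_+ 1#) (_- 1#)
      (solve 1 (λ x → (x :- :1) :+ :1 := x) refl) (solve 1 (λ x → (x :+ :1) :- :1 := x) refl)
    shifted : S ≡ S + ι N
    shifted = trans (sum-bijection (CommutativeRing.+-commutativeMonoid commRing) translate (λ x → x))
      (trans (Σ+.∑-distrib-+ element (λ _ → 1#)) (cong (S +_) (Σ+.sum-replicate N)))

  private
    -- The product of the nonzero elements is taken over all elements with 0 replaced by 1. Scaling
    -- the argument then costs one factor, at 0, which `indicator` records.
    orOne : Carrier → Carrier
    orOne y with y ≟ 0#
    ... | yes _ = 1#
    ... | no _ = y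

    orOne≢0 : ∀ y → orOne y ≢ 0#
    orOne≢0 y with y ≟ 0#
    ... | yes _ = 1≢0
    ... | no y≢0 = y≢0

    indicator : Carrier → Carrier → Carrier
    indicator x y with y ≟ 0#
    ... | yes _ = x
    ... | no _ = 1#

    orOne-* : ∀ x y → x ≢ 0# → x * orOne y ≡ orOne (x * y) * indicator x y
    orOne-* x y x≢0 with y ≟ 0# | (x * y) ≟ 0#
    ... | yes refl | yes _ = *-comm _ _
    ... | yes refl | no ne = contradiction (zeroʳ x) ne
    ... | no y≢0 | yes e = contradiction e (*≢0 x≢0 y≢0)
    ... | no y≢0 | no _ = sym (*-identityʳ _)

    prod-indicator : ∀ x {n} (g : Fin n → Carrier) → (∀ {i j} → g i ≡ g j → i ≡ j) → ∀ i → g i ≡ 0# → Π*.sum (λ j → indicator x (g j)) ≡ x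
    prod-indicator x {suc n} g inj i gi≡0 with g zero ≟ 0#
    ... | yes g0≡0 = trans (cong (x *_) (trans (Π*.sum-cong-≗ ones) (ones-product n))) (*-identityʳ x)
      where
      ones-product : ∀ m → Π*.sum {m} (λ _ → 1#) ≡ 1#
      ones-product zero = refl
      ones-product (suc m) = trans (*-identityˡ _) (ones-product m)
      ones : ∀ j → indicator x (g (suc j)) ≡ 1#
      ones j with g (suc j) ≟ 0#
      ... | yes e = contradiction (inj (trans g0≡0 (sym e))) λ ()
      ... | no _ = refl
    prod-indicator x {suc n} g inj zero gi≡0 | no ne = contradiction gi≡0 ne
    prod-indicator x {suc n} g inj (suc i) gi≡0 | no ne =
      trans (*-identityˡ _) (prod-indicator x (g ∘ suc) (Fin.suc-injective ∘ inj) i gi≡0)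

    product≢0 : ∀ {n} (g : Fin n → Carrier) → (∀ i → g i ≢ 0#) → Π*.sum g ≢ 0#
    product≢0 {zero} g h = 1≢0
    product≢0 {suc n} g h = *≢0 (h zero) (product≢0 (g ∘ suc) (h ∘ suc))

  -- Multiplication by x ≠ 0 permutes the field. Scaling all N factors of the product Π of `orOne`
  -- leaves one surplus x at the argument 0, so Π xᴺ = Π x with Π ≠ 0.
  fermat : ∀ x → 0 ℕ.< N → x ^ N ≡ x
  fermat x 0<N with x ≟ 0#
  ... | yes refl = 0^ N 0<N
  ... | no x≢0 = *-cancelˡ (product≢0 (orOne ∘ element) (orOne≢0 ∘ element)) (begin
    Π * x ^ N                                                   ≡⟨ *-comm _ _ ⟩
    x ^ N * Π                                                   ≡⟨ cong (_* Π) (trans (^≡Exp x N) (sym (Π*.sum-replicate N))) ⟩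
    Π*.sum {N} (λ _ → x) * Π                                    ≡⟨ Π*.∑-distrib-+ (λ _ → x) (orOne ∘ element) ⟨
    Π*.sum (λ i → x * orOne (element i))                        ≡⟨ Π*.sum-cong-≗ (λ i → orOne-* x (element i) x≢0) ⟩
    Π*.sum (λ i → orOne (x * element i) * indicator x (element i)) ≡⟨ Π*.∑-distrib-+ (λ i → orOne (x * element i)) _ ⟩
    Π*.sum (λ i → orOne (x * element i)) * Π*.sum (λ i → indicator x (element i))
      ≡⟨ cong₂ _*_ (sym (sum-bijection (CommutativeRing.*-commutativeMonoid commRing) scaling orOne))
                   (prod-indicator x element element-injective (Inverse.to enum 0#) (Inverse.strictlyInverseʳ enum 0#)) ⟩
    Π * x ∎)
    where
    open ≡-Reasoning
    Π = Π*.sum (orOne ∘ element)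
    scaling : Carrier ↔ Carrier
    scaling = mk↔ₛ′ (x *_) (inv x x≢0 *_)
      (λ y → trans (sym (*-assoc _ _ _)) (trans (cong (_* y) (*-inv x x≢0)) (*-identityˡ y)))
      (λ y → trans (sym (*-assoc _ _ _)) (trans (cong (_* y) (inv* x x≢0)) (*-identityˡ y)))

-- The field of order q², its subfield and the alternating form.

record Setting : Set₁ where
  field
    p n q : ℕ
    -- Keeping q as a variable lets it be rewritten as p, as s Q or as 2k + 1, whichever form is
    -- wanted.
    q≡pⁿ  : q ≡ p ℕ.^ n
    pp    : Prime p
    1≤n   : 1 ℕ.≤ n
    K     : FiniteField (q ℕ.* q)

Graph : Setting → ℕ → Set
Graph 𝕂 = PeisertData (Setting.q 𝕂) (Setting.K 𝕂)

Clique : (𝕂 : Setting) {m : ℕ} → Graph 𝕂 m → Set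
Clique 𝕂 = MaxClique (Setting.q 𝕂) (Setting.K 𝕂)

module QuadraticField (𝕂 : Setting) where
  open Setting 𝕂 public
  open FieldBasics K public
  open PowerSeries K public
  open Polynomials K public
  open RootPolynomials K public
  open FiniteSums K public
  open RootMultiplicity K public
  open CountRoots K public

  1<p : 1 ℕ.< p
  1<p = ℕ.nonTrivial⇒n>1 p {{prime⇒nonTrivial pp}}

  p≤q : p ℕ.≤ q
  p≤q = ℕₚ.≤-trans (ℕₚ.≤-reflexive (sym (ℕₚ.^-identityʳ p)))
    (ℕₚ.≤-trans (ℕₚ.^-monoʳ-≤ p {{nonZero 1<p}} 1≤n) (ℕₚ.≤-reflexive (sym q≡pⁿ)))

  1<q : 1 ℕ.< q
  1<q = ℕₚ.≤-trans 1<p p≤q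

  0<q : 0 ℕ.< q
  0<q = ℕₚ.<-trans ℕₚ.0<1+n 1<q

  -- The order q² is a power of p that vanishes in K, and K has no zero divisors.
  char : ι p ≡ 0#
  char = descend (n ℕ.+ n) (trans (cong ι (trans (ℕₚ.^-distribˡ-+-* p n n) (sym (cong₂ ℕ._*_ q≡pⁿ q≡pⁿ)))) ι-size)
    where
    descend : ∀ k → ι (p ℕ.^ k) ≡ 0# → ι p ≡ 0#
    descend zero e = contradiction (trans (sym (+-identityʳ _)) e) 1≢0
    descend (suc k) e with *≡0 (trans (sym (ι-* p (p ℕ.^ k))) e)
    ... | inj₁ h = h
    ... | inj₂ h = descend k h

  ι-q : ι q ≡ 0#
  ι-q = trans (cong ι q≡pⁿ) (go n 1≤n)
    where
    go : ∀ k → 1 ℕ.≤ k → ι (p ℕ.^ k) ≡ 0#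
    go (suc k) _ = trans (ι-* p (p ℕ.^ k)) (zeroed (inj₁ char))

  conj : Carrier → Carrier
  conj x = x ^ q

  abstract
    conj-+ : ∀ x y → conj (x + y) ≡ conj x + conj y
    conj-+ x y = trans (power (x + y))
      (trans (Frobenius.^pᵉ-homo-+ commRing pp char n x y) (sym (cong₂ _+_ (power x) (power y))))
      where
      power : ∀ z → conj z ≡ z Exp.^ (p ℕ.^ n)
      power z = trans (cong (z ^_) q≡pⁿ) (^≡Exp z (p ℕ.^ n))

  conj-* : ∀ x y → conj (x * y) ≡ conj x * conj y
  conj-* x y = *-^ x y q

  conj-0 : conj 0# ≡ 0#
  conj-0 = 0^ q 0<q

  conj-1 : conj 1# ≡ 1#
  conj-1 = 1^ q

  abstract
    conj-neg : ∀ x → conj (- x) ≡ - conj x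
    conj-neg x = begin
      conj (- x)                          ≡⟨ solve 2 (λ a b → a := (b :+ a) :- b) refl (conj (- x)) (conj x) ⟩
      (conj x + conj (- x)) - conj x      ≡⟨ cong (_- conj x) (trans (sym (conj-+ x (- x))) (trans (cong conj (-self x)) conj-0)) ⟩
      0# - conj x                         ≡⟨ +-identityˡ _ ⟩
      - conj x                            ∎
      where open ≡-Reasoning

  abstract
    conj-sub : ∀ x y → conj (x - y) ≡ conj x - conj y
    conj-sub x y = trans (conj-+ x (- y)) (cong (conj x +_) (conj-neg y))

  abstract
    conj-involutive : ∀ x → conj (conj x) ≡ x
    conj-involutive x = trans (sym (^-* x q q)) (fermat x (ℕₚ.*-mono-< 0<q 0<q))

  conj-inv : ∀ x (x≢0 : x ≢ 0#) → conj (inv x x≢0) * conj x ≡ 1#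
  conj-inv x x≢0 = trans (sym (conj-* _ _)) (trans (cong conj (inv* x x≢0)) conj-1)

  Fixed : Carrier → Set
  Fixed = InFq q K

  fixed? : ∀ x → Dec (Fixed x)
  fixed? x = conj x ≟ x

  abstract
    Fq : List Carrier
    Fq = filter fixed? elements

    Fq-unique : Unique Fq
    Fq-unique = Unique.filter⁺ fixed? elements-unique

    Fq-fixed : All Fixed Fq
    Fq-fixed = all-filter fixed? elements

    ∈Fq : ∀ {x} → Fixed x → x ∈ Fq
    ∈Fq {x} fx = ∈-filter⁺ fixed? (elements-complete x) fx

    ∈Fq⁻ : ∀ {x} → x ∈ Fq → Fixed x
    ∈Fq⁻ x∈ = proj₂ (∈-filter⁻ fixed? {xs = elements} x∈)

    Fq-complement : length Fq ℕ.+ length (filter (λ x → ¬? (fixed? x)) elements) ≡ length elements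
    Fq-complement = length-filter-¬ fixed? elements

  module _ (r : ℕ) where
    geometric : ℕ → Ser
    geometric zero = 0S
    geometric (suc m) = 1S ⊕ X ↑ r ⊗ geometric m

    Deg-geometric : ∀ m → Deg (geometric (suc m)) (suc (m ℕ.* r))
    Deg-geometric zero = Deg-⊕ {1S} Deg-const (λ i _ → trans (at (S.zeroʳ (X ↑ r)) i) refl)
    Deg-geometric (suc m) = Deg-⊕ (Deg-mono (ℕ.s≤s ℕ.z≤n) Deg-const)
      (Deg-⊗ (Deg-X↑ r) (Deg-geometric m) (ℕₚ.≤-reflexive (cong suc (ℕₚ.+-suc r (m ℕ.* r)))))

    abstract
      Ev-geometric : ∀ m x → ∃ λ v → Ev (geometric m) x v × (x ^ r - 1#) * v ≡ x ^ (r ℕ.* m) - 1#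
      Ev-geometric zero x = 0# , evaluates 0 Deg-0S refl , trans (zeroʳ _) (sym (trans (cong (λ k → x ^ k - 1#) (ℕₚ.*-zeroʳ r)) (-self 1#)))
      Ev-geometric (suc m) x with Ev-geometric m x
      ... | v , E , e = 1# + x ^ r * v , Ev-⊕ (Ev-const 1#) (Ev-⊗ (Ev-↑ r Ev-X) E) , (begin
        (x ^ r - 1#) * (1# + x ^ r * v)
          ≡⟨ solve 2 (λ z v → (z :- :1) :* (:1 :+ z :* v) := (z :- :1) :+ z :* ((z :- :1) :* v)) refl (x ^ r) v ⟩
        (x ^ r - 1#) + x ^ r * ((x ^ r - 1#) * v)
          ≡⟨ cong (λ w → (x ^ r - 1#) + x ^ r * w) e ⟩
        (x ^ r - 1#) + x ^ r * (x ^ (r ℕ.* m) - 1#)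
          ≡⟨ solve 2 (λ z w → (z :- :1) :+ z :* (w :- :1) := z :* w :- :1) refl (x ^ r) (x ^ (r ℕ.* m)) ⟩
        x ^ r * x ^ (r ℕ.* m) - 1#
          ≡⟨ cong (_- 1#) (trans (sym (^-+ x r (r ℕ.* m))) (cong (x ^_) (sym (ℕₚ.*-suc r m)))) ⟩
        x ^ (r ℕ.* suc m) - 1# ∎)
        where open ≡-Reasoning

  abstract
    -- Put r = q - 1. An element that is not fixed satisfies xʳ ≠ 1 but has x to the power r (q + 1)
    -- equal to 1, so it is a root of the quotient 1 + Xʳ + ... of degree r q. This leaves at least
    -- q² - q r = q fixed elements.
    q≤|Fq| : q ℕ.≤ length Fq
    q≤|Fq| = go q refl
      where
      go : ∀ q′ → q ≡ q′ → q ℕ.≤ length Fq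
      go zero e = contradiction e (ℕₚ.>⇒≢ 0<q)
      go (suc r) e = ℕₚ.+-cancelʳ-≤ (length others) q (length Fq)
        (ℕₚ.≤-trans (ℕₚ.+-monoʳ-≤ q few)
          (ℕₚ.≤-reflexive (trans total (sym Fq-complement))))
        where
        others : List Carrier
        others = filter (λ x → ¬? (fixed? x)) elements
        G : Ser
        G = geometric r (suc q)
        root : ∀ {x} → ¬ Fixed x → Ev G x 0#
        root {x} nf with Ev-geometric r (suc q) x
        ... | v , E , eq with *≡0 (trans eq (trans (cong (_- 1#) power) (-self 1#)))
          where
          x≢0 : x ≢ 0#
          x≢0 refl = nf conj-0
          power : x ^ (r ℕ.* suc q) ≡ 1#
          power = *-cancelˡ x≢0 (trans (cong (x ^_) size) (trans (fermat x (ℕₚ.*-mono-< 0<q 0<q)) (sym (*-identityʳ x))))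
            where
            size : suc (r ℕ.* suc q) ≡ q ℕ.* q
            size = trans (cong suc (ℕₚ.*-suc r q)) (trans (cong (ℕ._+ r ℕ.* q) (sym e)) (cong (ℕ._* q) (sym e)))
        ...   | inj₂ v≡0 = Ev-value v≡0 E
        ...   | inj₁ xr≡1 = contradiction (trans (cong (x ^_) e) (trans (cong (x *_) (-≡0 xr≡1)) (*-identityʳ x))) nf
        few : length others ℕ.≤ q ℕ.* r
        few = root-bound {i = 0} others (Unique.filter⁺ (λ x → ¬? (fixed? x)) elements-unique)
          (All.map root (all-filter (λ x → ¬? (fixed? x)) elements)) (Deg-geometric r q) nonzero
          where
          0<r : 0 ℕ.< r
          0<r = ℕₚ.≤-pred (subst (1 ℕ.<_) e 1<q)
          nonzero : G 0 ≢ 0#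
          nonzero h = 1≢0 (trans (sym (trans (cong (1# +_) (X↑-⊗-low r (geometric r q) 0 0<r)) (+-identityʳ _))) h)
        total : q ℕ.+ q ℕ.* r ≡ length elements
        total = trans (sym (ℕₚ.*-suc q r)) (trans (cong (q ℕ.*_) (sym e)) (sym length-elements))

  form : Carrier → Carrier → Carrier
  form u c = u * conj c - conj u * c

  abstract
    form-conj : ∀ u c → conj (form u c) ≡ - form u c
    form-conj u c = begin
      conj (u * conj c - conj u * c)                           ≡⟨ conj-sub _ _ ⟩
      conj (u * conj c) - conj (conj u * c)                    ≡⟨ cong₂ _-_ (conj-* _ _) (conj-* _ _) ⟩
      conj u * conj (conj c) - conj (conj u) * conj c          ≡⟨ cong₂ (λ a b → conj u * a - b * conj c) (conj-involutive c) (conj-involutive u) ⟩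
      conj u * c - u * conj c                                  ≡⟨ solve 2 (λ a b → a :- b := :- (b :- a)) refl _ _ ⟩
      - form u c                                               ∎
      where open ≡-Reasoning

  abstract
    form-alternating : ∀ u → form u u ≡ 0#
    form-alternating u = solve 2 (λ u v → u :* v :- v :* u := :0) refl u (conj u)

  abstract
    form-antisymmetric : ∀ u c → form u c ≡ - form c u
    form-antisymmetric u c = solve 4 (λ u v c d → u :* d :- v :* c := :- (c :* v :- d :* u)) refl u (conj u) c (conj c)

  form-flip : ∀ {u c} → form u c ≡ 0# → form c u ≡ 0#
  form-flip {u} {c} e = trans (form-antisymmetric c u) (trans (cong -_ e) -0≡0)

  fixed-sub : ∀ {x y} → Fixed x → Fixed y → Fixed (x - y)
  fixed-sub fx fy = trans (conj-sub _ _) (cong₂ _-_ fx fy)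

  fixed-neg : ∀ {x} → Fixed x → Fixed (- x)
  fixed-neg fx = trans (conj-neg _) (cong -_ fx)

  abstract
    form-sub : ∀ u v c → form (u - v) c ≡ form u c - form v c
    form-sub u v c = trans (cong (λ w → (u - v) * conj c - w * c) (conj-sub u v))
      (solve 6 (λ u v a b c d → (u :- v) :* d :- (a :- b) :* c := (u :* d :- a :* c) :- (v :* d :- b :* c)) refl u v (conj u) (conj v) c (conj c))

  abstract
    form-combineʳ : ∀ u e d {y} → Fixed y → form u (e + d * y) ≡ form u e + form u d * y
    form-combineʳ u e d {y} fy = trans
      (cong (λ w → u * w - conj u * (e + d * y)) (trans (conj-+ e (d * y)) (cong (conj e +_) (trans (conj-* d y) (cong (conj d *_) fy)))))
      (solve 7 (λ u v e f d g y → u :* (f :+ g :* y) :- v :* (e :+ d :* y) := (u :* f :- v :* e) :+ (u :* g :- v :* d) :* y) refl u (conj u) e (conj e) d (conj d) y)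

  abstract
    form-scaleʳ : ∀ u d {y} → Fixed y → form u (d * y) ≡ form u d * y
    form-scaleʳ u d {y} fy = trans (cong (λ w → u * w - conj u * (d * y)) (trans (conj-* d y) (cong (conj d *_) fy)))
      (solve 5 (λ u v d g y → u :* (g :* y) :- v :* (d :* y) := (u :* g :- v :* d) :* y) refl u (conj u) d (conj d) y)

  abstract
    form-scaleˡ : ∀ u d {y} → Fixed y → form (u * y) d ≡ form u d * y
    form-scaleˡ u d {y} fy = trans (cong (λ w → u * y * conj d - w * d) (trans (conj-* u y) (cong (conj u *_) fy)))
      (solve 5 (λ u v d g y → u :* y :* g :- (v :* y) :* d := (u :* g :- v :* d) :* y) refl u (conj u) d (conj d) y)

  abstract
    form-zero : ∀ {u c} → c ≢ 0# → form u c ≡ 0# → ∃ λ a → Fixed a × u ≡ c * a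
    form-zero {u} {c} c≢0 e = u * i , fixed , (begin
      u              ≡⟨ *-identityʳ u ⟨
      u * 1#         ≡⟨ cong (u *_) (sym (*-inv c c≢0)) ⟩
      u * (c * i)    ≡⟨ solve 3 (λ u c i → u :* (c :* i) := c :* (u :* i)) refl u c i ⟩
      c * (u * i)    ∎)
      where
      open ≡-Reasoning
      i : Carrier
      i = inv c c≢0
      fixed : Fixed (u * i)
      fixed = *-cancelˡ (*≢0 c≢0 (^≢0 q c≢0)) (begin
        (c * conj c) * conj (u * i)          ≡⟨ cong ((c * conj c) *_) (conj-* u i) ⟩
        (c * conj c) * (conj u * conj i)     ≡⟨ solve 4 (λ c d v j → (c :* d) :* (v :* j) := (v :* c) :* (j :* d)) refl c (conj c) (conj u) (conj i) ⟩
        (conj u * c) * (conj i * conj c)     ≡⟨ cong₂ _*_ (sym (-≡0 e)) (conj-inv c c≢0) ⟩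
        (u * conj c) * 1#                    ≡⟨ cong ((u * conj c) *_) (sym (*-inv c c≢0)) ⟩
        (u * conj c) * (c * i)               ≡⟨ solve 4 (λ u d c i → (u :* d) :* (c :* i) := (c :* d) :* (u :* i)) refl u (conj c) c i ⟩
        (c * conj c) * (u * i)               ∎)

  abstract
    form-on-line : ∀ x d {a} → Fixed a → form (x + d * a) d ≡ form x d
    form-on-line x d {a} fa = begin
      form (x + d * a) d            ≡⟨ form-antisymmetric _ d ⟩
      - form d (x + d * a)          ≡⟨ cong -_ (form-combineʳ d x d fa) ⟩
      - (form d x + form d d * a)   ≡⟨ cong (λ z → - (form d x + z * a)) (form-alternating d) ⟩
      - (form d x + 0# * a)         ≡⟨ solve 2 (λ f a → :- (f :+ :0 :* a) := :- f) refl (form d x) a ⟩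
      - form d x                    ≡⟨ form-antisymmetric x d ⟨
      form x d                      ∎
      where open ≡-Reasoning

  abstract
    -- Cramer's rule: three vectors of a plane are dependent, with values of the form as
    -- coefficients.
    form-plücker : ∀ c e d → form e d * c ≡ form c d * e - form c e * d
    form-plücker c e d = solve 6 (λ c c′ e e′ d d′ →
      (e :* d′ :- e′ :* d) :* c := (c :* d′ :- c′ :* d) :* e :- (c :* e′ :- c′ :* e) :* d) refl c (conj c) e (conj e) d (conj d)

-- Directions of a clique and their polynomials.

unique-tabulate⁻ : ∀ {A : Set} {n} {f : Fin n → A} → Unique (tabulate f) → ∀ i j → f i ≡ f j → i ≡ j
unique-tabulate⁻ {n = suc n} (_ ∷ u) zero zero e = refl
unique-tabulate⁻ {n = suc n} (a ∷ u) zero (suc j) e = contradiction e (All.tabulate⁻ a j)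
unique-tabulate⁻ {n = suc n} (a ∷ u) (suc i) zero e = contradiction (sym e) (All.tabulate⁻ a i)
unique-tabulate⁻ {n = suc n} (a ∷ u) (suc i) (suc j) e = cong suc (unique-tabulate⁻ u i j e)

module PeisertDirections (𝕂 : Setting) {m : ℕ} (Γ : Graph 𝕂 m) where
  open QuadraticField 𝕂
  open PeisertData Γ

  independent : ∀ {i j} → i ≢ j → form (c i) (c j) ≢ 0#
  independent {i} {j} i≢j e with form-zero (nonzero j) e
  ... | a , fa , ci≡ = distinct i j i≢j (a , (fa , λ { refl → nonzero i (trans ci≡ (zeroʳ _)) }) , ci≡)

  abstract
    parallel : ∀ {d k} → d ≢ 0# → form (c k) d ≡ 0# → ∃ λ a → Fixed a × a ≢ 0# × d ≡ c k * a
    parallel {d} {k} d≢0 e with form-zero (nonzero k) (form-flip e)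
    ... | a , fa , d≡ = a , fa , (λ { refl → d≢0 (trans d≡ (zeroʳ _)) }) , d≡

  abstract
    parallel-≢ : ∀ {d k j} → d ≢ 0# → form (c k) d ≡ 0# → j ≢ k → form (c j) d ≢ 0#
    parallel-≢ {d} {k} {j} d≢0 e j≢k e′ with parallel d≢0 e
    ... | a , fa , a≢0 , refl = *≢0 (independent j≢k) a≢0 (trans (sym (form-scaleʳ (c j) (c k) fa)) e′)

  parallel-transfer : ∀ {d k e} → d ≢ 0# → form (c k) d ≡ 0# → form e d ≢ 0# → form (c k) e ≢ 0#
  parallel-transfer {d} {k} {e} d≢0 ck ed≢0 eq with parallel d≢0 ck
  ... | a , fa , a≢0 , refl = ed≢0 (begin
    form e (c k * a)     ≡⟨ form-scaleʳ e (c k) fa ⟩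
    form e (c k) * a     ≡⟨ cong (_* a) (form-antisymmetric e (c k)) ⟩
    - form (c k) e * a   ≡⟨ cong (λ z → - z * a) eq ⟩
    - 0# * a             ≡⟨ cong (_* a) -0≡0 ⟩
    0# * a               ≡⟨ zeroˡ a ⟩
    0#                   ∎)
    where open ≡-Reasoning

module Directions (𝕂 : Setting) (r : ℕ) (Γ : Graph 𝕂 (suc (suc r))) (C : Clique 𝕂 Γ) where
  open QuadraticField 𝕂 public
  open PeisertDirections 𝕂 Γ public
  open PeisertData Γ public
  open MaxClique C public

  -- Types 0 and 1 are strict, so the type may be written as r + 2. This gives m - 1 without
  -- subtraction and a second direction `other` next to every given one.
  m : ℕ
  m = suc (suc r)

  abstract
    edge : ∀ {i j} → i ≢ j → ∃ λ k → ∃ λ a → Fixed a × a ≢ 0# × v i - v j ≡ c k * a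
    edge {i} {j} i≢j with clique i j i≢j
    ... | k , a , (fa , a≢0) , e = k , a , fa , a≢0 , e

  values : Carrier → List Carrier
  values d = tabulate (λ i → form (v i) d)

  length-values : ∀ d → length (values d) ≡ q
  length-values d = length-tabulate _

  Φ : Ser
  Φ = X ↑ q ⊕ X

  Φ-finite : Deg Φ (suc q)
  Φ-finite = Deg-⊕ (Deg-X↑ q) (Deg-mono (ℕ.s≤s (ℕₚ.<⇒≤ 1<q)) Deg-X)

  abstract
    Φ-root : ∀ {x} → conj x ≡ - x → Ev Φ x 0#
    Φ-root {x} e = Ev-value (trans (cong (_+ x) e) (-‿inverseˡ x)) (Ev-⊕ (Ev-↑ q Ev-X) Ev-X)

  abstract
    values-roots : ∀ d → All (λ x → Ev Φ x 0#) (values d)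
    values-roots d = All.tabulate⁺ (λ i → Φ-root (form-conj (v i) d))

  Φ-gap : ∀ {i} → i ≢ 1 → i ≢ q → Φ i ≡ 0#
  Φ-gap {i} i≢1 i≢q = trans (cong₂ _+_ (X↑-other q i i≢q) (X-other i≢1)) (+-identityˡ _)

  q≢1 : q ≢ 1
  q≢1 = ℕₚ.>⇒≢ 1<q

  Φ-top : Φ q ≡ 1#
  Φ-top = trans (cong₂ _+_ (X↑-top q) (X-other q≢1)) (+-identityʳ _)

  D-Φ : D Φ ≈ 1S
  D-Φ = S.trans (D-⊕ (X ↑ q) X) (S.trans (S.+-cong (pointwise D-X↑q) D-X) (S.+-identityˡ 1S))
    where
    D-X↑q : ∀ i → D (X ↑ q) i ≡ 0#
    D-X↑q i with suc i ℕ.≟ q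
    ... | yes e = zeroed (inj₁ (trans (cong ι e) ι-q))
    ... | no ne = zeroed (inj₂ (X↑-other q (suc i) ne))

  -- The condition refers to the cosets of the graph, which contain all differences of the clique.
  -- That each coset really occurs as a difference is a separate hypothesis, `AllDetermined`.
  Undetermined : Carrier → Set
  Undetermined d = ∀ k → form (c k) d ≢ 0#

  undetermined-injective : ∀ {d} → Undetermined d → ∀ i j → form (v i) d ≡ form (v j) d → i ≡ j
  undetermined-injective {d} und i j e with i Fin.≟ j
  ... | yes i≡j = i≡j
  ... | no i≢j with edge i≢j
  ...   | k , a , fa , a≢0 , eq = contradiction
          (trans (sym (form-scaleˡ (c k) d fa)) (trans (cong (λ w → form w d) (sym eq)) (trans (form-sub (v i) (v j) d) (trans (cong (_- form (v j) d) e) (-self _)))))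
          (*≢0 (und k) a≢0)

  abstract
    prod-undetermined : ∀ {d} → Undetermined d → prod (values d) ≈ Φ
    prod-undetermined {d} und = S.sym (monic-prod (values d) (Unique.tabulate⁺ (λ {i} {j} → undetermined-injective und i j)) (values-roots d)
      (subst (λ l → Deg Φ (suc l)) (sym (length-values d)) Φ-finite) (subst (λ l → Φ l ≡ 1#) (sym (length-values d)) Φ-top))

  record Determined (d : Carrier) : Set where
    constructor determined
    field
      d≢0   : d ≢ 0#
      index : Fin m
      along : form (c index) d ≡ 0#

  other : Fin m → Fin m
  other zero = suc zero
  other (suc _) = zero

  other≢ : ∀ k → k ≢ other k
  other≢ zero ()
  other≢ (suc k) ()

  module Pencil (d e : Carrier) (ed≢0 : form e d ≢ 0#) where

    pairs : List (Carrier × Carrier)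
    pairs = tabulate (λ i → form (v i) d , form (v i) e)

    length-pairs : length pairs ≡ q
    length-pairs = length-tabulate _

    values-pairs : ∀ {y} → Fixed y → map (value y) pairs ≡ values (e + d * y)
    values-pairs {y} fy = trans (map-tabulate _ (value y)) (tabulate-cong (λ i → sym (form-combineʳ (v i) e d fy)))

    values-pairs∞ : map proj₁ pairs ≡ values d
    values-pairs∞ = map-tabulate _ proj₁

    bad? : ∀ y → Dec (∃ λ k → form (c k) (e + d * y) ≡ 0#)
    bad? y = Fin.any? (λ k → form (c k) (e + d * y) ≟ 0#)

    good : List Carrier
    good = filter (λ y → ¬? (bad? y)) Fq

    good-unique : Unique good
    good-unique = Unique.filter⁺ (λ y → ¬? (bad? y)) Fq-unique

    good-undetermined : ∀ {y} → y ∈ good → Fixed y × Undetermined (e + d * y)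
    good-undetermined y∈ with ∈-filter⁻ (λ y → ¬? (bad? y)) {xs = Fq} y∈
    ... | y∈Fq , ¬bad = ∈Fq⁻ y∈Fq , λ k eq → ¬bad (k , eq)

    module _ (det : Determined d) where
      open Determined det

      -- The direction parallel to d is the point at infinity of the pencil. Each of the other m - 1
      -- directions is met for at most one y, the root of an affine factor with nonzero slope, so
      -- the bad y are roots of a product of r + 1 factors.
      few-bad : length (filter bad? Fq) ℕ.≤ suc r
      few-bad = subst (length (filter bad? Fq) ℕ.≤_) (length-tabulate pair)
        (root-bound {affineProd factors} {length factors} {zeros factors} (filter bad? Fq) (Unique.filter⁺ bad? Fq-unique) (All.tabulate root)
          (Deg-affineProd factors) (nonzero-at (Order-affineProd factors (All.tabulate⁺ {f = pair} (λ k _ → slope k)))))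
        where
        pair : Fin (suc r) → Carrier × Carrier
        pair k = form (c (punchIn index k)) d , form (c (punchIn index k)) e
        slope : ∀ k → form (c (punchIn index k)) d ≢ 0#
        slope k = parallel-≢ d≢0 along (Fin.punchInᵢ≢i index k)
        factors = tabulate pair
        root : ∀ {y} → y ∈ filter bad? Fq → Ev (affineProd factors) y 0#
        root {y} y∈ with ∈-filter⁻ bad? {xs = Fq} y∈
        ... | y∈Fq , k , eq = Ev-affineProd-root factors (pair (punchOut k≢)) (∈-tabulate⁺ {f = pair} (punchOut k≢))
              (trans (cong₂ (λ a b → form (c a) e + form (c b) d * y) (Fin.punchIn-punchOut k≢) (Fin.punchIn-punchOut k≢))
                (trans (sym (form-combineʳ (c k) e d (∈Fq⁻ y∈Fq))) eq))
          where
          k≢ : index ≢ k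
          k≢ refl = parallel-transfer d≢0 along ed≢0
            (trans (sym (+-identityʳ _)) (trans (cong (form (c index) e +_) (sym (zeroed (inj₁ along))))
              (trans (sym (form-combineʳ (c index) e d (∈Fq⁻ y∈Fq))) eq)))

      many-good : q ℕ.≤ suc r ℕ.+ length good
      many-good = ℕₚ.≤-trans q≤|Fq| (ℕₚ.≤-trans (ℕₚ.≤-reflexive (sym (length-filter-¬ bad? Fq))) (ℕₚ.+-monoˡ-≤ _ few-bad))

      lacunary : ∀ i → m ℕ.≤ i → i ℕ.< q → prod (values d) i ≡ 0#
      lacunary i m≤i i<q = trans (cong (λ l → prod l i) (sym values-pairs∞))
        (lacunary-coefficient pairs good i good-unique (All.tabulate vanish)
          (ℕₚ.≤-trans (ℕₚ.≤-reflexive (cong suc length-pairs)) (ℕₚ.≤-trans (ℕ.s≤s many-good) (ℕₚ.+-monoˡ-≤ (length good) m≤i)))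
          (ℕₚ.≤-trans (ℕₚ.<⇒≤ i<q) (ℕₚ.≤-reflexive (sym length-pairs))))
        where
        vanish : ∀ {y} → y ∈ good → prod (map (value y) pairs) i ≡ 0#
        vanish {y} y∈ with good-undetermined y∈
        ... | fy , und = trans (cong (λ l → prod l i) (values-pairs fy))
              (trans (at (prod-undetermined und) i) (Φ-gap (ℕₚ.>⇒≢ (ℕₚ.≤-trans (ℕ.s≤s (ℕ.s≤s ℕ.z≤n)) m≤i)) (ℕₚ.<⇒≢ i<q)))

  abstract
    transversal : ∀ {d} → Determined d → ∃ λ e → form e d ≢ 0#
    transversal (determined d≢0 k along) = c (other k) , parallel-≢ d≢0 along (other≢ k ∘ sym)

  module DeterminedDirection {d : Carrier} (det : Determined d) where
    h : Ser
    h = prod (values d)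

    h-monic : h q ≡ 1#
    h-monic = subst (λ l → h l ≡ 1#) (length-values d) (prod-monic (values d))

    h-degree : Deg h (suc q)
    h-degree = subst (λ l → Deg h (suc l)) (length-values d) (Deg-prod (values d))

    h-gap : ∀ i → m ℕ.≤ i → i ℕ.< q → h i ≡ 0#
    h-gap = Pencil.lacunary d (proj₁ (transversal det)) (proj₂ (transversal det)) det

    G : Ser
    G = Φ ⊕ ⊖ h

    G-degree : Deg G m
    G-degree i m≤i with ℕₚ.<-cmp i q
    ... | tri< i<q i≢q _ = trans (cong₂ _-_ (Φ-gap (ℕₚ.>⇒≢ (ℕₚ.≤-trans (ℕ.s≤s (ℕ.s≤s ℕ.z≤n)) m≤i)) i≢q) (h-gap i m≤i i<q)) (-self 0#)
    ... | tri≈ _ refl _ = trans (cong₂ _-_ Φ-top h-monic) (-self 1#)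
    ... | tri> _ _ q<i = trans (cong₂ _-_ (Φ-finite i q<i) (h-degree i q<i)) (-self 0#)

    Dh-degree : Deg (D h) (suc r)
    Dh-degree i r<i with ℕₚ.<-cmp (suc i) q
    ... | tri< i<q _ _ = zeroed (inj₂ (h-gap (suc i) (ℕ.s≤s r<i) i<q))
    ... | tri≈ _ e _ = zeroed (inj₁ (trans (cong ι e) ι-q))
    ... | tri> _ _ q<i = zeroed (inj₂ (h-degree (suc i) q<i))

    abstract
      h∣G⊗Dh : ∃ λ A → Finite A × G ⊗ D h ≈ h ⊗ A
      h∣G⊗Dh with prod∣Φ⊗D (suc q , Φ-finite) (values d) (values-roots d)
      ... | A , finA , e = A ⊕ ⊖ D h , Finite-⊕ finA (Finite-⊖ (_ , Dh-degree)) , (begin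
        (Φ ⊕ ⊖ h) ⊗ D h           ≈⟨ solveS 3 (λ f h d → (f ⊞ ⊟ h) ⊠ d ⩴ f ⊠ d ⊞ ⊟ (h ⊠ d)) S.refl Φ h (D h) ⟩
        Φ ⊗ D h ⊕ ⊖ (h ⊗ D h)     ≈⟨ S.+-congʳ e ⟩
        h ⊗ A ⊕ ⊖ (h ⊗ D h)       ≈⟨ solveS 3 (λ h a d → h ⊠ a ⊞ ⊟ (h ⊠ d) ⩴ h ⊠ (a ⊞ ⊟ d)) S.refl h A (D h) ⟩
        h ⊗ (A ⊕ ⊖ D h)           ∎)
        where open ≈-Reasoning

    -- In that case h = Φ has derivative 1 and only simple roots, so d is not a direction of the
    -- clique.
    G≈0⇒injective : G ≈ 0S → ∀ i j → form (v i) d ≡ form (v j) d → i ≡ j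
    G≈0⇒injective G≈0 = unique-tabulate⁻ (simple-roots⇒unique (values d)
      (λ x _ E → 1≢0 (sym (Ev-unique Dh≈1 E (Ev-const 1#)))))
      where
      Φ≈h : Φ ≈ h
      Φ≈h = pointwise λ i → -≡0 (at G≈0 i)
      Dh≈1 : D h ≈ 1S
      Dh≈1 = S.trans (D-cong (S.sym Φ≈h)) D-Φ

    -- G (D h) has degree at most (m - 1) + (m - 2) < q, while its divisor h has degree q. Hence the
    -- product is zero.
    few-directions : m ℕ.+ suc r ℕ.≤ suc q → G ≈ 0S ⊎ D h ≈ 0S
    few-directions small with h∣G⊗Dh
    ... | A , finA , e = ⊗-domain (_ , G-degree) (_ , Dh-degree)
      (S.trans e (S.trans (S.*-congˡ (pointwise A≡0)) (S.zeroʳ h)))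
      where
      A≡0 : ∀ i → A i ≡ 0#
      A≡0 i = Deg-cofactor h-degree h-monic finA (Deg-cong e (Deg-⊗ G-degree Dh-degree small)) i (ℕₚ.m≤m+n q i)

-- Parallel lines meet the clique equally often.

unique-split : ∀ {A : Set} (xs : List A) {y ys} → Unique (xs ++ y ∷ ys) → All (y ≢_) (xs ++ ys)
unique-split [] (a ∷ _) = a
unique-split (x ∷ xs) {y} (a ∷ u) = (λ y≡x → All.lookup a (∈-++⁺ʳ xs (here refl)) (sym y≡x)) ∷ unique-split xs u

∈-nonempty : ∀ {A : Set} {x : A} {L} → x ∈ L → 1 ℕ.≤ length L
∈-nonempty (here _) = ℕ.s≤s ℕ.z≤n
∈-nonempty (there _) = ℕ.s≤s ℕ.z≤n

module Multiplicities (𝕂 : Setting) (r : ℕ) (Γ : Graph 𝕂 (suc (suc r))) (C : Clique 𝕂 Γ) where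
  open Directions 𝕂 r Γ C public

  abstract
    -- Two independent directions give a coordinate system: by the Plücker relation a difference on
    -- which both forms vanish is zero.
    separated : ∀ {e f} → form e f ≢ 0# → ∀ i j → form (v i) e ≡ form (v j) e → form (v i) f ≡ form (v j) f → i ≡ j
    separated {e} {f} ef≢0 i j ee ff = inj i j (-≡0 (*-cancelˡ ef≢0 (begin
      form e f * w                 ≡⟨ form-plücker w e f ⟩
      form w f * e - form w e * f  ≡⟨ cong₂ (λ a b → a * e - b * f) (vanish f ff) (vanish e ee) ⟩
      0# * e - 0# * f              ≡⟨ solve 3 (λ e f g → :0 :* e :- :0 :* f := g :* :0) refl e f (form e f) ⟩
      form e f * 0#                ∎)))
      where
      open ≡-Reasoning
      w : Carrier
      w = v i - v j
      vanish : ∀ d → form (v i) d ≡ form (v j) d → form w d ≡ 0#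
      vanish d eq = trans (form-sub (v i) (v j) d) (trans (cong (_- form (v j) d) eq) (-self _))

  difference : Carrier × Carrier → Carrier × Carrier → Carrier × Carrier
  difference (a , b) (a′ , b′) = a - a′ , b - b′

  private
    Point = Carrier × Carrier

  -- One number read in two ways. The product of the differences between the value of l and the
  -- other values at y is a polynomial in X evaluated at the value of l, and also a polynomial in
  -- the pencil parameter evaluated at y.
  Ev-differences : ∀ y l O → ∃ λ w →
    Ev (prod (map (value y) O)) (value y l) w × Ev (affineProd (map (difference l) O)) y w
  Ev-differences y l [] = 1# , Ev-const 1# , Ev-const 1#
  Ev-differences y l (l′ ∷ O) with Ev-differences y l O
  ... | w , E , F = (value y l - value y l′) * w , Ev-⊗ (Ev-lin (value y l′)) E ,
    Ev-⊗ (Ev-value (solve 5 (λ a b a′ b′ y → (b :- b′) :+ (a :- a′) :* y := (b :+ a :* y) :- (b′ :+ a′ :* y)) refl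
      (proj₁ l) (proj₂ l) (proj₁ l′) (proj₂ l′) y) (Ev-affine (difference l l′))) F

  count-difference : ∀ l ys zs →
    count (proj₂ l) (map proj₂ (ys ++ l ∷ zs)) ≡ suc (zeros (map (difference l) (ys ++ zs)))
  count-difference l (y ∷ ys) zs with proj₂ y ≟ proj₂ l | (proj₂ l - proj₂ y) ≟ 0#
  ... | yes _ | yes _ = cong suc (count-difference l ys zs)
  ... | yes e | no ne = contradiction (trans (cong (λ z → proj₂ l - z) e) (-self _)) ne
  ... | no ne | yes e = contradiction (sym (-≡0 e)) ne
  ... | no _ | no _ = count-difference l ys zs
  count-difference l [] zs with proj₂ l ≟ proj₂ l
  ... | no ne = contradiction refl ne
  ... | yes _ = cong suc (rest zs)
    where
    rest : ∀ zs → count (proj₂ l) (map proj₂ zs) ≡ zeros (map (difference l) zs)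
    rest [] = refl
    rest (z ∷ zs) with proj₂ z ≟ proj₂ l | (proj₂ l - proj₂ z) ≟ 0#
    ... | yes _ | yes _ = cong suc (rest zs)
    ... | yes e | no ne = contradiction (trans (cong (λ z → proj₂ l - z) e) (-self _)) ne
    ... | no ne | yes e = contradiction (sym (-≡0 e)) ne
    ... | no _ | no _ = rest zs

  -- If all h_d have constant derivative, the polynomial ∏_{l′ ≠ l} (slope of l − l′ in Y) does not
  -- depend on l, since its value at y is the derivative of h at the root belonging to l.
  module _ (d e : Carrier) (ed≢0 : form e d ≢ 0#)
    (derivative : ∀ y → Fixed y → ∃ λ κ → D (prod (values (e + d * y))) ≈ const κ) where
    open Pencil d e ed≢0

    pairs-unique : Unique pairs
    pairs-unique = Unique.tabulate⁺ (λ {i} {j} eq → separated ed≢0 i j (cong proj₂ eq) (cong proj₁ eq))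

    abstract
      slopes : ∀ {y} (fy : Fixed y) ys l zs → pairs ≡ ys ++ l ∷ zs →
        Ev (affineProd (map (difference l) (ys ++ zs))) y (proj₁ (derivative y fy))
      slopes {y} fy ys l zs split = go (Ev-differences y l (ys ++ zs))
        where
        h≈ : prod (values (e + d * y)) ≈ lin (value y l) ⊗ prod (map (value y) (ys ++ zs))
        h≈ = S.trans (S.reflexive (cong prod (trans (sym (values-pairs fy)) (trans (cong (map (value y)) split) (map-++ _ ys _)))))
          (S.trans (prod-insert (map (value y) ys) (value y l) (map (value y) zs))
            (S.*-congˡ (S.reflexive (cong prod (sym (map-++ (value y) ys zs))))))
          where open import Data.List.Properties using (map-++)
        go : (∃ λ w → Ev (prod (map (value y) (ys ++ zs))) (value y l) w × Ev (affineProd (map (difference l) (ys ++ zs))) y w) →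
          Ev (affineProd (map (difference l) (ys ++ zs))) y (proj₁ (derivative y fy))
        go (w , E , F) = Ev-value (Ev-unique
          (S.trans (S.sym (S.trans (D-cong h≈) (D-lin-⊗ (value y l) (prod (map (value y) (ys ++ zs)))))) (proj₂ (derivative y fy)))
          (Ev-value (trans (cong (w +_) (zeroed (inj₁ (-self _)))) (+-identityʳ w))
            (Ev-⊕ E (Ev-⊗ (Ev-lin (value y l)) (Ev-total (Deg-D (Deg-prod (map (value y) (ys ++ zs))))))))
          (Ev-const _)) F

      -- Both products have q - 1 affine factors and agree on 𝔽_q, so they are equal as polynomials.
      -- Their order at y = 0 counts the further points of the clique on the line in direction e
      -- through the point of l.
      equal-zeros : ∀ ys l zs ys′ l′ zs′ → pairs ≡ ys ++ l ∷ zs → pairs ≡ ys′ ++ l′ ∷ zs′ →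
        zeros (map (difference l) (ys ++ zs)) ≡ zeros (map (difference l′) (ys′ ++ zs′))
      equal-zeros ys l zs ys′ l′ zs′ split split′ = Order-unique W≈W′ (ord ys l zs split) (ord ys′ l′ zs′ split′)
        where
        W W′ : Ser
        W = affineProd (map (difference l) (ys ++ zs))
        W′ = affineProd (map (difference l′) (ys′ ++ zs′))
        degree : ∀ ys l zs → pairs ≡ ys ++ l ∷ zs → Deg (affineProd (map (difference l) (ys ++ zs))) q
        degree ys l zs split = subst (Deg (affineProd (map (difference l) (ys ++ zs)))) len (Deg-affineProd (map (difference l) (ys ++ zs)))
          where
          open import Data.List.Properties using (length-++)
          len : suc (length (map (difference l) (ys ++ zs))) ≡ q
          len = trans (cong suc (trans (length-map (difference l) (ys ++ zs)) (length-++ ys)))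
            (trans (sym (ℕₚ.+-suc (length ys) (length zs))) (trans (sym (length-++ ys)) (trans (cong length (sym split)) length-pairs)))
        W≈W′ : W ≈ W′
        W≈W′ = pointwise λ i → -≡0 (at (too-many-roots {W ⊕ ⊖ W′} Fq Fq-unique
          (All.map (λ fy → Ev-value (-self _) (Ev-⊕ (slopes fy ys l zs split) (Ev-⊖ (slopes fy ys′ l′ zs′ split′)))) Fq-fixed)
          (Deg-⊕ (degree ys l zs split) (Deg-⊖ (degree ys′ l′ zs′ split′))) q≤|Fq|) i)
        ord : ∀ ys l zs → pairs ≡ ys ++ l ∷ zs → Order (affineProd (map (difference l) (ys ++ zs))) (zeros (map (difference l) (ys ++ zs)))
        ord ys l zs split = Order-affineProd _ (All.map⁺ (All.map
          (λ { {l′} l≢l′ b≡ a≡ → l≢l′ (cong₂ _,_ (-≡0 a≡) (-≡0 b≡)) }) (unique-split ys (subst Unique split pairs-unique))))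

      values-e : map proj₂ pairs ≡ values e
      values-e = map-tabulate _ proj₂

      equal-counts : ∀ i j → count (form (v i) e) (values e) ≡ count (form (v j) e) (values e)
      equal-counts i j = go (∈-∃++ (∈-tabulate⁺ i)) (∈-∃++ (∈-tabulate⁺ j))
        where
        l : Fin q → Carrier × Carrier
        l i = form (v i) d , form (v i) e
        counted : ∀ i {ys zs} → pairs ≡ ys ++ l i ∷ zs → count (form (v i) e) (values e) ≡ suc (zeros (map (difference (l i)) (ys ++ zs)))
        counted i {ys} {zs} split = trans (cong (count (form (v i) e)) (trans (sym values-e) (cong (map proj₂) split))) (count-difference (l i) ys zs)
        go : (∃ λ ys → ∃ λ zs → pairs ≡ ys ++ l i ∷ zs) → (∃ λ ys → ∃ λ zs → pairs ≡ ys ++ l j ∷ zs) →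
          count (form (v i) e) (values e) ≡ count (form (v j) e) (values e)
        go (ys , zs , split) (ys′ , zs′ , split′) = trans (counted i split)
          (trans (cong suc (equal-zeros ys (l i) zs ys′ (l j) zs′ split split′)) (sym (counted j split′)))

two-members : ∀ {A : Set} {x y : A} {L} → x ∈ L → y ∈ L → x ≢ y → 2 ℕ.≤ length L
two-members (here refl) (here refl) x≢y = contradiction refl x≢y
two-members (here refl) (there y∈) x≢y = ℕ.s≤s (∈-nonempty y∈)
two-members (there x∈) _ x≢y = ℕ.s≤s (∈-nonempty x∈)

filter-split : ∀ {A : Set} {P Q : A → Set} (P? : Decidable P) (Q? : Decidable Q) L →
  length (filter P? L) ≡ length (filter P? (filter Q? L)) ℕ.+ length (filter P? (filter (λ x → ¬? (Q? x)) L))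
filter-split P? Q? [] = refl
filter-split P? Q? (x ∷ L) with Q? x
... | yes _ with P? x
...   | yes _ = cong suc (filter-split P? Q? L)
...   | no _ = filter-split P? Q? L
filter-split P? Q? (x ∷ L) | no _ with P? x
...   | yes _ = trans (cong suc (filter-split P? Q? L)) (sym (ℕₚ.+-suc _ _))
...   | no _ = filter-split P? Q? L

module FewDirections (𝕂 : Setting) (r : ℕ) (Γ : Graph 𝕂 (suc (suc r))) (C : Clique 𝕂 Γ) where
  open Multiplicities 𝕂 r Γ C public

  -- Supplied by the minimality of an extremal graph; it excludes the case G = 0 for every coset.
  AllDetermined : Set
  AllDetermined = ∀ k → ∃ λ i → ∃ λ j → i ≢ j × form (v i) (c k) ≡ form (v j) (c k)

  NotCollinear : Set
  NotCollinear = ∀ k → ¬ (∀ i j → form (v i) (c k) ≡ form (v j) (c k))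

  module Main (all-determined : AllDetermined) (not-collinear : NotCollinear) where

    abstract
      not-injective : ∀ {d} → Determined d → ¬ (∀ i j → form (v i) d ≡ form (v j) d → i ≡ j)
      not-injective {d} (determined d≢0 k along) injective = go (parallel d≢0 along) (all-determined k)
        where
        go : ∃ (λ a → Fixed a × a ≢ 0# × d ≡ c k * a) → ∃ (λ i → ∃ λ j → i ≢ j × form (v i) (c k) ≡ form (v j) (c k)) → ⊥
        go (a , fa , a≢0 , refl) (i , j , i≢j , e) =
          i≢j (injective i j (trans (form-scaleʳ (v i) (c k) fa) (trans (cong (_* a) e) (sym (form-scaleʳ (v j) (c k) fa)))))

      D≈0 : m ℕ.+ suc r ℕ.≤ suc q → ∀ {d} (det : Determined d) → D (prod (values d)) ≈ 0S
      D≈0 small det with DeterminedDirection.few-directions det small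
      ... | inj₁ G≈0 = contradiction (DeterminedDirection.G≈0⇒injective det G≈0) (not-injective det)
      ... | inj₂ Dh≈0 = Dh≈0

    module _ (small : m ℕ.+ suc r ℕ.≤ suc q) where
      abstract
        constant-derivative : ∀ {d} → d ≢ 0# → ∃ λ κ → D (prod (values d)) ≈ const κ
        constant-derivative {d} d≢0 = go (Fin.any? (λ k → form (c k) d ≟ 0#))
          where
          go : Dec (∃ λ k → form (c k) d ≡ 0#) → ∃ λ κ → D (prod (values d)) ≈ const κ
          go (yes (k , e)) = 0# , S.trans (D≈0 small (determined d≢0 k e)) (pointwise λ { zero → refl ; (suc _) → refl })
          go (no und) = 1# , S.trans (D-cong (prod-undetermined (λ k e → und (k , e)))) D-Φ

        equal-multiplicities : ∀ k i j → count (form (v i) (c k)) (values (c k)) ≡ count (form (v j) (c k)) (values (c k))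
        equal-multiplicities k = equal-counts (c (other k)) (c k) transverse
          (λ y fy → constant-derivative (λ e → independent (other≢ k ∘ sym) (begin
            form (c (other k)) (c k)                                   ≡⟨ +-identityʳ _ ⟨
            form (c (other k)) (c k) + 0#                              ≡⟨ cong (form (c (other k)) (c k) +_) (sym (zeroed (inj₁ (form-alternating (c (other k)))))) ⟩
            form (c (other k)) (c k) + form (c (other k)) (c (other k)) * y ≡⟨ form-combineʳ (c (other k)) (c k) (c (other k)) fy ⟨
            form (c (other k)) (c k + c (other k) * y)                 ≡⟨ cong (form (c (other k))) e ⟩
            form (c (other k)) 0#                                      ≡⟨ cong₂ _-_ (trans (cong (c (other k) *_) conj-0) (zeroʳ _)) (zeroʳ _) ⟩
            0# - 0#                                                    ≡⟨ -self 0# ⟩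
            0#                                                         ∎)))
          where
          open ≡-Reasoning
          transverse : form (c k) (c (other k)) ≢ 0#
          transverse = independent (other≢ k)

      i₀ : Fin q
      i₀ = Fin.fromℕ< 0<q

      multiplicity : Fin m → ℕ
      multiplicity k = count (form (v i₀) (c k)) (values (c k))

      abstract
        2≤multiplicity : ∀ k → 2 ℕ.≤ multiplicity k
        2≤multiplicity k = go (all-determined k)
          where
          f : Fin q → Carrier
          f i = form (v i) (c k)
          go : ∃ (λ i → ∃ λ j → i ≢ j × f i ≡ f j) → 2 ℕ.≤ multiplicity k
          go (i , j , i≢j , e) = subst (2 ℕ.≤_) (trans (sym (count-tabulate f (f i))) (equal-multiplicities k i i₀))
            (two-members (∈-filter⁺ (λ t → f t ≟ f i) (∈-allFin i) refl) (∈-filter⁺ (λ t → f t ≟ f i) (∈-allFin j) (sym e)) i≢j)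

        -- The lines through `v i₀` in the m directions meet only in that point, and each contains
        -- at least μ of the other q - 1 points.
        multiplicity-sum : ∀ μ → (∀ k → suc μ ℕ.≤ multiplicity k) → m ℕ.* μ ℕ.< q
        multiplicity-sum μ h = ℕₚ.≤-trans (ℕ.s≤s (disjoint-filters m μ P? others disjoint big)) fewer
          where
          P? : ∀ k i → Dec (form (v i) (c k) ≡ form (v i₀) (c k))
          P? k i = form (v i) (c k) ≟ form (v i₀) (c k)
          others : List (Fin q)
          others = filter (λ i → ¬? (i Fin.≟ i₀)) (allFin q)
          disjoint : ∀ i → i ∈ others → ∀ j k → form (v i) (c j) ≡ form (v i₀) (c j) → form (v i) (c k) ≡ form (v i₀) (c k) → j ≡ k
          disjoint i i∈ j k ej ek with j Fin.≟ k
          ... | yes e = e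
          ... | no j≢k = contradiction (separated (independent j≢k) i i₀ ej ek) (proj₂ (∈-filter⁻ (λ i → ¬? (i Fin.≟ i₀)) {xs = allFin q} i∈))
          big : ∀ k → μ ℕ.≤ length (filter (P? k) others)
          big k = ℕₚ.≤-pred (ℕₚ.≤-trans (h k) (ℕₚ.≤-trans (ℕₚ.≤-reflexive (count-tabulate (λ i → form (v i) (c k)) (form (v i₀) (c k))))
            (ℕₚ.≤-trans (ℕₚ.≤-reflexive (filter-split (P? k) (Fin._≟ i₀) (allFin q)))
              (ℕₚ.+-monoˡ-≤ _ (ℕₚ.≤-trans (length-filter (P? k) (filter (Fin._≟ i₀) (allFin q))) (length-filter-unique (Fin._≟ i₀) (allFin q) (Unique.allFin⁺ q) (λ x y _ _ e e′ → trans e (sym e′))))))))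
          fewer : suc (length others) ℕ.≤ q
          fewer = ℕₚ.≤-trans (ℕₚ.+-monoˡ-≤ (length others) (∈-nonempty (∈-filter⁺ (Fin._≟ i₀) (∈-allFin i₀) refl)))
            (ℕₚ.≤-reflexive (trans (length-filter-¬ (Fin._≟ i₀) (allFin q)) (length-tabulate (λ i → i))))

-- The lower bound for the number of directions by means of a subfield.

module SubfieldBound (𝕂 : Setting) (r : ℕ) (Γ : Graph 𝕂 (suc (suc r))) (C : Clique 𝕂 Γ) where
  open FewDirections 𝕂 r Γ C

  -- h = rˢ with r squarefree of degree Q; since r divides X^q + X = X + rˢ + G₀ˢ, where r = X^Q − G₀,
  -- it divides X + G₀ˢ.
  module Squarefree (σ e : ℕ) (s≡ : suc (suc σ) ≡ p ℕ.^ e) (d : Carrier) (det : Determined d)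
    (R : List Carrier) (R-unique : Unique R) (R⊆ : All (_∈ values d) R)
    (q≡sQ : q ≡ suc (suc σ) ℕ.* length R) (1<Q : 1 ℕ.< length R)
    (h≈rˢ : prod (values d) ≈ prod R ↑ suc (suc σ)) (few : suc (suc r) ℕ.+ suc (suc r) ℕ.≤ q)
    (sum : suc (suc r) ℕ.* suc σ ℕ.< q) where
    open DeterminedDirection det

    s Q : ℕ
    s = suc (suc σ)
    Q = length R

    ρ G₀ : Ser
    ρ = prod R
    G₀ = X ↑ Q ⊕ ⊖ ρ

    ρ-degree : Deg ρ (suc Q)
    ρ-degree = Deg-prod R

    Q≤q : Q ℕ.≤ q
    Q≤q = ℕₚ.≤-trans (ℕₚ.m≤n*m Q s) (ℕₚ.≤-reflexive (sym q≡sQ))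

    G₀-low : ∀ i → Q ℕ.≤ i → G₀ i ≡ 0#
    G₀-low i Q≤i with ℕₚ.m≤n⇒m<n∨m≡n Q≤i
    ... | inj₁ Q<i = trans (cong₂ _-_ (Deg-X↑ Q i Q<i) (ρ-degree i Q<i)) (-self 0#)
    ... | inj₂ refl = trans (cong₂ _-_ (X↑-top Q) (prod-monic R)) (-self 1#)

    charS : p SMult.× 1S ≈ 0S
    charS = PrimePower.charS pp char e

    abstract
      ↑s-multiple : ∀ P i → (P ↑ s) (s ℕ.* i) ≡ P i ^ s
      ↑s-multiple P i = subst (λ t → 0 ℕ.< t → (P ↑ t) (t ℕ.* i) ≡ P i ^ t) (sym s≡)
        (λ 0<t → PrimePower.↑s-multiple pp char e 0<t P i) (ℕ.s≤s ℕ.z≤n)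

      ↑s-nonmultiple : ∀ P j → ¬ (s ∣ j) → (P ↑ s) j ≡ 0#
      ↑s-nonmultiple P j = subst (λ t → 0 ℕ.< t → ¬ (t ∣ j) → (P ↑ t) j ≡ 0#) (sym s≡)
        (λ 0<t → PrimePower.↑s-nonmultiple pp char e 0<t P j) (ℕ.s≤s ℕ.z≤n)

      ↑s-homo : ∀ A B → (A ⊕ B) ↑ s ≈ A ↑ s ⊕ B ↑ s
      ↑s-homo A B = subst (λ t → (A ⊕ B) ↑ t ≈ A ↑ t ⊕ B ↑ t) (sym s≡) (PrimePower.↑s-homo pp char e A B)

      G≈X+G₀ˢ : G ≈ X ⊕ G₀ ↑ s
      G≈X+G₀ˢ = begin
        (X ↑ q ⊕ X) ⊕ ⊖ h                      ≈⟨ S.+-cong (S.+-congʳ X^q) (S.-‿cong h≈rˢ) ⟩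
        ((ρ ↑ s ⊕ G₀ ↑ s) ⊕ X) ⊕ ⊖ (ρ ↑ s)     ≈⟨ solveS 3 (λ a b x → ((a ⊞ b) ⊞ x) ⊟ a ⩴ x ⊞ b) S.refl (ρ ↑ s) (G₀ ↑ s) X ⟩
        X ⊕ G₀ ↑ s                             ∎
        where
        open ≈-Reasoning
        X^q : X ↑ q ≈ ρ ↑ s ⊕ G₀ ↑ s
        X^q = begin
          X ↑ q                  ≈⟨ SExp.^-congʳ X (trans q≡sQ (ℕₚ.*-comm s Q)) ⟩
          X ↑ (Q ℕ.* s)          ≈⟨ SExp.^-assocʳ X Q s ⟨
          (X ↑ Q) ↑ s            ≈⟨ SExp.^-congˡ s (solveS 2 (λ x ρ → x ⩴ ρ ⊞ (x ⊟ ρ)) S.refl (X ↑ Q) ρ) ⟩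
          (ρ ⊕ G₀) ↑ s           ≈⟨ ↑s-homo ρ G₀ ⟩
          ρ ↑ s ⊕ G₀ ↑ s         ∎

      ρ∣G : ∃ λ A → Finite A × G ≈ ρ ⊗ A
      ρ∣G = go (factor-roots {Φ} {suc q ℕ.∸ Q} R R-unique (All.map root R⊆) (Deg-mono (ℕₚ.≤-reflexive (sym (ℕₚ.m+[n∸m]≡n (ℕₚ.m≤n⇒m≤1+n Q≤q)))) Φ-finite))
        where
        root : ∀ {x} → x ∈ values d → Ev Φ x 0#
        root x∈ = All.lookup (values-roots d) x∈
        go : (∃ λ B → Deg B (suc q ℕ.∸ Q) × Φ ≈ ρ ⊗ B) → ∃ λ A → Finite A × G ≈ ρ ⊗ A
        go (B , hB , Φ≈) = B ⊕ ⊖ (ρ ↑ suc σ) , Finite-⊕ (_ , hB) (Finite-⊖ (Finite-↑ (suc σ) (_ , ρ-degree))) ,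
          S.trans (S.+-cong Φ≈ (S.-‿cong h≈rˢ))
            (solveS 3 (λ r b c → r ⊠ b ⊞ ⊟ (r ⊠ c) ⩴ r ⊠ (b ⊞ ⊟ c)) S.refl ρ B (ρ ↑ suc σ))

    A : Ser
    A = proj₁ ρ∣G

    A-finite : Finite A
    A-finite = proj₁ (proj₂ ρ∣G)

    G≈ρA : G ≈ ρ ⊗ A
    G≈ρA = proj₂ (proj₂ ρ∣G)

    A-degree : ∀ i → m ℕ.≤ Q ℕ.+ i → A i ≡ 0#
    A-degree = Deg-cofactor ρ-degree (prod-monic R) A-finite (Deg-cong G≈ρA G-degree)

    s∤1 : ¬ (s ∣ 1)
    s∤1 s∣1 = ℕₚ.<⇒≱ (ℕ.s≤s (ℕ.s≤s ℕ.z≤n)) (∣⇒≤ s∣1)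

    G-at : ∀ i → i ≢ 1 → G i ≡ (G₀ ↑ s) i
    G-at i i≢1 = trans (at G≈X+G₀ˢ i) (trans (cong (_+ (G₀ ↑ s) i) (X-other i≢1)) (+-identityˡ _))

    G-one : G 1 ≡ 1#
    G-one = trans (at G≈X+G₀ˢ 1) (trans (cong (1# +_) (↑s-nonmultiple G₀ 1 s∤1)) (+-identityʳ _))

    -- If m ≤ Q, the cofactor A would vanish for reasons of degree. But the coefficient of X in G is
    -- 1, because G₀ˢ contributes only in degrees divisible by s.
    Q<m : Q ℕ.< m
    Q<m with suc Q ℕ.≤? m
    ... | yes Q<m = Q<m
    ... | no Q≮m = contradiction (trans (sym G-one) (trans (at G≈ρA 1)
      (⊗-zero-at ρ A 1 (λ a b _ → zeroed (inj₂ (A-degree b (ℕₚ.≤-trans (ℕₚ.≮⇒≥ Q≮m) (ℕₚ.m≤m+n Q b)))))))) 1≢0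

    s*≢1 : ∀ i → s ℕ.* i ≢ 1
    s*≢1 i e = s∤1 (divides i (trans (sym e) (ℕₚ.*-comm s i)))

    G₀-degree : ∀ i → m ℕ.≤ s ℕ.* i → G₀ i ≡ 0#
    G₀-degree i m≤ = ^≡0 s (trans (sym (↑s-multiple G₀ i)) (trans (sym (G-at (s ℕ.* i) (s*≢1 i))) (G-degree (s ℕ.* i) m≤)))

    abstract
      -- The choice of a direction with minimal s enters here, through m (s - 1) < q. Since s deg G₀
      -- < m and Q + deg A < m, this inequality and 2m ≤ q force deg G₀ + deg A < Q.
      G₀A-degree : ∀ j → Q ℕ.≤ j → (G₀ ⊗ A) j ≡ 0#
      G₀A-degree j Q≤j = ⊗-zero-at G₀ A j vanish
        where
        vanish : ∀ i l → i ℕ.+ l ≡ j → G₀ i * A l ≡ 0#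
        vanish i l e with m ℕ.≤? s ℕ.* i | m ℕ.≤? Q ℕ.+ l
        ... | yes p | _ = zeroed (inj₁ (G₀-degree i p))
        ... | no _ | yes p = zeroed (inj₂ (A-degree l p))
        ... | no ¬p | no ¬p′ = contradiction (subst (Q ℕ.≤_) (sym e) Q≤j)
          (ℕₚ.<⇒≱ (degree-estimate σ r Q (subst (_ ℕ.<_) q≡sQ sum) (subst (_ ℕ.≤_) q≡sQ few) i l (ℕₚ.≰⇒> ¬p) (ℕₚ.≰⇒> ¬p′)))

    ρA : ρ ⊗ A ≈ X ↑ Q ⊗ A ⊕ ⊖ (G₀ ⊗ A)
    ρA = solveS 3 (λ x r a → r ⊠ a ⩴ x ⊠ a ⊞ ⊟ ((x ⊟ r) ⊠ a)) S.refl (X ↑ Q) ρ A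

    -- In ρ A = X^Q A - G₀ A the first summand begins in degree Q and the second ends below it, so A
    -- can be read off from the upper coefficients of G.
    A-at : ∀ i → A i ≡ G (Q ℕ.+ i)
    A-at i = sym (trans (at G≈ρA (Q ℕ.+ i)) (trans (at ρA (Q ℕ.+ i))
      (trans (cong₂ _-_ (X↑-⊗ Q A i) (G₀A-degree (Q ℕ.+ i) (ℕₚ.m≤m+n Q i)))
        (sub-zero (A i)))))

    abstract
      Q-prime-power : ∃ λ e′ → e′ ℕ.≤ n × s ≡ p ℕ.^ e′ × Q ≡ p ℕ.^ (n ℕ.∸ e′)
      Q-prime-power = divisor-of-prime-power pp n s Q (trans (sym q≡sQ) q≡pⁿ)

    p∣power : ∀ j → 1 ℕ.< p ℕ.^ j → p ∣ p ℕ.^ j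
    p∣power zero (ℕ.s≤s ())
    p∣power (suc j) _ = m∣m*n (p ℕ.^ j)

    p∣s : p ∣ s
    p∣s = subst (p ∣_) (sym s≡) (p∣power e (subst (1 ℕ.<_) s≡ (ℕ.s≤s (ℕ.s≤s ℕ.z≤n))))

    p∣Q : p ∣ Q
    p∣Q with Q-prime-power
    ... | e′ , _ , _ , Q≡ = subst (p ∣_) (sym Q≡) (p∣power (n ℕ.∸ e′) (subst (1 ℕ.<_) Q≡ 1<Q))

    ι-multiple : ∀ {i} → p ∣ i → ι i ≡ 0#
    ι-multiple (divides j refl) = trans (ι-* j p) (zeroed (inj₂ char))

    abstract
      -- A nonzero coefficient of A at i > 0 is one of G at Q + i > 1, hence one of G₀ˢ, so s
      -- divides Q + i. As p divides both s and Q, it divides i.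
      DA≈0 : D A ≈ 0S
      DA≈0 = pointwise vanish
        where
        vanish : ∀ i → D A i ≡ 0#
        vanish i with s ∣? (Q ℕ.+ suc i)
        ... | yes s∣ = zeroed (inj₁ (ι-multiple (∣m+n∣m⇒∣n (∣-trans p∣s s∣) p∣Q)))
        ... | no s∤ = zeroed (inj₂ (trans (A-at (suc i)) (trans (G-at (Q ℕ.+ suc i)
                (ℕₚ.>⇒≢ (ℕₚ.≤-trans 1<Q (ℕₚ.m≤m+n Q (suc i))))) (↑s-nonmultiple G₀ _ s∤))))

    abstract
      DG≈1 : D G ≈ 1S
      DG≈1 = S.trans (D-cong G≈X+G₀ˢ) (S.trans (D-⊕ X (G₀ ↑ s)) (S.trans (S.+-cong D-X (pointwise vanish)) (S.+-identityʳ 1S)))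
        where
        vanish : ∀ i → D (G₀ ↑ s) i ≡ 0#
        vanish i with s ∣? suc i
        ... | yes s∣ = zeroed (inj₁ (ι-multiple (∣-trans p∣s s∣)))
        ... | no s∤ = zeroed (inj₂ (↑s-nonmultiple G₀ (suc i) s∤))

    -- G = X + G₀ˢ has derivative 1, and D A = 0 removes one term of the product rule for G = ρ A.
    -- Thus A is a unit among polynomials, that is, a nonzero constant.
    DρA≈1 : D ρ ⊗ A ≈ 1S
    DρA≈1 = begin
      D ρ ⊗ A                ≈⟨ S.+-identityʳ _ ⟨
      D ρ ⊗ A ⊕ 0S           ≈⟨ S.+-congˡ (S.sym (S.trans (S.*-congˡ DA≈0) (S.zeroʳ ρ))) ⟩
      D ρ ⊗ A ⊕ ρ ⊗ D A      ≈⟨ D-⊗ ρ A ⟨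
      D (ρ ⊗ A)              ≈⟨ D-cong G≈ρA ⟨
      D G                    ≈⟨ DG≈1 ⟩
      1S                     ∎
      where open ≈-Reasoning

    abstract
      A-constant : Deg A 1 × A 0 ≢ 0#
      A-constant = go (zero-or-top _ (Deg-D ρ-degree)) (zero-or-top _ (proj₂ A-finite))
        where
        go : (D ρ ≈ 0S ⊎ ∃ λ i → i ℕ.< Q × D ρ i ≢ 0# × Deg (D ρ) (suc i)) →
             (A ≈ 0S ⊎ ∃ λ j → j ℕ.< proj₁ A-finite × A j ≢ 0# × Deg A (suc j)) → Deg A 1 × A 0 ≢ 0#
        go (inj₁ z) _ = contradiction (sym (at (S.trans (S.sym (S.trans (S.*-congʳ z) (S.zeroˡ A))) DρA≈1) 0)) 1≢0
        go (inj₂ _) (inj₁ z) = contradiction (sym (at (S.trans (S.sym (S.trans (S.*-congˡ z) (S.zeroʳ (D ρ)))) DρA≈1) 0)) 1≢0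
        go (inj₂ (i , _ , Di≢0 , hi)) (inj₂ (zero , _ , Aj≢0 , hj)) = hj , Aj≢0
        go (inj₂ (i , _ , Di≢0 , hi)) (inj₂ (suc j , _ , Aj≢0 , hj)) =
          contradiction (trans (sym (⊗-top {D ρ} {A} hi hj)) (trans (at DρA≈1 (i ℕ.+ suc j))
            (Deg-const (i ℕ.+ suc j) (ℕₚ.≤-trans (ℕ.s≤s ℕ.z≤n) (ℕₚ.m≤n+m (suc j) i))))) (*≢0 Di≢0 Aj≢0)

    a₀ : Carrier
    a₀ = A 0

    G-coefficients : ∀ j → G j ≡ a₀ * ((X ↑ Q) j - G₀ j)
    G-coefficients j = trans (at G≈ρA j) (trans (at (S.*-congˡ {ρ} A≈) j) (trans (⊗-comm-at ρ (const a₀) j)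
      (trans (const-⊗ a₀ ρ j) (cong (a₀ *_) (solve 2 (λ x r → r := x :- (x :- r)) refl ((X ↑ Q) j) (ρ j))))))
      where
      A≈ : A ≈ const a₀
      A≈ = pointwise λ { zero → refl ; (suc i) → proj₁ A-constant (suc i) (ℕ.s≤s ℕ.z≤n) }

    abstract
      -- Away from index 1 the coefficients of G are those of G₀ˢ, so a nonzero one sits at a
      -- multiple of s and comes from a nonzero coefficient of G₀. Because G = a₀ (X^Q - G₀), this
      -- links the support of G₀ with itself.
      descend : ∀ j → 0 ℕ.< j → j ≢ 1 → G j ≢ 0# → ∃ λ i → 0 ℕ.< i × i ℕ.< j × j ≡ s ℕ.* i × G₀ i ≢ 0#
      descend j 0<j j≢1 Gj≢0 with s ∣? j
      ... | no s∤j = contradiction (trans (G-at j j≢1) (↑s-nonmultiple G₀ j s∤j)) Gj≢0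
      ... | yes (divides zero refl) = contradiction refl (ℕₚ.>⇒≢ 0<j)
      ... | yes (divides (suc i) refl) = suc i , ℕ.s≤s ℕ.z≤n , ℕₚ.m<m*n (suc i) s (ℕ.s≤s (ℕ.s≤s ℕ.z≤n)) , ℕₚ.*-comm (suc i) s ,
        λ G₀≡0 → Gj≢0 (trans (G-at j j≢1) (trans (cong (G₀ ↑ s) (ℕₚ.*-comm (suc i) s))
          (trans (↑s-multiple G₀ (suc i)) (trans (cong (_^ s) G₀≡0) (0^ s (ℕ.s≤s ℕ.z≤n))))))

    abstract
      -- Division by s strictly lowers a positive index and stays in the support, so it can only
      -- stop at the exceptional index 1.
      support : ∀ j → 0 ℕ.< j → G₀ j ≢ 0# → ∃ λ a → j ≡ s ℕ.^ a
      support = <-rec (λ j → 0 ℕ.< j → G₀ j ≢ 0# → ∃ λ a → j ≡ s ℕ.^ a) step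
        where
        step : ∀ j → (∀ {i} → i ℕ.< j → 0 ℕ.< i → G₀ i ≢ 0# → ∃ λ a → i ≡ s ℕ.^ a) → 0 ℕ.< j → G₀ j ≢ 0# → ∃ λ a → j ≡ s ℕ.^ a
        step j rec 0<j G₀j≢0 with j ℕ.≟ 1
        ... | yes refl = 0 , refl
        ... | no j≢1 = go (descend j 0<j j≢1 Gj≢0)
          where
          j≢Q : j ≢ Q
          j≢Q e = G₀j≢0 (G₀-low j (ℕₚ.≤-reflexive (sym e)))
          Gj≢0 : G j ≢ 0#
          Gj≢0 e = *≢0 (proj₂ A-constant) (λ z → G₀j≢0 (neg≡0 (trans (sym (+-identityˡ _)) (trans (cong (_- G₀ j) (sym (X↑-other Q j j≢Q))) z))))
            (trans (sym (G-coefficients j)) e)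
          go : (∃ λ i → 0 ℕ.< i × i ℕ.< j × j ≡ s ℕ.* i × G₀ i ≢ 0#) → ∃ λ a → j ≡ s ℕ.^ a
          go (i , 0<i , i<j , j≡ , G₀i≢0) with rec i<j 0<i G₀i≢0
          ... | a , i≡ = suc a , trans j≡ (cong (s ℕ.*_) i≡)

    abstract
      -- The descent is started at Q, where G₀ vanishes and G has the coefficient a₀ ≠ 0. This first
      -- division makes the exponent positive.
      Q-power : ∃ λ a → Q ≡ s ℕ.^ suc a
      Q-power = go (descend Q (ℕₚ.<-trans ℕₚ.0<1+n 1<Q) (ℕₚ.>⇒≢ 1<Q) GQ≢0)
        where
        GQ≢0 : G Q ≢ 0#
        GQ≢0 e = proj₂ A-constant (trans (sym (trans (G-coefficients Q) (trans (cong (a₀ *_)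
          (trans (cong₂ _-_ (X↑-top Q) (G₀-low Q ℕₚ.≤-refl)) (sub-zero 1#))) (*-identityʳ a₀)))) e)
        go : (∃ λ i → 0 ℕ.< i × i ℕ.< Q × Q ≡ s ℕ.* i × G₀ i ≢ 0#) → ∃ λ a → Q ≡ s ℕ.^ suc a
        go (i , 0<i , _ , Q≡ , G₀i≢0) with support i 0<i G₀i≢0
        ... | a , i≡ = a , trans Q≡ (cong (s ℕ.*_) i≡)

    subfield : e ∣ n × e ℕ.< n × p ℕ.^ (n ℕ.∸ e) ℕ.< m
    subfield with Q-power | Q-prime-power
    ... | a , Q≡sᵃ | e′ , e′≤n , s≡e′ , Q≡ with ^-cancelʳ-≡ p {e} {e′} 1<p (trans (sym s≡) s≡e′)
    ...   | refl = divides (suc (suc a)) n≡ , e<n , subst (ℕ._< m) Q≡ Q<m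
      where
      n≡ : n ≡ suc (suc a) ℕ.* e
      n≡ = ^-cancelʳ-≡ p 1<p (begin
        p ℕ.^ n                     ≡⟨ q≡pⁿ ⟨
        q                           ≡⟨ q≡sQ ⟩
        s ℕ.* Q                     ≡⟨ cong (s ℕ.*_) Q≡sᵃ ⟩
        s ℕ.^ suc (suc a)           ≡⟨ cong (ℕ._^ suc (suc a)) s≡ ⟩
        (p ℕ.^ e) ℕ.^ suc (suc a)   ≡⟨ ℕₚ.^-*-assoc p e (suc (suc a)) ⟩
        p ℕ.^ (e ℕ.* suc (suc a))   ≡⟨ cong (p ℕ.^_) (ℕₚ.*-comm e (suc (suc a))) ⟩
        p ℕ.^ (suc (suc a) ℕ.* e)   ∎)
        where open ≡-Reasoning
      e<n : e ℕ.< n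
      e<n = ℕₚ.≤∧≢⇒< e′≤n (λ { refl → ℕₚ.<⇒≢ 1<Q (sym (trans Q≡ (cong (p ℕ.^_) (ℕₚ.n∸n≡0 n)))) })

  module _ (all-determined : AllDetermined) (not-collinear : NotCollinear) (few : m ℕ.+ m ℕ.≤ q) where
    open Main all-determined not-collinear

    private
      small : m ℕ.+ suc r ℕ.≤ suc q
      small = ℕₚ.m≤n⇒m≤1+n (ℕₚ.≤-trans (ℕₚ.+-monoʳ-≤ m (ℕₚ.n≤1+n (suc r))) few)

    abstract
      subfield-bound : ∃ λ e → e ∣ n × e ℕ.< n × p ℕ.^ (n ℕ.∸ e) ℕ.< m
      -- A direction with least multiplicity s: then every line of the graph through a point of the
      -- clique has at least s - 1 further points, which yields m (s - 1) < q.
      subfield-bound = go (argmin (multiplicity small))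
        where
        go : (∃ λ k → ∀ j → multiplicity small k ℕ.≤ multiplicity small j) → ∃ λ e → e ∣ n × e ℕ.< n × p ℕ.^ (n ℕ.∸ e) ℕ.< m
        go (k , minimal) = shape (multiplicity small k) refl
          where
          Uniform : ℕ → Set
          Uniform μ = ∃ λ R → Unique R × All (_∈ values (c k)) R × length (values (c k)) ≡ μ ℕ.* length R × prod (values (c k)) ≈ prod R ↑ μ
          shape : ∀ μ → multiplicity small k ≡ μ → ∃ λ e → e ∣ n × e ℕ.< n × p ℕ.^ (n ℕ.∸ e) ℕ.< m
          shape zero eq = contradiction (2≤multiplicity small k) (subst (λ t → ¬ (2 ℕ.≤ t)) (sym eq) λ ())
          shape (suc zero) eq = contradiction (2≤multiplicity small k) (subst (λ t → ¬ (2 ℕ.≤ t)) (sym eq) λ { (ℕ.s≤s ()) })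
          shape (suc (suc σ)) eq = squarefree (prod-uniform (suc (suc σ)) (values (c k)) uniform)
            where
            uniform : ∀ x → x ∈ values (c k) → count x (values (c k)) ≡ suc (suc σ)
            uniform x x∈ with ∈-tabulate⁻ x∈
            ... | i , refl = trans (equal-multiplicities small k i (i₀ small)) eq
            squarefree : Uniform (suc (suc σ)) → ∃ λ e → e ∣ n × e ℕ.< n × p ℕ.^ (n ℕ.∸ e) ℕ.< m
            squarefree (R , R-unique , R⊆ , len , h≈) with divisor-of-prime-power pp n (suc (suc σ)) (length R) (trans (sym len) (trans (length-values (c k)) q≡pⁿ))
            ... | e , _ , s≡ , _ = e , Squarefree.subfield σ e s≡ (c k) (determined (nonzero k) k (form-alternating (c k))) R R-unique R⊆
                    (trans (sym (length-values (c k))) len) (1<Q R len h≈) h≈ few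
                    (multiplicity-sum small (suc σ) (λ j → subst (ℕ._≤ multiplicity small j) eq (minimal j)))
              where
              1<Q : ∀ R → length (values (c k)) ≡ suc (suc σ) ℕ.* length R → prod (values (c k)) ≈ prod R ↑ suc (suc σ) → 1 ℕ.< length R
              1<Q [] len _ = contradiction (trans (sym (length-values (c k))) (trans len (ℕₚ.*-zeroʳ (suc (suc σ))))) (ℕₚ.>⇒≢ 0<q)
              -- With a single root the whole clique would lie on one line.
              1<Q (x ∷ []) len h≈ = contradiction (λ i j → trans (same i) (sym (same j))) (not-collinear k)
                where
                same : ∀ i → form (v i) (c k) ≡ x
                same i = -≡0 (^≡0 (suc (suc σ)) (Ev-unique S.refl (Ev-↑ (suc (suc σ)) (Ev-value (*-identityʳ _) (Ev-⊗ (Ev-lin x) (Ev-const 1#))))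
                  (Ev-cong h≈ (Ev-prod-root (values (c k)) (∈-tabulate⁺ i)))))
              1<Q (_ ∷ _ ∷ _) _ _ = ℕ.s≤s (ℕ.s≤s ℕ.z≤n)

-- Construction of non-strict graphs.

lookup-unique : ∀ {A : Set} {L : List A} → Unique L → ∀ i j → lookup L i ≡ lookup L j → i ≡ j
lookup-unique (_ ∷ _) zero zero e = refl
lookup-unique (a ∷ _) zero (suc j) e = contradiction e (All.lookup a (∈-lookup j))
lookup-unique (a ∷ _) (suc i) zero e = contradiction (sym e) (All.lookup a (∈-lookup i))
lookup-unique (_ ∷ u) (suc i) (suc j) e = cong suc (lookup-unique u i j e)

early-index : ∀ {A : Set} {x : A} {xs} ys → x ∈ xs → ∃ λ (i : Fin (length (xs ++ ys))) → toℕ i ℕ.< length xs × lookup (xs ++ ys) i ≡ x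
early-index ys (here refl) = zero , ℕ.s≤s ℕ.z≤n , refl
early-index ys (there x∈) with early-index ys x∈
... | i , i< , e = suc i , ℕ.s≤s i< , e

module Construction (𝕂 : Setting) where
  open QuadraticField 𝕂

  abstract
    |Fq|≡q : length Fq ≡ q
    |Fq|≡q = ℕₚ.≤-antisym (root-bound {X ↑ q ⊕ ⊖ X} {q} {q} Fq Fq-unique
      (All.map (λ {x} fx → Ev-value (trans (cong (_- x) fx) (-self x)) (Ev-⊕ (Ev-↑ q Ev-X) (Ev-⊖ Ev-X))) Fq-fixed)
      (Deg-⊕ (Deg-X↑ q) (Deg-⊖ (Deg-mono (ℕ.s≤s (ℕₚ.<⇒≤ 1<q)) Deg-X))) top) q≤|Fq|
      where
      top : (X ↑ q ⊕ ⊖ X) q ≢ 0#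
      top e = 1≢0 (trans (sym (trans (cong₂ _-_ (X↑-top q) (Deg-X q 1<q)) (sub-zero 1#))) e)

    unfixed : ∃ λ ω → ¬ Fixed ω
    unfixed with filter (λ x → ¬? (fixed? x)) elements in eq
    ... | [] = contradiction counted (ℕₚ.<⇒≢ (ℕₚ.m<m*n q q {{ℕ.>-nonZero 0<q}} 1<q))
      where
      counted : q ≡ q ℕ.* q
      counted = trans (sym (trans (ℕₚ.+-identityʳ _) |Fq|≡q))
        (trans (cong (λ l → length Fq ℕ.+ length l) (sym eq)) (trans Fq-complement length-elements))
    ... | ω ∷ _ = ω , proj₂ (∈-filter⁻ (λ x → ¬? (fixed? x)) {xs = elements} (subst (ω ∈_) (sym eq) (here refl)))

    nonroot : ∀ {P d i} → Deg P (suc d) → P i ≢ 0# → d ℕ.< q → ∃ λ x → Fixed x × ¬ Ev P x 0#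
    nonroot {P} {d} {i} hP Pi≢0 d<q with All.all? (λ x → ev (suc d) P x ≟ 0#) Fq
    ... | yes roots = contradiction (ℕₚ.≤-trans q≤|Fq| (root-bound Fq Fq-unique (All.map (evaluates (suc d) hP) roots) hP Pi≢0)) (ℕₚ.<⇒≱ d<q)
    ... | no ¬roots with find (All.¬All⇒Any¬ (λ x → ev (suc d) P x ≟ 0#) Fq ¬roots)
      where open import Data.List.Membership.Propositional using (find)
    ...   | x , x∈ , ne = x , ∈Fq⁻ x∈ , λ E → ne (Ev-Deg hP E)

  ω : Carrier
  ω = proj₁ unfixed

  ω-unfixed : ¬ Fixed ω
  ω-unfixed = proj₂ unfixed

  -- The value of the form on the basis 1, ω. All values of the form on the directions below are
  -- multiples of it by elements of 𝔽_q.
  δ : Carrier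
  δ = conj ω - ω

  δ≢0 : δ ≢ 0#
  δ≢0 e = ω-unfixed (-≡0 e)

  abstract
    conj-ω : ∀ {z} → Fixed z → conj (z + ω) ≡ z + conj ω
    conj-ω {z} fz = trans (conj-+ z ω) (cong (_+ conj ω) fz)

    form-1-ω : ∀ {z} → Fixed z → form 1# (z + ω) ≡ δ
    form-1-ω {z} fz = trans (cong₂ (λ a b → 1# * a - b * (z + ω)) (conj-ω fz) conj-1)
      (solve 3 (λ z w w′ → :1 :* (z :+ w′) :- :1 :* (z :+ w) := w′ :- w) refl z ω (conj ω))

    form-ω-ω : ∀ {z z′} → Fixed z → Fixed z′ → form (z + ω) (z′ + ω) ≡ (z - z′) * δ
    form-ω-ω {z} {z′} fz fz′ = trans (cong₂ (λ a b → (z + ω) * a - b * (z′ + ω)) (conj-ω fz′) (conj-ω fz))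
      (solve 4 (λ z z′ w w′ → (z :+ w) :* (z′ :+ w′) :- (z :+ w′) :* (z′ :+ w) := (z :- z′) :* (w′ :- w)) refl z z′ ω (conj ω))

    form-0ʳ : ∀ u → form u 0# ≡ 0#
    form-0ʳ u = trans (cong₂ _-_ (trans (cong (u *_) conj-0) (zeroʳ u)) (zeroʳ (conj u))) (-self 0#)

  independent-family : ∀ {M} (c : Fin M → Carrier) → M ℕ.≤ q → (∀ i → c i ≢ 0#) → (∀ i j → i ≢ j → form (c i) (c j) ≢ 0#) → PeisertData q K M
  independent-family c M≤q c≢0 indep = record
    { c = c ; m≤q = M≤q ; nonzero = c≢0
    ; distinct = λ { i j i≢j (a , (fa , _) , e) → indep i j i≢j
        (trans (cong (λ w → form w (c j)) e) (trans (form-scaleˡ (c j) (c j) fa) (zeroed (inj₁ (form-alternating (c j)))))) } }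

  -- The directions of the graph are 1 and z + ω for z ∈ 𝔽_q, those with P z coming first.
  module _ (P : Carrier → Set) (P? : Decidable P) where
    Flat Steep : Carrier → Set
    Flat w = Fixed w × w ≢ 0#
    Steep w = ∃ λ z → ∃ λ a → Fixed z × P z × Fixed a × a ≢ 0# × w ≡ (z + ω) * a

    slopes : List Carrier
    slopes = filter P? Fq ++ filter (λ x → ¬? (P? x)) Fq

    abstract
      slopes-fixed : ∀ {z} → z ∈ slopes → Fixed z
      slopes-fixed z∈ with ∈-++⁻ (filter P? Fq) z∈
      ... | inj₁ z∈ = ∈Fq⁻ (proj₁ (∈-filter⁻ P? {xs = Fq} z∈))
      ... | inj₂ z∈ = ∈Fq⁻ (proj₁ (∈-filter⁻ (λ x → ¬? (P? x)) {xs = Fq} z∈))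

    abstract
      slopes-unique : Unique slopes
      slopes-unique = Unique.++⁺ (Unique.filter⁺ P? Fq-unique) (Unique.filter⁺ (λ x → ¬? (P? x)) Fq-unique)
        (λ { (x∈ , x∈′) → proj₂ (∈-filter⁻ (λ x → ¬? (P? x)) {xs = Fq} x∈′) (proj₂ (∈-filter⁻ P? {xs = Fq} x∈)) })

    abstract
      length-slopes : length slopes ≡ q
      length-slopes = trans (length-++ (filter P? Fq)) (trans (length-filter-¬ P? Fq) |Fq|≡q)

    module _ (M : ℕ) (P≤M : length (filter P? Fq) ℕ.≤ M) (M<q : suc M ℕ.≤ q) where

      -- The first M entries contain all slopes with P, and the others are padding. So one clique
      -- serves for every type from its number of directions up to q.
      slope : Fin M → Carrier
      slope i = lookup slopes (Fin.inject≤ i (ℕₚ.≤-trans (ℕₚ.<⇒≤ M<q) (ℕₚ.≤-reflexive (sym length-slopes))))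

      slope-fixed : ∀ i → Fixed (slope i)
      slope-fixed i = slopes-fixed (∈-lookup {xs = slopes} _)

      abstract
        slope-injective : ∀ i j → slope i ≡ slope j → i ≡ j
        slope-injective i j e = Fin.inject≤-injective _ _ i j (lookup-unique slopes-unique _ _ e)

      abstract
        slope-index : ∀ {z} → Fixed z → P z → ∃ λ i → slope i ≡ z
        slope-index {z} fz Pz = go (early-index (filter (λ x → ¬? (P? x)) Fq) (∈-filter⁺ P? (∈Fq fz) Pz))
          where
          go : (∃ λ (i : Fin (length slopes)) → toℕ i ℕ.< length (filter P? Fq) × lookup slopes i ≡ z) → ∃ λ i → slope i ≡ z
          go (i , i< , e) = Fin.fromℕ< i<M , trans (cong (lookup slopes) (Fin.toℕ-injective
              (trans (Fin.toℕ-inject≤ (Fin.fromℕ< i<M) _) (Fin.toℕ-fromℕ< i<M)))) e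
            where
            i<M : toℕ i ℕ.< M
            i<M = ℕₚ.≤-trans i< P≤M

      directions : Fin (suc M) → Carrier
      directions zero = 1#
      directions (suc i) = slope i + ω

      directions-independent : ∀ i j → i ≢ j → form (directions i) (directions j) ≢ 0#
      directions-independent zero zero ne = contradiction refl ne
      directions-independent zero (suc j) _ e = δ≢0 (trans (sym (form-1-ω (slope-fixed j))) e)
      directions-independent (suc i) zero _ e = δ≢0 (trans (sym (form-1-ω (slope-fixed i)))
        (form-flip e))
      directions-independent (suc i) (suc j) ne e =
        *≢0 (λ z → ne (cong suc (slope-injective i j (-≡0 z)))) δ≢0 (trans (sym (form-ω-ω (slope-fixed i) (slope-fixed j))) e)

      directions≢0 : ∀ i → directions i ≢ 0#
      directions≢0 zero = 1≢0
      directions≢0 (suc i) e = δ≢0 (trans (sym (form-1-ω (slope-fixed i))) (trans (cong (form 1#) e) (form-0ʳ 1#)))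

      graph : PeisertData q K (suc M)
      graph = independent-family directions M<q directions≢0 directions-independent

      module _ (τ : Carrier → Carrier)
        (step : ∀ {x y} → Fixed x → Fixed y → x ≢ y → Flat (τ x - τ y) ⊎ Steep (τ x - τ y))
        (flat : ∃ λ x → ∃ λ y → Fixed x × Fixed y × Flat (τ x - τ y))
        (steep : ∃ λ x → ∃ λ y → Fixed x × Fixed y × Steep (τ x - τ y)) where

        point : Fin q → Carrier
        point i = lookup Fq (Fin.cast (sym |Fq|≡q) i)

        point-fixed : ∀ i → Fixed (point i)
        point-fixed i = ∈Fq⁻ (∈-lookup {xs = Fq} _)

        abstract
          point-injective : ∀ i j → point i ≡ point j → i ≡ j
          point-injective i j e = Fin.toℕ-injective (trans (sym (Fin.toℕ-cast (sym |Fq|≡q) i))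
            (trans (cong toℕ (lookup-unique Fq-unique (Fin.cast (sym |Fq|≡q) i) (Fin.cast (sym |Fq|≡q) j) e)) (Fin.toℕ-cast (sym |Fq|≡q) j)))

        abstract
          point-surjective : ∀ {x} → Fixed x → ∃ λ i → point i ≡ x
          point-surjective {x} fx = Fin.cast |Fq|≡q index , trans (cong (lookup Fq) (Fin.toℕ-injective
            (trans (Fin.toℕ-cast (sym |Fq|≡q) _) (Fin.toℕ-cast |Fq|≡q index)))) (sym (lookup-index (∈Fq fx)))
            where
            index : Fin (length Fq)
            index = Any.index (∈Fq fx)

        adjacent : ∀ {w} → Flat w ⊎ Steep w → InS q K graph w
        adjacent (inj₁ (fw , w≢0)) = zero , _ , (fw , w≢0) , sym (*-identityˡ _)
        adjacent (inj₂ (z , a , fz , Pz , fa , a≢0 , e)) with slope-index fz Pz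
        ... | i , refl = suc i , a , (fa , a≢0) , e

        nonzero-step : ∀ {w} → Flat w ⊎ Steep w → w ≢ 0#
        nonzero-step (inj₁ (_ , w≢0)) = w≢0
        nonzero-step (inj₂ s@(z , a , fz , _ , _ , a≢0 , e)) w≡0 =
          *≢0 (λ z+ω≡0 → δ≢0 (trans (sym (form-1-ω fz)) (trans (cong (form 1#) z+ω≡0) (form-0ʳ 1#)))) a≢0 (trans (sym e) w≡0)

        clique : MaxClique q K graph
        clique = record
          { v = τ ∘ point
          ; inj = injective
          ; clique = λ i j i≢j → adjacent (step (point-fixed i) (point-fixed j) (i≢j ∘ point-injective i j)) }
          where
          injective : ∀ i j → τ (point i) ≡ τ (point j) → i ≡ j
          injective i j e with i Fin.≟ j
          ... | yes i≡j = i≡j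
          ... | no i≢j = contradiction (trans (cong (_- τ (point j)) e) (-self _))
                  (nonzero-step (step (point-fixed i) (point-fixed j) (i≢j ∘ point-injective i j)))

        abstract
          -- All differences in a canonical clique are parallel to one direction, but a flat and a
          -- steep difference are independent.
          not-canonical : ¬ Canonical q K graph clique
          not-canonical (x , k , on-line) = contra flat steep
            where
            d : Carrier
            d = directions k
            along : ∀ {y y′} → Fixed y → Fixed y′ → form (τ y - τ y′) d ≡ 0#
            along {y} {y′} fy fy′ = trans (form-sub (τ y) (τ y′) d) (trans (cong₂ _-_ (through fy) (through fy′)) (-self _))
              where
              on : ∀ {t a} → t ≡ x + d * a → Fixed a → form t d ≡ form x d
              on e fa = trans (cong (λ t → form t d) e) (form-on-line x d fa)
              through : ∀ {y} → Fixed y → form (τ y) d ≡ form x d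
              through {y} fy = go (point-surjective fy)
                where
                go : (∃ λ i → point i ≡ y) → form (τ y) d ≡ form x d
                go (i , e) = subst (λ t → form (τ t) d ≡ form x d) e (on (proj₂ (proj₂ (on-line i))) (proj₁ (proj₂ (on-line i))))
            contra : (∃ λ x → ∃ λ y → Fixed x × Fixed y × Flat (τ x - τ y)) → (∃ λ x → ∃ λ y → Fixed x × Fixed y × Steep (τ x - τ y)) → ⊥
            contra (x , y , fx , fy , fw , w≢0) (x′ , y′ , fx′ , fy′ , z , a , fz , _ , fa , a≢0 , e) =
              contra′ k refl
              where
              first : ∀ {s t : Carrier} → s ≡ 0# ⊎ t ≡ 0# → t ≢ 0# → s ≡ 0#
              first (inj₁ h) _ = h
              first (inj₂ h) t≢0 = contradiction h t≢0
              one : form 1# d ≡ 0#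
              one = first (*≡0 (trans (sym (form-scaleˡ 1# d fw)) (trans (cong (λ t → form t d) (*-identityˡ _)) (along fx fy)))) w≢0
              two : form (z + ω) d ≡ 0#
              two = first (*≡0 (trans (sym (form-scaleˡ (z + ω) d fa)) (trans (cong (λ t → form t d) (sym e)) (along fx′ fy′)))) a≢0
              contra′ : ∀ i → directions i ≡ d → ⊥
              contra′ zero refl′ = δ≢0 (trans (sym (form-1-ω fz)) (form-flip (trans (cong (form (z + ω)) refl′) two)))
              contra′ (suc i) refl′ = δ≢0 (trans (sym (form-1-ω (slope-fixed i))) (trans (cong (form 1#) refl′) one))

        not-strict : ¬ StrictEKR q K graph
        not-strict strict = not-canonical (strict clique)

-- The graph of the trace map.

module TraceGraph (𝕂 : Setting)
  (k t : ℕ) (1≤k : 1 ℕ.≤ k) (1≤t : 1 ℕ.≤ t) (n≡ : Setting.n 𝕂 ≡ k ℕ.* suc t) where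
  open QuadraticField 𝕂
  open Construction 𝕂

  s : ℕ
  s = p ℕ.^ k

  q≡sᵗ : q ≡ s ℕ.^ suc t
  q≡sᵗ = trans q≡pⁿ (trans (cong (p ℕ.^_) n≡) (sym (ℕₚ.^-*-assoc p k (suc t))))

  1<s : 1 ℕ.< s
  1<s = ℕₚ.≤-trans 1<p (ℕₚ.≤-trans (ℕₚ.≤-reflexive (sym (ℕₚ.^-identityʳ p))) (ℕₚ.^-monoʳ-≤ p {{nonZero 1<p}} 1≤k))

  sᵗ<q : s ℕ.^ t ℕ.< q
  sᵗ<q = ℕₚ.<-≤-trans (ℕₚ.^-monoʳ-< s 1<s (ℕₚ.n<1+n t)) (ℕₚ.≤-reflexive (sym q≡sᵗ))

  abstract
    power-+ : ∀ i x y → (x + y) ^ (s ℕ.^ i) ≡ x ^ (s ℕ.^ i) + y ^ (s ℕ.^ i)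
    power-+ i x y = trans (convert (x + y)) (trans (Frobenius.^pᵉ-homo-+ commRing pp char (k ℕ.* i) x y) (sym (cong₂ _+_ (convert x) (convert y))))
      where
      convert : ∀ z → z ^ (s ℕ.^ i) ≡ z Exp.^ (p ℕ.^ (k ℕ.* i))
      convert z = trans (cong (z ^_) (ℕₚ.^-*-assoc p k i)) (^≡Exp z (p ℕ.^ (k ℕ.* i)))

  -- Partial sums of x + xˢ + ..., where q is the (t + 1)-st power of s. On 𝔽_q the sum with t + 1
  -- terms is the trace to the subfield of order s.
  tr : ℕ → Carrier → Carrier
  tr zero x = 0#
  tr (suc i) x = tr i x + x ^ (s ℕ.^ i)

  Tr : Carrier → Carrier
  Tr = tr (suc t)

  abstract
    tr-+ : ∀ i x y → tr i (x + y) ≡ tr i x + tr i y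
    tr-+ zero x y = sym (+-identityˡ 0#)
    tr-+ (suc i) x y = trans (cong₂ _+_ (tr-+ i x y) (power-+ i x y))
      (solve 4 (λ a b c d → (a :+ b) :+ (c :+ d) := (a :+ c) :+ (b :+ d)) refl _ _ _ _)

    tr-sub : ∀ i x y → tr i (x - y) ≡ tr i x - tr i y
    tr-sub i x y = trans (solve 2 (λ a b → a := (a :+ b) :- b) refl (tr i (x - y)) (tr i y))
      (cong (_- tr i y) (trans (sym (tr-+ i (x - y) y)) (cong (tr i) (solve 2 (λ x y → (x :- y) :+ y := x) refl x y))))

    subfield-power : ∀ {a} → a ^ s ≡ a → ∀ i → a ^ (s ℕ.^ i) ≡ a
    subfield-power e zero = *-identityʳ _
    subfield-power {a} e (suc i) = trans (^-* a s (s ℕ.^ i)) (trans (cong (_^ (s ℕ.^ i)) e) (subfield-power e i))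

    tr-scale : ∀ i {a} x → a ^ s ≡ a → tr i (a * x) ≡ a * tr i x
    tr-scale zero x e = sym (zeroʳ _)
    tr-scale (suc i) {a} x e = trans (cong₂ _+_ (tr-scale i x e) (trans (*-^ a x (s ℕ.^ i)) (cong (_* x ^ (s ℕ.^ i)) (subfield-power e i))))
      (sym (distribˡ _ _ _))

    -- Raising to the power s shifts the summands by one place. For t + 1 summands and x in 𝔽_q the
    -- new last summand is x itself, so the trace is unchanged.
    tr-telescope : ∀ i x → tr i (x ^ s) + x ≡ tr i x + x ^ (s ℕ.^ i)
    tr-telescope zero x = cong (0# +_) (sym (*-identityʳ x))
    tr-telescope (suc i) x = trans (solve 3 (λ a b x → (a :+ b) :+ x := (a :+ x) :+ b) refl (tr i (x ^ s)) ((x ^ s) ^ (s ℕ.^ i)) x)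
      (cong₂ _+_ (tr-telescope i x) (sym (^-* x s (s ℕ.^ i))))

    tr-power : ∀ i x → tr i x ^ s ≡ tr i (x ^ s)
    tr-power zero x = 0^ s (ℕₚ.<-trans ℕₚ.0<1+n 1<s)
    tr-power (suc i) x = trans (power₁ (tr i x) (x ^ (s ℕ.^ i))) (cong₂ _+_ (tr-power i x)
      (trans (sym (^-* x (s ℕ.^ i) s)) (trans (cong (x ^_) (ℕₚ.*-comm (s ℕ.^ i) s)) (^-* x s (s ℕ.^ i)))))
      where
      power₁ : ∀ x y → (x + y) ^ s ≡ x ^ s + y ^ s
      power₁ x y = subst (λ j → (x + y) ^ j ≡ x ^ j + y ^ j) (ℕₚ.^-identityʳ s) (power-+ 1 x y)

    Tr-^s : ∀ {x} → Fixed x → Tr (x ^ s) ≡ Tr x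
    Tr-^s {x} fx = trans (solve 2 (λ a x → a := (a :+ x) :- x) refl (Tr (x ^ s)) x)
      (trans (cong (_- x) (trans (tr-telescope (suc t) x) (cong (Tr x +_) (trans (cong (x ^_) (sym q≡sᵗ)) fx))))
        (solve 2 (λ a x → (a :+ x) :- x := a) refl (Tr x) x))

    Tr-subfield : ∀ {x} → Fixed x → Tr x ^ s ≡ Tr x
    Tr-subfield fx = trans (tr-power (suc t) _) (Tr-^s fx)

    subfield-fixed : ∀ {a} → a ^ s ≡ a → Fixed a
    subfield-fixed {a} e = trans (cong (a ^_) q≡sᵗ) (subfield-power e (suc t))

  trPoly : ℕ → Ser
  trPoly zero = 0S
  trPoly (suc i) = trPoly i ⊕ X ↑ (s ℕ.^ i)

  Ev-trPoly : ∀ i {x} → Ev (trPoly i) x (tr i x)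
  Ev-trPoly zero = evaluates 0 Deg-0S refl
  Ev-trPoly (suc i) = Ev-⊕ (Ev-trPoly i) (Ev-↑ (s ℕ.^ i) Ev-X)

  Deg-trPoly : ∀ i → Deg (trPoly i) (s ℕ.^ i)
  Deg-trPoly zero = Deg-0S
  Deg-trPoly (suc i) = Deg-⊕ (Deg-mono (ℕₚ.^-monoʳ-≤ s {{nonZero 1<s}} (ℕₚ.n≤1+n i)) (Deg-trPoly i))
    (Deg-mono (ℕₚ.^-monoʳ-< s 1<s (ℕₚ.n<1+n i)) (Deg-X↑ (s ℕ.^ i)))

  Deg-Tr : Deg (trPoly (suc t)) (suc (s ℕ.^ t))
  Deg-Tr = Deg-⊕ (Deg-mono (ℕₚ.n≤1+n _) (Deg-trPoly t)) (Deg-X↑ (s ℕ.^ t))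

  Tr-top : trPoly (suc t) (s ℕ.^ t) ≡ 1#
  Tr-top = trans (cong₂ _+_ (Deg-trPoly t (s ℕ.^ t) ℕₚ.≤-refl) (X↑-top (s ℕ.^ t))) (+-identityˡ 1#)

  1<sᵗ : 1 ℕ.< s ℕ.^ t
  1<sᵗ = ℕₚ.≤-trans 1<s (ℕₚ.≤-trans (ℕₚ.≤-reflexive (sym (ℕₚ.^-identityʳ s))) (ℕₚ.^-monoʳ-≤ s {{nonZero 1<s}} 1≤t))

  -- A difference d of trace a ≠ 0 contributes d + ω a = (d/a + ω) a, and d/a has trace 1 because
  -- the trace is linear over the subfield. The trace polynomial has degree sᵗ, so there are at most
  -- sᵗ such slopes.
  P : Carrier → Set
  P z = Tr z ≡ 1#

  P? : ∀ z → Dec (P z)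
  P? z = Tr z ≟ 1#

  abstract
    few-slopes : length (filter P? Fq) ℕ.≤ s ℕ.^ t
    few-slopes = root-bound {trPoly (suc t) ⊕ ⊖ 1S} {s ℕ.^ t} {s ℕ.^ t} (filter P? Fq) (Unique.filter⁺ P? Fq-unique)
      (All.tabulate (λ z∈ → Ev-value (trans (cong (_- 1#) (proj₂ (∈-filter⁻ P? {xs = Fq} z∈))) (-self 1#))
        (Ev-⊕ (Ev-trPoly (suc t)) (Ev-⊖ (Ev-const 1#)))))
      (Deg-⊕ Deg-Tr (Deg-⊖ (Deg-mono (ℕ.s≤s ℕ.z≤n) Deg-const)))
      (λ e → 1≢0 (trans (sym (trans (cong₂ _-_ Tr-top (Deg-const (s ℕ.^ t) (ℕₚ.<⇒≤ 1<sᵗ))) (sub-zero 1#))) e))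

  τ : Carrier → Carrier
  τ x = x + ω * Tr x

  abstract
    τ-sub : ∀ x y → τ x - τ y ≡ (x - y) + ω * Tr (x - y)
    τ-sub x y = trans (solve 5 (λ x y w a b → (x :+ w :* a) :- (y :+ w :* b) := (x :- y) :+ w :* (a :- b)) refl x y ω (Tr x) (Tr y))
      (cong (λ z → (x - y) + ω * z) (sym (tr-sub (suc t) x y)))

    flat-difference : ∀ {x y} → Fixed x → Fixed y → x ≢ y → Tr (x - y) ≡ 0# → Flat P P? (τ x - τ y)
    flat-difference {x} {y} fx fy x≢y e = subst Fixed (sym value≡) (fixed-sub fx fy) , λ z → x≢y (-≡0 (trans (sym value≡) z))
      where
      value≡ : τ x - τ y ≡ x - y
      value≡ = trans (τ-sub x y) (trans (cong (λ z → (x - y) + ω * z) e) (trans (cong ((x - y) +_) (zeroʳ ω)) (+-identityʳ _)))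

    steep-difference : ∀ {x y} → Fixed x → Fixed y → Tr (x - y) ≢ 0# → Steep P P? (τ x - τ y)
    steep-difference {x} {y} fx fy a≢0 = d * i , a , fixed-di , trace≡1 , fixed-a , a≢0 , trans (τ-sub x y)
        (trans (cong (_+ ω * a) (sym da)) (sym (distribʳ a (d * i) ω)))
      where
      d a i : Carrier
      d = x - y
      a = Tr d
      i = inv a a≢0
      a-subfield : a ^ s ≡ a
      a-subfield = Tr-subfield (fixed-sub fx fy)
      fixed-a : Fixed a
      fixed-a = subfield-fixed a-subfield
      da : d * i * a ≡ d
      da = trans (*-assoc d i a) (trans (cong (d *_) (inv* a a≢0)) (*-identityʳ d))
      fixed-di : Fixed (d * i)
      fixed-di = *-cancelˡ a≢0 (trans (*-comm a _) (trans (cong (conj (d * i) *_) (sym fixed-a)) (trans (sym (conj-* (d * i) a))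
        (trans (cong conj da) (trans (fixed-sub fx fy) (trans (sym da) (*-comm (d * i) a)))))))
      trace≡1 : Tr (d * i) ≡ 1#
      trace≡1 = *-cancelˡ a≢0 (trans (sym (tr-scale (suc t) (d * i) a-subfield))
        (trans (cong Tr (trans (*-comm a _) da)) (sym (*-identityʳ a))))

    step : ∀ {x y} → Fixed x → Fixed y → x ≢ y → Flat P P? (τ x - τ y) ⊎ Steep P P? (τ x - τ y)
    step {x} {y} fx fy x≢y with Tr (x - y) ≟ 0#
    ... | yes e = inj₁ (flat-difference fx fy x≢y e)
    ... | no ne = inj₂ (steep-difference fx fy ne)

    -- For g in 𝔽_q outside the subfield, gˢ - g is nonzero and has trace 0.
    flat : ∃ λ x → ∃ λ y → Fixed x × Fixed y × Flat P P? (τ x - τ y)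
    flat = go (nonroot {X ↑ s ⊕ ⊖ X} {s} {s} (Deg-⊕ (Deg-X↑ s) (Deg-⊖ (Deg-mono (ℕ.s≤s (ℕₚ.<⇒≤ 1<s)) Deg-X))) top s<q)
      where
      top : (X ↑ s ⊕ ⊖ X) s ≢ 0#
      top e = 1≢0 (trans (sym (trans (cong₂ _-_ (X↑-top s) (Deg-X s 1<s)) (sub-zero 1#))) e)
      s<q : s ℕ.< q
      s<q = ℕₚ.≤-trans (ℕₚ.≤-reflexive (cong suc (sym (ℕₚ.^-identityʳ s))))
        (ℕₚ.≤-trans (ℕₚ.^-monoʳ-< s 1<s (ℕ.s≤s 1≤t)) (ℕₚ.≤-reflexive (sym q≡sᵗ)))
      go : (∃ λ g → Fixed g × ¬ Ev (X ↑ s ⊕ ⊖ X) g 0#) → ∃ λ x → ∃ λ y → Fixed x × Fixed y × Flat P P? (τ x - τ y)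
      go (g , fg , ne) = g ^ s , g , fgs , fg , flat-difference fgs fg
        (λ e → ne (Ev-value (trans (cong (_- g) e) (-self g)) (Ev-⊕ (Ev-↑ s Ev-X) (Ev-⊖ Ev-X))))
        (trans (tr-sub (suc t) (g ^ s) g) (trans (cong (_- Tr g) (Tr-^s fg)) (-self _)))
        where
        fgs : Fixed (g ^ s)
        fgs = trans (sym (^-* g s q)) (trans (cong (g ^_) (ℕₚ.*-comm s q)) (trans (^-* g q s) (cong (_^ s) fg)))

    steep : ∃ λ x → ∃ λ y → Fixed x × Fixed y × Steep P P? (τ x - τ y)
    steep = go (nonroot {trPoly (suc t)} {s ℕ.^ t} {s ℕ.^ t} Deg-Tr (λ e → 1≢0 (trans (sym Tr-top) e)) sᵗ<q)
      where
      go : (∃ λ g → Fixed g × ¬ Ev (trPoly (suc t)) g 0#) → ∃ λ x → ∃ λ y → Fixed x × Fixed y × Steep P P? (τ x - τ y)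
      go (g , fg , ne) = g , 0# , fg , conj-0 , steep-difference fg conj-0
        (λ e → ne (Ev-value (trans (cong Tr (solve 1 (λ g → g := g :- :0) refl g)) e) (Ev-trPoly (suc t))))

  trace-graph : ∀ M → s ℕ.^ t ℕ.≤ M → suc M ℕ.≤ q → ∃ λ (Γ : PeisertData q K (suc M)) → ¬ StrictEKR q K Γ
  trace-graph M sᵗ≤M M<q = graph P P? M few M<q , not-strict P P? M few M<q τ step flat steep
    where
    few : length (filter P? Fq) ℕ.≤ M
    few = ℕₚ.≤-trans few-slopes sᵗ≤M

-- Squares and nonsquares on two lines.

module SquareGraph (𝕂 : Setting) (k : ℕ) (q≡2k+1 : Setting.q 𝕂 ≡ suc (k ℕ.+ k)) where
  open QuadraticField 𝕂
  open Construction 𝕂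

  1≤k : 1 ℕ.≤ k
  1≤k = go k q≡2k+1
    where
    go : ∀ k → q ≡ suc (k ℕ.+ k) → 1 ℕ.≤ k
    go zero e = contradiction e (ℕₚ.>⇒≢ 1<q)
    go (suc k) _ = ℕ.s≤s ℕ.z≤n

  -- Otherwise 1 + 1 = 0, and the image 1 + k + k of q would be 1 instead of 0.
  -1≢1 : - 1# ≢ 1#
  -1≢1 e = 1≢0 (trans (solve 1 (λ a → :1 := (:1 :+ (a :+ a)) :- (:1 :- :- :1) :* a) refl (ι k))
    (trans (cong₂ (λ u w → u - w * ι k) (trans (cong (1# +_) (sym (ι-+ k k))) (trans (cong ι (sym q≡2k+1)) ι-q)) (trans (cong (λ z → 1# - z) e) (-self 1#)))
      (solve 1 (λ a → :0 :- :0 :* a := :0) refl (ι k))))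

  NonSquare : Carrier → Set
  NonSquare x = x ^ k ≡ - 1#

  nonSquare? : ∀ x → Dec (NonSquare x)
  nonSquare? x = (x ^ k) ≟ (- 1#)

  abstract
    square-or-not : ∀ {x} → Fixed x → x ≢ 0# → x ^ k ≡ 1# ⊎ NonSquare x
    square-or-not {x} fx x≢0 = go (*≡0 {x ^ k - 1#} {x ^ k + 1#} (trans
        (solve 1 (λ z → (z :- :1) :* (z :+ :1) := z :* z :- :1) refl (x ^ k))
        (trans (cong (_- 1#) (trans (sym (^-+ x k k)) x^2k)) (-self 1#))))
      where
      x^2k : x ^ (k ℕ.+ k) ≡ 1#
      x^2k = *-cancelˡ x≢0 (trans (trans (cong (x ^_) (sym q≡2k+1)) fx) (sym (*-identityʳ x)))
      go : x ^ k - 1# ≡ 0# ⊎ x ^ k + 1# ≡ 0# → x ^ k ≡ 1# ⊎ NonSquare x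
      go (inj₁ e) = inj₁ (-≡0 e)
      go (inj₂ e) = inj₂ (-≡0 (trans (cong (x ^ k +_) (solve 0 (:- (:- :1) := :1) refl)) e))

  -- A difference between a point x of the first line, a square or zero, and a point ω y with y a
  -- nonsquare is x - ω y = (-x/y + ω)(-y). Its slope z = -x/y is 0, or -z is a nonsquare; two
  -- nonsquares give slope 0. With the direction 1 this makes at most k + 2 directions.
  P : Carrier → Set
  P z = z ≡ 0# ⊎ NonSquare (- z)

  P? : ∀ z → Dec (P z)
  P? z = (z ≟ 0#) ⊎-dec nonSquare? (- z)

  slopePoly : Ser
  slopePoly = X ⊗ ((⊖ X) ↑ k ⊕ 1S)

  abstract
    Ev-slopePoly : ∀ {z} → P z → Ev slopePoly z 0#
    Ev-slopePoly {z} Pz = Ev-value (zeroed (root Pz)) (Ev-⊗ Ev-X (Ev-⊕ (Ev-↑ k (Ev-⊖ Ev-X)) (Ev-const 1#)))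
      where
      root : P z → z ≡ 0# ⊎ (- z) ^ k + 1# ≡ 0#
      root (inj₁ e) = inj₁ e
      root (inj₂ e) = inj₂ (trans (cong (_+ 1#) e) (-‿inverseˡ 1#))

    Deg-↑-⊖X : ∀ j → Deg ((⊖ X) ↑ j) (suc j)
    Deg-↑-⊖X zero = Deg-const
    Deg-↑-⊖X (suc j) = Deg-⊗ (Deg-⊖ Deg-X) (Deg-↑-⊖X j) ℕₚ.≤-refl

    few-slopes : length (filter P? Fq) ℕ.≤ suc k
    few-slopes = root-bound {slopePoly} {suc k} {1} (filter P? Fq) (Unique.filter⁺ P? Fq-unique)
      (All.tabulate (λ z∈ → Ev-slopePoly (proj₂ (∈-filter⁻ P? {xs = Fq} z∈))))
      (Deg-⊗ Deg-X (Deg-⊕ (Deg-↑-⊖X k) (Deg-mono (ℕ.s≤s ℕ.z≤n) Deg-const)) ℕₚ.≤-refl)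
      (λ e → 1≢0 (trans (sym (trans (X⊗-suc ((⊖ X) ↑ k ⊕ 1S) 0) (trans (cong (_+ 1#) (low k 1≤k)) (+-identityˡ 1#)))) e))
      where
      low : ∀ j → 1 ℕ.≤ j → ((⊖ X) ↑ j) 0 ≡ 0#
      low (suc j) _ = zeroed (inj₁ -0≡0)

  τ : Carrier → Carrier
  τ x with nonSquare? x
  ... | yes _ = ω * x
  ... | no _ = x

  abstract
    τ-nonsquare : ∀ {x} → NonSquare x → τ x ≡ ω * x
    τ-nonsquare {x} ns with nonSquare? x
    ... | yes _ = refl
    ... | no ne = contradiction ns ne

    τ-square : ∀ {x} → ¬ NonSquare x → τ x ≡ x
    τ-square {x} ns with nonSquare? x
    ... | yes e = contradiction e ns
    ... | no _ = refl

    nonsquare≢0 : ∀ {x} → NonSquare x → x ≢ 0#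
    nonsquare≢0 ns refl = 1≢0 (trans (solve 0 (:1 := :- (:- :1)) refl) (trans (cong -_ (trans (sym ns) (0^ k 1≤k))) -0≡0))

    mixed : ∀ {x y} → Fixed x → Fixed y → ¬ NonSquare x → NonSquare y → Steep P P? (τ x - τ y)
    mixed {x} {y} fx fy nx ny = - (x * i) , - y , fixed-neg fxi , slope-P , fixed-neg fy , (λ z → y≢0 (neg≡0 z)) , (begin
      τ x - τ y                          ≡⟨ cong₂ _-_ (τ-square nx) (τ-nonsquare ny) ⟩
      x - ω * y                          ≡⟨ cong (λ z → z - ω * y) (sym xi) ⟩
      x * i * y - ω * y                  ≡⟨ solve 3 (λ z y w → z :* y :- w :* y := (:- z :+ w) :* :- y) refl (x * i) y ω ⟩
      (- (x * i) + ω) * - y              ∎)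
      where
      open ≡-Reasoning
      y≢0 : y ≢ 0#
      y≢0 = nonsquare≢0 ny
      i : Carrier
      i = inv y y≢0
      xi : x * i * y ≡ x
      xi = trans (*-assoc x i y) (trans (cong (x *_) (inv* y y≢0)) (*-identityʳ x))
      fxi : Fixed (x * i)
      fxi = *-cancelˡ y≢0 (trans (*-comm y _) (trans (cong (conj (x * i) *_) (sym fy)) (trans (sym (conj-* (x * i) y))
        (trans (cong conj xi) (trans fx (trans (sym xi) (*-comm (x * i) y)))))))
      slope-P : P (- (x * i))
      slope-P with x ≟ 0#
      ... | yes refl = inj₁ (trans (cong -_ (zeroˡ i)) -0≡0)
      ... | no x≢0 with square-or-not fx x≢0
      ...   | inj₂ ns = contradiction ns nx
      ...   | inj₁ sq = inj₂ (trans (cong (_^ k) (solve 1 (λ z → :- (:- z) := z) refl (x * i))) (begin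
        (x * i) ^ k                      ≡⟨ solve 1 (λ z → z := :- (z :* :- :1)) refl _ ⟩
        - ((x * i) ^ k * - 1#)           ≡⟨ cong (λ z → - ((x * i) ^ k * z)) (sym ny) ⟩
        - ((x * i) ^ k * y ^ k)          ≡⟨ cong -_ (trans (sym (*-^ (x * i) y k)) (trans (cong (_^ k) xi) sq)) ⟩
        - 1#                             ∎))

    step : ∀ {x y} → Fixed x → Fixed y → x ≢ y → Flat P P? (τ x - τ y) ⊎ Steep P P? (τ x - τ y)
    step {x} {y} fx fy x≢y = go (nonSquare? x) (nonSquare? y)
      where
      go : Dec (NonSquare x) → Dec (NonSquare y) → Flat P P? (τ x - τ y) ⊎ Steep P P? (τ x - τ y)
      go (no nx) (no ny) = inj₁ (subst (Flat P P?) (sym (cong₂ _-_ (τ-square nx) (τ-square ny))) (fixed-sub fx fy , x≢y ∘ -≡0))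
      go (yes nx) (yes ny) = inj₂ (0# , x - y , conj-0 , inj₁ refl , fixed-sub fx fy , x≢y ∘ -≡0 ,
        trans (cong₂ _-_ (τ-nonsquare nx) (τ-nonsquare ny)) (solve 3 (λ w x y → w :* x :- w :* y := (:0 :+ w) :* (x :- y)) refl ω x y))
      go (no nx) (yes ny) = inj₂ (mixed fx fy nx ny)
      go (yes nx) (no ny) = inj₂ (flip (mixed fy fx ny nx))
        where
        flip : Steep P P? (τ y - τ x) → Steep P P? (τ x - τ y)
        flip (z , a , fz , Pz , fa , a≢0 , e) = z , - a , fz , Pz , fixed-neg fa , a≢0 ∘ neg≡0 ,
          trans (solve 2 (λ x y → x :- y := :- (y :- x)) refl (τ x) (τ y)) (trans (cong -_ e) (solve 2 (λ u a → :- (u :* a) := u :* :- a) refl (z + ω) a))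

    zero-square : ¬ NonSquare 0#
    zero-square ns = nonsquare≢0 ns refl

    flat : ∃ λ x → ∃ λ y → Fixed x × Fixed y × Flat P P? (τ x - τ y)
    flat = 1# , 0# , conj-1 , conj-0 , subst (Flat P P?)
      (sym (trans (cong₂ _-_ (τ-square (λ e → -1≢1 (trans (sym e) (1^ k)))) (τ-square zero-square)) (solve 0 (:1 :- :0 := :1) refl)))
      (conj-1 , 1≢0)

    -- X (Xᵏ - 1) has degree k + 1 < q, so 𝔽_q contains a nonsquare g. The points ω g and 0 give a
    -- difference of slope 0.
    steep : ∃ λ x → ∃ λ y → Fixed x × Fixed y × Steep P P? (τ x - τ y)
    steep = go (nonroot {X ⊗ (X ↑ k ⊕ ⊖ 1S)} {suc k} {1} (Deg-⊗ Deg-X (Deg-⊕ (Deg-X↑ k) (Deg-⊖ (Deg-mono (ℕ.s≤s ℕ.z≤n) Deg-const))) ℕₚ.≤-refl)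
        (λ e → -1≢0 (trans (sym (trans (X⊗-suc (X ↑ k ⊕ ⊖ 1S) 0) (trans (cong (_+ - 1#) (X↑-other k 0 (ℕₚ.<⇒≢ 1≤k))) (+-identityˡ _)))) e))
        (ℕₚ.≤-trans (ℕ.s≤s (ℕₚ.+-monoˡ-≤ k 1≤k)) (ℕₚ.≤-reflexive (sym q≡2k+1))))
      where
      -1≢0 : - 1# ≢ 0#
      -1≢0 e = 1≢0 (neg≡0 e)
      go : (∃ λ g → Fixed g × ¬ Ev (X ⊗ (X ↑ k ⊕ ⊖ 1S)) g 0#) → ∃ λ x → ∃ λ y → Fixed x × Fixed y × Steep P P? (τ x - τ y)
      go (g , fg , ne) = g , 0# , fg , conj-0 , 0# , g , conj-0 , inj₁ refl , fg , g≢0 ,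
          trans (cong₂ _-_ (τ-nonsquare (nonsquare (square-or-not fg g≢0))) (τ-square zero-square))
            (solve 2 (λ w g → w :* g :- :0 := (:0 :+ w) :* g) refl ω g)
        where
        evaluation : g ≡ 0# ⊎ g ^ k - 1# ≡ 0# → Ev (X ⊗ (X ↑ k ⊕ ⊖ 1S)) g 0#
        evaluation h = Ev-value (zeroed h) (Ev-⊗ Ev-X (Ev-⊕ (Ev-↑ k Ev-X) (Ev-⊖ (Ev-const 1#))))
        g≢0 : g ≢ 0#
        g≢0 e = ne (evaluation (inj₁ e))
        nonsquare : g ^ k ≡ 1# ⊎ NonSquare g → NonSquare g
        nonsquare (inj₁ e) = contradiction (evaluation (inj₂ (trans (cong (_- 1#) e) (-self 1#)))) ne
        nonsquare (inj₂ ns) = ns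

  square-graph : ∀ M → suc k ℕ.≤ M → suc M ℕ.≤ q → ∃ λ (Γ : PeisertData q K (suc M)) → ¬ StrictEKR q K Γ
  square-graph M k<M M<q = graph P P? M few M<q , not-strict P P? M few M<q τ step flat steep
    where
    few : length (filter P? Fq) ℕ.≤ M
    few = ℕₚ.≤-trans few-slopes k<M

-- Prime order: the bound and the two shapes of a direction polynomial.

module PrimeOrder (𝕂 : Setting) (q≡p : Setting.q 𝕂 ≡ Setting.p 𝕂) where
  open QuadraticField 𝕂

  abstract
    ι≢0 : ∀ {i} → 0 ℕ.< i → i ℕ.< q → ι i ≢ 0#
    ι≢0 {i} 0<i i<q ιi≡0 = go (coprime-Bézout (prime⇒coprime pp {{ℕ.>-nonZero 0<i}} (subst (i ℕ.<_) q≡p i<q)))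
      where
      vanish : ∀ x {j} → ι j ≡ 0# → ι (x ℕ.* j) ≡ 0#
      vanish x {j} e = trans (ι-* x j) (trans (cong (ι x *_) e) (zeroʳ _))
      combine : ∀ {x y} → ι x ≡ 0# → ι y ≡ 0# → 1 ℕ.+ x ≡ y → ⊥
      combine {x} {y} x≡0 y≡0 e = 1≢0 (trans (sym (trans (cong (1# +_) x≡0) (+-identityʳ 1#))) (trans (cong ι e) y≡0))
      go : GCD.Bézout.Identity 1 p i → ⊥
      go (GCD.Bézout.+- x y e) = combine (vanish y ιi≡0) (vanish x char) e
      go (GCD.Bézout.-+ x y e) = combine (vanish x char) (vanish y ιi≡0) e

module PrimeDirections (𝕂 : Setting) (q≡p : Setting.q 𝕂 ≡ Setting.p 𝕂)
  (r : ℕ) (Γ : Graph 𝕂 (suc (suc r))) (C : Clique 𝕂 Γ) where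
  open FewDirections 𝕂 r Γ C public
  open PrimeOrder 𝕂 q≡p public

  module Bound (all-determined : AllDetermined) (not-collinear : NotCollinear) where
    open Main all-determined not-collinear

    abstract
      -- Indices strictly between 0 and p are invertible, so a vanishing derivative leaves h = X^q +
      -- h 0. All values of the form then have the conjugate -h 0, hence they coincide and the
      -- clique is a line.
      Dh≉0 : ∀ {d} → Determined d → ¬ (D (prod (values d)) ≈ 0S)
      Dh≉0 {d} det@(determined d≢0 k along) Dh≈0 = not-collinear k (go (parallel d≢0 along))
        where
        open DeterminedDirection det
        h-shape : h ≈ X ↑ q ⊕ const (h 0)
        h-shape = pointwise shape
          where
          shape : ∀ i → h i ≡ (X ↑ q ⊕ const (h 0)) i
          shape zero = sym (trans (cong (_+ h 0) (X↑-other q 0 (ℕₚ.<⇒≢ 0<q))) (+-identityˡ _))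
          shape (suc i) with ℕₚ.<-cmp (suc i) q
          ... | tri< i<q i≢q _ = trans vanishes (sym (trans (cong (_+ 0#) (X↑-other q (suc i) i≢q)) (+-identityˡ _)))
            where
            vanishes : h (suc i) ≡ 0#
            vanishes = *-cancelˡ (ι≢0 (ℕ.s≤s ℕ.z≤n) i<q) (trans (at Dh≈0 i) (sym (zeroʳ _)))
          ... | tri≈ _ refl _ = trans h-monic (sym (trans (cong (_+ 0#) (X↑-top q)) (+-identityʳ _)))
          ... | tri> _ i≢q q<i = trans (h-degree (suc i) q<i) (sym (trans (cong (_+ 0#) (X↑-other q (suc i) i≢q)) (+-identityˡ _)))
        conj-value : ∀ i → conj (form (v i) d) ≡ - h 0
        conj-value i = trans (solve 2 (λ a b → a := (a :+ b) :- b) refl _ (h 0))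
          (trans (cong (_- h 0) (Ev-unique (S.sym h-shape) (Ev-⊕ (Ev-↑ q Ev-X) (Ev-const (h 0))) (Ev-prod-root (values d) (∈-tabulate⁺ i))))
            (+-identityˡ _))
        constant : ∀ i j → form (v i) d ≡ form (v j) d
        constant i j = trans (sym (conj-involutive _)) (trans (cong conj (trans (conj-value i) (sym (conj-value j)))) (conj-involutive _))
        go : (∃ λ a → Fixed a × a ≢ 0# × d ≡ c k * a) → ∀ i j → form (v i) (c k) ≡ form (v j) (c k)
        go (a , fa , a≢0 , refl) i j = *-cancelˡ a≢0 (trans (*-comm a _) (trans (sym (form-scaleʳ (v i) (c k) fa))
          (trans (constant i j) (trans (form-scaleʳ (v j) (c k) fa) (*-comm _ a)))))

      many-directions : ¬ (m ℕ.+ suc r ℕ.≤ suc q)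
      many-directions small = Dh≉0 det (D≈0 small det)
        where
        det : Determined (c zero)
        det = determined (nonzero zero) zero (form-alternating (c zero))

    module Classification (q≡2r+1 : q ≡ suc (r ℕ.+ r)) (2≤r : 2 ℕ.≤ r) where

      1≤r : 1 ℕ.≤ r
      1≤r = ℕₚ.<⇒≤ 2≤r

      -- As a field element r + 1 = (q + 1)/2 is the inverse of 2.
      half : Carrier
      half = ι (suc r)

      half+half : half + half ≡ 1#
      half+half = trans (sym (ι-+ (suc r) (suc r))) (trans (cong ι (cong suc (trans (ℕₚ.+-suc r r) (sym q≡2r+1)))) (trans (cong (1# +_) ι-q) (+-identityʳ 1#)))

      r<q : r ℕ.< q
      r<q = ℕₚ.≤-trans (ℕ.s≤s (ℕₚ.m≤m+n r r)) (ℕₚ.≤-reflexive (sym q≡2r+1))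

      r+1<q : suc r ℕ.< q
      r+1<q = ℕₚ.≤-trans (ℕ.s≤s (ℕₚ.+-monoˡ-≤ r 1≤r)) (ℕₚ.≤-reflexive (sym q≡2r+1))

      r+2<q : suc (suc r) ℕ.< q
      r+2<q = ℕₚ.≤-trans (ℕ.s≤s (ℕₚ.+-monoˡ-≤ r 2≤r)) (ℕₚ.≤-reflexive (sym q≡2r+1))

      half≢0 : half ≢ 0#
      half≢0 = ι≢0 (ℕ.s≤s ℕ.z≤n) r+1<q

      two three four : Carrier
      two = 1# + 1#
      three = 1# + two
      four = two + two

      -- The two shapes of h: up to a translation X ↦ X − t it is X^{r+1} (X^r − γ) with γ² = −1, or
      -- X^{2r+1} − γ X^{r+1} − X with γ² = −4.
      record TypeB (d : Carrier) : Set where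
        field
          γ t    : Carrier
          conj-t : conj t ≡ - t
          γ²     : γ * γ ≡ - 1#
          factor : prod (values d) ≈ lin t ↑ suc r ⊗ (lin t ↑ r ⊕ ⊖ const γ)

      TypeA : Carrier → Set
      TypeA d = prod (values d) (suc r) * prod (values d) (suc r) ≡ - four

      module Shape {d : Carrier} (det : Determined d) where
        open DeterminedDirection det

        Dh≈ : D h ≈ 1S ⊕ ⊖ D G
        Dh≈ = begin
          D h                       ≈⟨ solveS 2 (λ f h → h ⩴ f ⊟ (f ⊟ h)) S.refl (D Φ) (D h) ⟩
          D Φ ⊕ ⊖ (D Φ ⊕ ⊖ D h)     ≈⟨ S.+-cong D-Φ (S.-‿cong (S.sym (S.trans (D-⊕ Φ (⊖ h)) (S.+-congˡ (D-⊖ h))))) ⟩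
          1S ⊕ ⊖ D G                ∎
          where open ≈-Reasoning

        γ : Carrier
        γ = G (suc r)

        h-middle : h (suc r) ≡ - γ
        h-middle = trans (solve 2 (λ h f → h := f :- (f :- h)) refl (h (suc r)) (Φ (suc r)))
          (trans (cong (_- γ) (Φ-gap {suc r} (λ e → ℕₚ.>⇒≢ 1≤r (ℕₚ.suc-injective e)) (ℕₚ.<⇒≢ r+1<q))) (+-identityˡ _))

        abstract
          -- G has degree at most r + 1 and D h at most r; their sum is exactly q, the degree of h.
          cofactor : ∃ λ a → G ⊗ D h ≈ const a ⊗ h
          cofactor = go h∣G⊗Dh
            where
            go : (∃ λ A → Finite A × G ⊗ D h ≈ h ⊗ A) → ∃ λ a → G ⊗ D h ≈ const a ⊗ h
            go (A , finA , e) = A 0 , S.trans e (S.trans (S.*-comm h A) (S.*-congʳ (pointwise λ { zero → refl ; (suc i) → A≡0 i })))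
              where
              A≡0 : ∀ i → A (suc i) ≡ 0#
              A≡0 i = Deg-cofactor h-degree h-monic finA (Deg-cong e (Deg-⊗ {G} {D h} {m} {suc r} {suc q} G-degree Dh-degree
                (ℕₚ.≤-reflexive (cong suc (cong suc (trans (ℕₚ.+-suc r r) (sym q≡2r+1))))))) (suc i) (ℕₚ.≤-trans (ℕ.s≤s (ℕₚ.m≤m+n q i)) (ℕₚ.≤-reflexive (sym (ℕₚ.+-suc q i))))

        a : Carrier
        a = proj₁ cofactor

        -- Comparison in degree q, where h is monic and G (D h) has the product of its leading
        -- terms, with coefficients γ and -(r + 1) γ.
        a≡ : a ≡ - (half * (γ * γ))
        a≡ = begin
          a                             ≡⟨ *-identityʳ a ⟨
          a * 1#                        ≡⟨ cong (a *_) (sym h-monic) ⟩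
          a * h q                       ≡⟨ const-⊗ a h q ⟨
          (const a ⊗ h) q               ≡⟨ at (proj₂ cofactor) q ⟨
          (G ⊗ D h) q                   ≡⟨ cong (G ⊗ D h) q≡2r+1 ⟩
          (G ⊗ D h) (suc r ℕ.+ r)       ≡⟨ ⊗-top {G} {D h} G-degree Dh-degree ⟩
          γ * D h r                     ≡⟨ cong (λ z → γ * (half * z)) h-middle ⟩
          γ * (half * - γ)              ≡⟨ solve 2 (λ g k → g :* (k :* :- g) := :- (k :* (g :* g))) refl γ half ⟩
          - (half * (γ * γ))            ∎
          where open ≡-Reasoning

        abstract
          γ≢0 : γ ≢ 0#
          γ≢0 γ≡0 = go (⊗-domain (_ , G-degree) (_ , Dh-degree) (S.trans (proj₂ cofactor) (pointwise λ i → trans (const-⊗ a h i) (zeroed (inj₁ a≡0)))))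
            where
            a≡0 : a ≡ 0#
            a≡0 = trans a≡ (trans (cong (λ g → - (half * (g * g))) γ≡0) (solve 1 (λ k → :- (k :* (:0 :* :0)) := :0) refl half))
            go : G ≈ 0S ⊎ D h ≈ 0S → ⊥
            go (inj₁ G≈0) = not-injective det (G≈0⇒injective G≈0)
            go (inj₂ Dh≈0) = Dh≉0 det Dh≈0

          a≢0 : a ≢ 0#
          a≢0 e = *≢0 half≢0 (*≢0 γ≢0 γ≢0) (neg≡0 (trans (sym a≡) e))

        ι[r+2]≢0 : ι (suc (suc r)) ≢ 0#
        ι[r+2]≢0 = ι≢0 (ℕ.s≤s ℕ.z≤n) r+2<q

        -- Parameters of the model F = γ Y^{r+1} + g Y with Y = X - t. The translation t makes F
        -- agree with G in degree r too, and g makes the terms in Y^{r+1} cancel when F replaces G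
        -- in G (D h) = a h. The terms in Y^{2r+1} cancel by the value of a.
        t g : Carrier
        t = - (G r * inv (half * γ) (*≢0 half≢0 γ≢0))
        g = (1# + a) * inv (ι (suc (suc r))) ι[r+2]≢0

        g-equation : (1# + half) * g ≡ 1# + a
        g-equation = trans (*-comm _ g) (trans (*-assoc _ _ _) (trans (cong ((1# + a) *_) (inv* _ ι[r+2]≢0)) (*-identityʳ _)))

        Y u F Δ : Ser
        Y = lin t
        u = Y ↑ r
        F = const γ ⊗ (Y ⊗ u) ⊕ const g ⊗ Y
        Δ = G ⊕ ⊖ F

        F-at : ∀ i → F i ≡ γ * (Y ↑ suc r) i + g * Y i
        F-at i = cong₂ _+_ (const-⊗ γ (Y ↑ suc r) i) (const-⊗ g Y i)

        F-degree : Deg F m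
        F-degree i m≤i = trans (F-at i) (trans (cong₂ _+_ (zeroed (inj₂ (lin↑-degree t (suc r) i m≤i)))
          (zeroed (inj₂ (Deg-lin {t} i (ℕₚ.≤-trans (ℕ.s≤s (ℕ.s≤s ℕ.z≤n)) m≤i))))) (+-identityˡ 0#))

        F-top : F (suc r) ≡ γ
        F-top = trans (F-at (suc r)) (trans (cong₂ _+_ (trans (cong (γ *_) (lin↑-top t (suc r))) (*-identityʳ γ))
          (zeroed (inj₂ (Deg-lin {t} (suc r) (ℕ.s≤s 1≤r))))) (+-identityʳ γ))

        F-second : F r ≡ G r
        F-second = begin
          F r                                        ≡⟨ F-at r ⟩
          γ * (Y ↑ suc r) r + g * Y r                ≡⟨ cong₂ _+_ (cong (γ *_) (lin↑-second t r)) (zeroed (inj₂ (Deg-lin {t} r 2≤r))) ⟩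
          γ * - (half * t) + 0#                      ≡⟨ solve 4 (λ γ k x i → γ :* :- (k :* :- (x :* i)) :+ :0 := x :* (i :* (k :* γ))) refl γ half (G r) _ ⟩
          G r * (inv (half * γ) _ * (half * γ))      ≡⟨ cong (G r *_) (inv* _ (*≢0 half≢0 γ≢0)) ⟩
          G r * 1#                                   ≡⟨ *-identityʳ _ ⟩
          G r                                        ∎
          where open ≡-Reasoning

        Δ-degree : Deg Δ r
        Δ-degree i r≤i with ℕₚ.m≤n⇒m<n∨m≡n r≤i
        ... | inj₂ refl = trans (cong (λ z → G r - z) F-second) (-self _)
        ... | inj₁ r<i with ℕₚ.m≤n⇒m<n∨m≡n r<i
        ...   | inj₂ refl = trans (cong (λ z → G (suc r) - z) F-top) (-self _)
        ...   | inj₁ m≤i = trans (cong₂ _-_ (G-degree i m≤i) (F-degree i m≤i)) (-self 0#)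

        DF : D F ≈ const γ ⊗ (const half ⊗ u) ⊕ const g
        DF = begin
          D F
            ≈⟨ D-⊕ (const γ ⊗ (Y ↑ suc r)) (const g ⊗ Y) ⟩
          D (const γ ⊗ Y ↑ suc r) ⊕ D (const g ⊗ Y)
            ≈⟨ S.+-cong (D-scale γ (Y ↑ suc r)) (D-scale g Y) ⟩
          const γ ⊗ D (Y ↑ suc r) ⊕ const g ⊗ D Y
            ≈⟨ S.+-cong (S.*-congˡ (D-lin↑ t r)) (S.trans (S.*-congˡ (D-lin t)) (S.*-identityʳ _)) ⟩
          const γ ⊗ (const half ⊗ u) ⊕ const g ∎
          where
          open ≈-Reasoning

        -- What the model leaves over: B is the coefficient of Y, and the constant is -a (T + t).
        T B : Carrier
        T = conj t
        B = (1# - g) * (g - a)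

        Φ-shift : Φ ≈ Y ⊗ (u ⊗ u) ⊕ const T ⊕ (Y ⊕ const t)
        Φ-shift = S.+-cong (begin
          X ↑ q                                 ≈⟨ SExp.^-congˡ q X≈ ⟩
          (Y ⊕ const t) ↑ q                     ≈⟨ S.trans (SExp.^-congʳ (Y ⊕ const t) q≡pⁿ) (S.trans (PrimePower.↑s-homo pp char n Y (const t))
                                                     (S.+-cong (SExp.^-congʳ Y (sym q≡pⁿ)) (SExp.^-congʳ (const t) (sym q≡pⁿ)))) ⟩
          Y ↑ q ⊕ const t ↑ q                   ≈⟨ S.+-cong (S.trans (SExp.^-congʳ Y q≡2r+1) (S.*-congˡ (SExp.^-homo-* Y r r))) (const-↑ t q) ⟩
          Y ⊗ (u ⊗ u) ⊕ const T                 ∎) X≈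
          where
          open ≈-Reasoning
          X≈ : X ≈ Y ⊕ const t
          X≈ = solveS 2 (λ x t → x ⩴ (x ⊟ t) ⊞ t) S.refl X (const t)

        H : Ser
        H = 1S ⊕ const a ⊕ ⊖ const g ⊕ ⊖ (const γ ⊗ (const half ⊗ u)) ⊕ ⊖ D Δ

        abstract
          -- Substituting G = F + Δ in G (1 − G′) = a h; the terms of F cancel by the choice of t and g.
          residual : const B ⊗ Y ⊕ ⊖ (const a ⊗ const (T + t)) ⊕ Δ ⊗ H ⊕ ⊖ (F ⊗ D Δ) ≈ 0S
          residual = begin
            const B ⊗ Y ⊕ ⊖ (const a ⊗ const (T + t)) ⊕ Δ ⊗ H ⊕ ⊖ (F ⊗ D Δ)
              ≈⟨ S.+-congʳ (S.+-congʳ (S.+-congʳ (S.*-congʳ B≈))) ⟩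
            (1S ⊕ ⊖ cg) ⊗ (cg ⊕ ⊖ ca) ⊗ Y ⊕ ⊖ (ca ⊗ const (T + t)) ⊕ Δ ⊗ H ⊕ ⊖ (F ⊗ D Δ)
              ≈⟨ solveS 9 (λ γ k g a τ y u Δ D′ →
                   let f = γ ⊠ (y ⊠ u) ⊞ g ⊠ y ; o = 𝟙 in
                   (o ⊟ g) ⊠ (g ⊟ a) ⊠ y ⊞ ⊟ (a ⊠ τ) ⊞ Δ ⊠ (o ⊞ a ⊞ ⊟ g ⊞ ⊟ (γ ⊠ (k ⊠ u)) ⊞ ⊟ D′) ⊞ ⊟ (f ⊠ D′)
                   ⩴ ((f ⊞ Δ) ⊠ (o ⊞ ⊟ (γ ⊠ (k ⊠ u) ⊞ g ⊞ D′)) ⊞ ⊟ (a ⊠ (y ⊠ (u ⊠ u) ⊞ (y ⊞ τ) ⊞ ⊟ (f ⊞ Δ))))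
                     ⊞ ((a ⊞ k ⊠ (γ ⊠ γ)) ⊠ (y ⊠ (u ⊠ u)) ⊞ ((o ⊞ k) ⊠ g ⊞ ⊟ (o ⊞ a)) ⊠ (γ ⊠ (y ⊠ u))))
                   S.refl cγ ck cg ca (const (T + t)) Y u Δ (D Δ) ⟩
            ((F ⊕ Δ) ⊗ (1S ⊕ ⊖ (cγ ⊗ (ck ⊗ u) ⊕ cg ⊕ D Δ)) ⊕ ⊖ (ca ⊗ (Y ⊗ (u ⊗ u) ⊕ (Y ⊕ const (T + t)) ⊕ ⊖ (F ⊕ Δ))))
              ⊕ ((ca ⊕ ck ⊗ (cγ ⊗ cγ)) ⊗ (Y ⊗ (u ⊗ u)) ⊕ ((1S ⊕ ck) ⊗ cg ⊕ ⊖ (1S ⊕ ca)) ⊗ (cγ ⊗ (Y ⊗ u)))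
              ≈⟨ S.+-cong (S.trans (S.+-congʳ equation) (S.-‿inverseʳ _))
                   (S.+-cong (S.trans (S.*-congʳ a-relation) (S.zeroˡ _)) (S.trans (S.*-congʳ g-relation) (S.zeroˡ _))) ⟩
            0S ⊕ (0S ⊕ 0S)
              ≈⟨ S.trans (S.+-identityˡ _) (S.+-identityˡ _) ⟩
            0S ∎
            where
            open ≈-Reasoning
            cγ ck cg ca : Ser
            cγ = const γ
            ck = const half
            cg = const g
            ca = const a
            B≈ : const B ≈ (1S ⊕ ⊖ cg) ⊗ (cg ⊕ ⊖ ca)
            B≈ = S.trans (S.sym (const-* (1# - g) (g - a))) (S.*-cong (const-sub 1# g) (const-sub g a))
            a-relation : ca ⊕ ck ⊗ (cγ ⊗ cγ) ≈ 0S
            a-relation = S.trans (S.+-congˡ (S.trans (S.*-congˡ (const-* γ γ)) (const-* half (γ * γ))))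
              (S.trans (const-+ a _) (const-zero (trans (cong (_+ half * (γ * γ)) a≡) (-‿inverseˡ _))))
            g-relation : (1S ⊕ ck) ⊗ cg ⊕ ⊖ (1S ⊕ ca) ≈ 0S
            g-relation = S.trans (S.+-cong (S.trans (S.*-congʳ (const-+ 1# half)) (const-* (1# + half) g)) (S.-‿cong (const-+ 1# a)))
              (S.trans (S.sym (const-sub _ _)) (const-zero (trans (cong (_- (1# + a)) g-equation) (-self _))))
            G≈ : G ≈ F ⊕ Δ
            G≈ = solveS 2 (λ x y → x ⩴ y ⊞ (x ⊟ y)) S.refl G F
            equation : (F ⊕ Δ) ⊗ (1S ⊕ ⊖ (cγ ⊗ (ck ⊗ u) ⊕ cg ⊕ D Δ)) ≈ ca ⊗ (Y ⊗ (u ⊗ u) ⊕ (Y ⊕ const (T + t)) ⊕ ⊖ (F ⊕ Δ))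
            equation = begin
              (F ⊕ Δ) ⊗ (1S ⊕ ⊖ (cγ ⊗ (ck ⊗ u) ⊕ cg ⊕ D Δ))
                ≈⟨ S.*-cong (S.sym G≈) (S.+-congˡ (S.-‿cong (S.sym (S.trans (D-cong G≈) (S.trans (D-⊕ F Δ) (S.+-congʳ DF)))))) ⟩
              G ⊗ (1S ⊕ ⊖ D G)
                ≈⟨ S.*-congˡ Dh≈ ⟨
              G ⊗ D h
                ≈⟨ proj₂ cofactor ⟩
              ca ⊗ h
                ≈⟨ S.*-congˡ (solveS 2 (λ h f → h ⩴ f ⊟ (f ⊟ h)) S.refl h Φ) ⟩
              ca ⊗ (Φ ⊕ ⊖ G)
                ≈⟨ S.*-congˡ (S.+-cong Φ-shift′ (S.-‿cong G≈)) ⟩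
              ca ⊗ (Y ⊗ (u ⊗ u) ⊕ (Y ⊕ const (T + t)) ⊕ ⊖ (F ⊕ Δ)) ∎
              where
              Φ-shift′ : Φ ≈ Y ⊗ (u ⊗ u) ⊕ (Y ⊕ const (T + t))
              Φ-shift′ = S.trans Φ-shift (S.trans (solveS 4 (λ a b y c → (a ⊞ b) ⊞ (y ⊞ c) ⩴ a ⊞ (y ⊞ (b ⊞ c))) S.refl (Y ⊗ (u ⊗ u)) (const T) Y (const t))
                (S.+-congˡ (S.+-congˡ (const-+ T t))))

        H-degree : Deg H (suc r)
        H-degree = Deg-⊕ (Deg-⊕ (Deg-⊕ (Deg-⊕ (low Deg-const) (low Deg-const)) (Deg-⊖ (low Deg-const)))
          (Deg-⊖ (Deg-⊗ (Deg-const {γ}) (Deg-⊗ (Deg-const {half}) (lin↑-degree t r) ℕₚ.≤-refl) ℕₚ.≤-refl)))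
          (Deg-⊖ (Deg-D (Deg-mono (ℕₚ.m≤n⇒m≤1+n (ℕₚ.n≤1+n r)) Δ-degree)))
          where
          low : ∀ {P} → Deg P 1 → Deg P (suc r)
          low = Deg-mono (ℕ.s≤s ℕ.z≤n)

        H-top : H r ≡ - (half * γ)
        H-top = trans (cong₂ _+_ (cong₂ _+_ (cong₂ _+_ (cong₂ _+_ (Deg-const r 1≤r) (Deg-const r 1≤r)) (cong -_ (Deg-const r 1≤r)))
            (cong -_ (trans (const-⊗ γ (const half ⊗ u) r) (cong (γ *_) (trans (const-⊗ half u r) (cong (half *_) (lin↑-top t r)))))))
            (cong -_ (zeroed (inj₂ (Δ-degree (suc r) (ℕₚ.n≤1+n r))))))
          (solve 2 (λ k γ → :0 :+ :0 :+ :- :0 :+ :- (γ :* (k :* :1)) :+ :- :0 := :- (k :* γ)) refl half γ)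

        abstract
          -- If Δ had degree i < r, the residual would have the coefficient -γ (r + 1 + i) Δ i at i
          -- + r. Since r + 1 + i < q this is nonzero. The terms in B and a stay out of the way
          -- because i + r ≥ 2.
          Δ≈0 : Δ ≈ 0S
          Δ≈0 = go (zero-or-top r Δ-degree)
            where
            F⊗DΔ : ∀ i → Deg Δ (suc i) → (F ⊗ D Δ) (i ℕ.+ r) ≡ γ * (ι i * Δ i)
            F⊗DΔ zero hΔ = trans (⊗-zero-at F (D Δ) r (λ x y _ → zeroed (inj₂ (zeroed (inj₂ (hΔ (suc y) (ℕ.s≤s ℕ.z≤n)))))))
              (solve 2 (λ g z → :0 := g :* (:0 :* z)) refl γ (Δ 0))
            F⊗DΔ (suc i) hΔ = trans (cong (F ⊗ D Δ) (cong suc (ℕₚ.+-comm i r)))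
              (trans (⊗-top {F} {D Δ} {suc r} {i} F-degree (Deg-D hΔ)) (cong (_* D Δ i) F-top))
            go : Δ ≈ 0S ⊎ (∃ λ i → i ℕ.< r × Δ i ≢ 0# × Deg Δ (suc i)) → Δ ≈ 0S
            go (inj₁ z) = z
            go (inj₂ (i , i<r , Δi≢0 , hΔ)) = contradiction top (*≢0 γ≢0 (*≢0 (ι≢0 (ℕ.s≤s ℕ.z≤n) index<q) Δi≢0))
              where
              index<q : suc r ℕ.+ i ℕ.< q
              index<q = ℕₚ.≤-trans (ℕ.s≤s (ℕₚ.+-monoʳ-< r i<r)) (ℕₚ.≤-reflexive (sym q≡2r+1))
              2≤i+r : 2 ℕ.≤ i ℕ.+ r
              2≤i+r = ℕₚ.≤-trans 2≤r (ℕₚ.m≤n+m r i)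
              top : γ * (ι (suc r ℕ.+ i) * Δ i) ≡ 0#
              top = begin
                γ * (ι (suc r ℕ.+ i) * Δ i)
                  ≡⟨ cong (λ z → γ * (z * Δ i)) (ι-+ (suc r) i) ⟩
                γ * ((half + ι i) * Δ i)
                  ≡⟨ solve 4 (λ γ k n x → γ :* ((k :+ n) :* x) := :- (:0 :+ :- :0 :+ x :* :- (k :* γ) :+ :- (γ :* (n :* x)))) refl γ half (ι i) (Δ i) ⟩
                - (0# + - 0# + Δ i * - (half * γ) + - (γ * (ι i * Δ i)))
                  ≡⟨ cong -_ (cong₂ _+_ (cong₂ _+_ (cong₂ _+_
                       (sym (trans (const-⊗ B Y (i ℕ.+ r)) (zeroed (inj₂ (Deg-lin {t} (i ℕ.+ r) 2≤i+r)))))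
                       (cong -_ (sym (trans (const-⊗ a (const (T + t)) (i ℕ.+ r)) (zeroed (inj₂ (Deg-const (i ℕ.+ r) (ℕₚ.<⇒≤ 2≤i+r))))))))
                       (sym (trans (⊗-top {Δ} {H} hΔ H-degree) (cong (Δ i *_) H-top))))
                       (cong -_ (sym (F⊗DΔ i hΔ)))) ⟩
                - (const B ⊗ Y ⊕ ⊖ (const a ⊗ const (T + t)) ⊕ Δ ⊗ H ⊕ ⊖ (F ⊗ D Δ)) (i ℕ.+ r)
                  ≡⟨ trans (cong -_ (at residual (i ℕ.+ r))) -0≡0 ⟩
                0# ∎
                where open ≡-Reasoning

          remainder : const B ⊗ Y ≈ const a ⊗ const (T + t)
          remainder = begin
            const B ⊗ Y
              ≈⟨ solveS 4 (λ b a x y → b ⩴ (b ⊞ ⊟ a ⊞ x ⊞ ⊟ y) ⊞ (a ⊟ x ⊞ y)) S.refl (const B ⊗ Y) (const a ⊗ const (T + t)) (Δ ⊗ H) (F ⊗ D Δ) ⟩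
            _ ⊕ (const a ⊗ const (T + t) ⊕ ⊖ (Δ ⊗ H) ⊕ F ⊗ D Δ)
              ≈⟨ S.+-cong residual (S.+-cong (S.+-congˡ (S.-‿cong (S.trans (S.*-congʳ Δ≈0) (S.zeroˡ H))))
                   (S.trans (S.*-congˡ (S.trans (D-cong Δ≈0) (pointwise λ i → zeroʳ _))) (S.zeroʳ F))) ⟩
            0S ⊕ (const a ⊗ const (T + t) ⊕ ⊖ 0S ⊕ 0S)
              ≈⟨ solveS 1 (λ x → 𝟘 ⊞ (x ⊞ ⊟ 𝟘 ⊞ 𝟘) ⩴ x) S.refl _ ⟩
            const a ⊗ const (T + t) ∎
            where open ≈-Reasoning

          B≡0 : B ≡ 0#
          B≡0 = trans (sym (trans (cong (B *_) (lin-one t)) (*-identityʳ B)))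
            (trans (sym (const-⊗ B Y 1)) (trans (at remainder 1) (trans (const-⊗ a (const (T + t)) 1) (zeroʳ a))))

          T≡-t : T ≡ - t
          T≡-t = go (*≡0 (trans (sym (at remainder 0)) (zeroed (inj₁ B≡0))))
            where
            go : a ≡ 0# ⊎ T + t ≡ 0# → T ≡ - t
            go (inj₁ a≡0) = contradiction a≡0 a≢0
            go (inj₂ e) = -≡0 (trans (cong (T +_) (solve 1 (λ t → :- (:- t) := t) refl t)) e)

          h-factor : g ≡ 1# → h ≈ Y ↑ suc r ⊗ (u ⊕ ⊖ const γ)
          h-factor g≡1 = begin
            h
              ≈⟨ solveS 3 (λ h f F → h ⩴ (f ⊟ (f ⊟ h ⊟ F)) ⊟ F) S.refl h Φ F ⟩
            (Φ ⊕ ⊖ Δ) ⊕ ⊖ F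
              ≈⟨ S.+-cong (S.+-cong Φ-shift (S.-‿cong Δ≈0)) (S.-‿cong (S.+-congˡ (S.trans (S.*-congʳ (S.reflexive (cong const g≡1))) (S.*-identityˡ Y)))) ⟩
            ((Y ⊗ (u ⊗ u) ⊕ const T ⊕ (Y ⊕ const t)) ⊕ ⊖ 0S) ⊕ ⊖ (const γ ⊗ (Y ⊗ u) ⊕ Y)
              ≈⟨ solveS 5 (λ y u T t γ → ((y ⊠ (u ⊠ u) ⊞ T ⊞ (y ⊞ t)) ⊞ ⊟ 𝟘) ⊞ ⊟ (γ ⊠ (y ⊠ u) ⊞ y) ⩴ (T ⊞ t) ⊞ (y ⊠ u) ⊠ (u ⊞ ⊟ γ)) S.refl Y u (const T) (const t) (const γ) ⟩
            (const T ⊕ const t) ⊕ (Y ⊗ u) ⊗ (u ⊕ ⊖ const γ)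
              ≈⟨ S.trans (S.+-congʳ (S.trans (const-+ T t) (const-zero (trans (cong (_+ t) T≡-t) (-‿inverseˡ t))))) (S.+-identityˡ _) ⟩
            (Y ⊗ u) ⊗ (u ⊕ ⊖ const γ) ∎
            where open ≈-Reasoning

          -- B = 0 leaves g = 1 or g = a. By (1 + 1/2) g = 1 + a these mean a = 1/2 and a = 2, and
          -- γ² = -2a turns them into γ² = -1 and γ² = -4.
          typeA-or-B : TypeA d ⊎ TypeB d
          typeA-or-B = go (*≡0 B≡0)
            where
            open ≡-Reasoning
            halved : ∀ {x} → x ≡ two * (half * x)
            halved {x} = trans (sym (*-identityˡ x)) (trans (cong (_* x) (sym half+half))
              (solve 2 (λ k x → (k :+ k) :* x := (:1 :+ :1) :* (k :* x)) refl half x))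
            γ²≡ : γ * γ ≡ - (two * a)
            γ²≡ = trans halved (trans (solve 1 (λ z → (:1 :+ :1) :* z := :- ((:1 :+ :1) :* :- z)) refl (half * (γ * γ)))
              (cong (λ z → - (two * z)) (sym a≡)))
            go : 1# - g ≡ 0# ⊎ g - a ≡ 0# → TypeA d ⊎ TypeB d
            go (inj₁ e) = inj₂ (record { γ = γ ; t = t ; conj-t = T≡-t ; factor = h-factor (sym (-≡0 e)) ; γ² = begin
              γ * γ                  ≡⟨ γ²≡ ⟩
              - (two * a)            ≡⟨ cong (λ z → - (two * z)) a≡half ⟩
              - (two * half)         ≡⟨ solve 1 (λ k → :- ((:1 :+ :1) :* k) := :- (k :+ k)) refl half ⟩
              - (half + half)        ≡⟨ cong -_ half+half ⟩
              - 1#                   ∎ })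
              where
              a≡half : a ≡ half
              a≡half = begin
                a                      ≡⟨ solve 1 (λ a → a := (:1 :+ a) :- :1) refl a ⟩
                (1# + a) - 1#          ≡⟨ cong (_- 1#) (sym g-equation) ⟩
                (1# + half) * g - 1#   ≡⟨ cong (λ z → (1# + half) * z - 1#) (sym (-≡0 e)) ⟩
                (1# + half) * 1# - 1#  ≡⟨ solve 1 (λ k → (:1 :+ k) :* :1 :- :1 := k) refl half ⟩
                half                   ∎
            go (inj₂ e) = inj₁ (begin
              h (suc r) * h (suc r)  ≡⟨ cong₂ _*_ h-middle h-middle ⟩
              - γ * - γ              ≡⟨ solve 1 (λ g → :- g :* :- g := g :* g) refl γ ⟩
              γ * γ                  ≡⟨ γ²≡ ⟩
              - (two * a)            ≡⟨ cong (λ z → - (two * z)) a≡two ⟩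
              - (two * two)          ≡⟨ solve 0 (:- ((:1 :+ :1) :* (:1 :+ :1)) := :- ((:1 :+ :1) :+ (:1 :+ :1))) refl ⟩
              - four                 ∎)
              where
              a≡two : a ≡ two
              a≡two = begin
                a                                       ≡⟨ halved ⟩
                two * (half * a)                        ≡⟨ cong (two *_) (solve 2 (λ k a → k :* a := (:1 :+ k) :* a :- a) refl half a) ⟩
                two * ((1# + half) * a - a)             ≡⟨ cong (λ z → two * ((1# + half) * z - a)) (sym (-≡0 e)) ⟩
                two * ((1# + half) * g - a)             ≡⟨ cong (λ z → two * (z - a)) g-equation ⟩
                two * ((1# + a) - a)                    ≡⟨ solve 1 (λ a → (:1 :+ :1) :* ((:1 :+ a) :- a) := :1 :+ :1) refl a ⟩
                two                                     ∎

-- Two directions with a line through more than half of the clique.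

module TwoAxes (𝕂 : Setting) (q≡p : Setting.q 𝕂 ≡ Setting.p 𝕂)
  (r : ℕ) (Γ : Graph 𝕂 (suc (suc r))) (C : Clique 𝕂 Γ) where
  open PrimeDirections 𝕂 q≡p r Γ C public
  open Construction 𝕂 using (|Fq|≡q)

  module _ (all-determined : AllDetermined) (not-collinear : NotCollinear) (q≡2r+1 : q ≡ suc (r ℕ.+ r)) (2≤r : 2 ℕ.≤ r) where
    open Main all-determined not-collinear
    open Bound all-determined not-collinear
    open Classification q≡2r+1 2≤r

    middle : Carrier → Carrier
    middle d = prod (values d) (suc r)

    -- Undetermined directions have middle coefficient 0, and those of type A satisfy the second
    -- condition, so a direction that fails both is of type B.
    Tame : Carrier → Set
    Tame d = middle d ≡ 0# ⊎ TypeA d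

    tame? : ∀ d → Dec (Tame d)
    tame? d = (middle d ≟ 0#) ⊎-dec ((middle d * middle d) ≟ (- four))

    abstract
      middle-undetermined : ∀ {d} → Undetermined d → middle d ≡ 0#
      middle-undetermined und = trans (at (prod-undetermined und) (suc r))
        (Φ-gap (λ e → ℕₚ.>⇒≢ 1≤r (ℕₚ.suc-injective e)) (ℕₚ.<⇒≢ r+1<q))

    -- The middle coefficient E of h along the pencil e + d y is a polynomial of degree r in y. If no
    -- h has type B then E³ + 4E vanishes on 𝔽_q, say E³ + 4E = (Y^q − Y) J. Differentiating gives
    -- 4E′ = −J at the zeros of E and 8E′ = J at the other points, hence 12E′ = 0.
    module NoTypeB (d e : Carrier) (det : Determined d) (ed≢0 : form e d ≢ 0#)
      (tame : ∀ {y} → y ∈ Fq → Tame (e + d * y)) where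
      open Pencil d e ed≢0

      E : Ser
      E = coeffY pairs (suc r)

      E-degree : Deg E (suc r)
      E-degree j r<j = coeffY-degree pairs (suc r) j (ℕₚ.≤-trans (ℕₚ.≤-reflexive (cong suc (trans length-pairs q≡2r+1)))
        (ℕₚ.≤-trans (ℕ.s≤s (ℕₚ.≤-reflexive (sym (ℕₚ.+-suc r r)))) (ℕ.s≤s (ℕₚ.+-monoʳ-≤ r r<j))))

      E-top : E r ≢ 0#
      E-top Er≡0 = Shape.γ≢0 det (neg≡0 (trans (sym (Shape.h-middle det)) (trans (cong (λ l → prod l (suc r)) (sym values-pairs∞))
        (trans (sym (coeffY-top pairs (suc r) r (trans (sym q≡2r+1) (sym length-pairs)))) Er≡0))))

      E-value : ∀ {y} → y ∈ Fq → Ev E y (middle (e + d * y))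
      E-value {y} y∈ = Ev-value (cong (λ l → prod l (suc r)) (values-pairs (∈Fq⁻ y∈))) (Ev-coeffY pairs (suc r) y)

      four₁ : Ser
      four₁ = const four

      V W : Ser
      V = X ↑ q ⊕ ⊖ X
      W = E ⊗ (E ⊗ E ⊕ four₁)

      W-degree : Deg W (suc (r ℕ.+ (r ℕ.+ r)))
      W-degree = Deg-⊗ E-degree (Deg-⊕ (Deg-⊗ E-degree E-degree (ℕₚ.≤-reflexive (cong suc (ℕₚ.+-suc r r)))) (Deg-mono (ℕ.s≤s ℕ.z≤n) Deg-const))
        (ℕₚ.≤-reflexive (cong suc (ℕₚ.+-suc r (r ℕ.+ r))))

      W-root : ∀ {y} → y ∈ Fq → Ev W y 0#
      W-root {y} y∈ = Ev-value (vanish (tame y∈)) (Ev-⊗ (E-value y∈) (Ev-⊕ (Ev-⊗ (E-value y∈) (E-value y∈)) (Ev-const four)))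
        where
        vanish : Tame (e + d * y) → middle (e + d * y) * (middle (e + d * y) * middle (e + d * y) + four) ≡ 0#
        vanish (inj₁ z) = zeroed (inj₁ z)
        vanish (inj₂ z) = zeroed (inj₂ (trans (cong (_+ four) z) (-‿inverseˡ four)))

      abstract
        quotient : ∃ λ J → Deg J r × W ≈ V ⊗ J
        quotient = go (factor-roots {W} {r} Fq Fq-unique (All.tabulate W-root) (Deg-mono (ℕₚ.≤-reflexive size) W-degree))
          where
          size : suc (r ℕ.+ (r ℕ.+ r)) ≡ length Fq ℕ.+ r
          size = trans (cong suc (ℕₚ.+-comm r (r ℕ.+ r))) (cong (ℕ._+ r) (sym (trans |Fq|≡q q≡2r+1)))
          V≈ : V ≈ prod Fq
          V≈ = monic-prod Fq Fq-unique
            (All.map (λ {y} fy → Ev-value (trans (cong (_- y) fy) (-self y)) (Ev-⊕ (Ev-↑ q Ev-X) (Ev-⊖ Ev-X))) Fq-fixed)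
            (subst (λ l → Deg V (suc l)) (sym |Fq|≡q) (Deg-⊕ (Deg-X↑ q) (Deg-⊖ (Deg-mono (ℕ.s≤s (ℕₚ.<⇒≤ 1<q)) Deg-X))))
            (subst (λ l → V l ≡ 1#) (sym |Fq|≡q) (trans (cong₂ _-_ (X↑-top q) (X-other q≢1)) (sub-zero 1#)))
          go : (∃ λ J → Deg J r × W ≈ prod Fq ⊗ J) → ∃ λ J → Deg J r × W ≈ V ⊗ J
          go (J , hJ , eJ) = J , hJ , S.trans eJ (S.*-congʳ (S.sym V≈))

      J E′ : Ser
      J = proj₁ quotient
      E′ = D E

      J-degree : Deg J r
      J-degree = proj₁ (proj₂ quotient)

      E′-degree : Deg E′ r
      E′-degree = Deg-D E-degree

      DV≈ : D V ≈ ⊖ 1S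
      DV≈ = begin
        D (X ↑ q ⊕ ⊖ X)       ≈⟨ D-cong (solveS 2 (λ a x → a ⊟ x ⩴ (a ⊞ x) ⊟ (x ⊞ x)) S.refl (X ↑ q) X) ⟩
        D (Φ ⊕ ⊖ (X ⊕ X))     ≈⟨ S.trans (D-⊕ Φ (⊖ (X ⊕ X))) (S.+-cong D-Φ (S.trans (D-⊖ (X ⊕ X)) (S.-‿cong (S.trans (D-⊕ X X) (S.+-cong D-X D-X))))) ⟩
        1S ⊕ ⊖ (1S ⊕ 1S)      ≈⟨ solveS 0 (𝟙 ⊟ (𝟙 ⊞ 𝟙) ⩴ ⊟ 𝟙) S.refl ⟩
        ⊖ 1S                  ∎
        where open ≈-Reasoning

      abstract
        derivatives : E′ ⊗ (E ⊗ E ⊕ four₁) ⊕ E ⊗ (E′ ⊗ E ⊕ E ⊗ E′) ≈ ⊖ 1S ⊗ J ⊕ V ⊗ D J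
        derivatives = begin
          E′ ⊗ (E ⊗ E ⊕ four₁) ⊕ E ⊗ (E′ ⊗ E ⊕ E ⊗ E′)
            ≈⟨ S.+-congˡ (S.*-congˡ (S.sym (S.trans (D-⊕ (E ⊗ E) four₁) (S.trans (S.+-cong (D-⊗ E E) (D-const four)) (S.+-identityʳ _))))) ⟩
          E′ ⊗ (E ⊗ E ⊕ four₁) ⊕ E ⊗ D (E ⊗ E ⊕ four₁)   ≈⟨ D-⊗ E (E ⊗ E ⊕ four₁) ⟨
          D W                                            ≈⟨ D-cong (proj₂ (proj₂ quotient)) ⟩
          D (V ⊗ J)                                      ≈⟨ S.trans (D-⊗ V J) (S.+-congʳ (S.*-congʳ DV≈)) ⟩
          ⊖ 1S ⊗ J ⊕ V ⊗ D J                             ∎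
          where open ≈-Reasoning

        pointwise-derivative : ∀ {y} → y ∈ Fq →
          (three * (middle (e + d * y) * middle (e + d * y)) + four) * ev r E′ y + ev r J y ≡ 0#
        pointwise-derivative {y} y∈ = begin
          (three * (ε * ε) + four) * ε′ + j
            ≡⟨ solve 4 (λ ε ε′ j f → ((:1 :+ (:1 :+ :1)) :* (ε :* ε) :+ f) :* ε′ :+ j
                 := ε′ :* (ε :* ε :+ f) :+ ε :* (ε′ :* ε :+ ε :* ε′) :+ j) refl ε ε′ j four ⟩
          ε′ * (ε * ε + four) + ε * (ε′ * ε + ε * ε′) + j
            ≡⟨ cong (_+ j) (Ev-unique derivatives
                 (Ev-⊕ (Ev-⊗ EE′ (Ev-⊕ (Ev-⊗ EE EE) (Ev-const four))) (Ev-⊗ EE (Ev-⊕ (Ev-⊗ EE′ EE) (Ev-⊗ EE EE′))))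
                 (Ev-⊕ (Ev-⊗ (Ev-⊖ (Ev-const 1#)) EJ) (Ev-⊗ (Ev-⊕ (Ev-↑ q Ev-X) (Ev-⊖ Ev-X)) (Ev-total (proj₂ (Finite-D (r , J-degree))))))) ⟩
          (- 1# * j + (conj y - y) * j′) + j
            ≡⟨ cong (λ z → (- 1# * j + z * j′) + j) (trans (cong (_- y) (∈Fq⁻ y∈)) (-self y)) ⟩
          (- 1# * j + 0# * j′) + j
            ≡⟨ solve 2 (λ j j′ → (:- :1 :* j :+ :0 :* j′) :+ j := :0) refl j j′ ⟩
          0# ∎
          where
          open ≡-Reasoning
          ε ε′ j j′ : Carrier
          ε = middle (e + d * y)
          ε′ = ev r E′ y
          j = ev r J y
          j′ = ev (proj₁ (Finite-D (r , J-degree))) (D J) y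
          EE : Ev E y ε
          EE = E-value y∈
          EE′ : Ev E′ y ε′
          EE′ = Ev-total E′-degree
          EJ : Ev J y j
          EJ = Ev-total J-degree

      nonzeros : List Carrier
      nonzeros = filter (λ y → ¬? (middle (e + d * y) ≟ 0#)) Fq

      abstract
        many-nonzeros : r ℕ.≤ length nonzeros
        many-nonzeros = ℕₚ.+-cancelˡ-≤ r r (length nonzeros) (ℕₚ.≤-trans (ℕₚ.n≤1+n (r ℕ.+ r))
          (ℕₚ.≤-trans (ℕₚ.≤-reflexive (sym (trans |Fq|≡q q≡2r+1)))
            (ℕₚ.≤-trans (ℕₚ.≤-reflexive (sym (length-filter-¬ zero? Fq))) (ℕₚ.+-monoˡ-≤ (length nonzeros) few))))
          where
          zero? : ∀ y → Dec (middle (e + d * y) ≡ 0#)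
          zero? y = middle (e + d * y) ≟ 0#
          few : length (filter zero? Fq) ℕ.≤ r
          few = root-bound {E} {r} {r} (filter zero? Fq) (Unique.filter⁺ zero? Fq-unique)
            (All.tabulate (λ y∈ → Ev-value (proj₂ (∈-filter⁻ zero? {xs = Fq} y∈)) (E-value (proj₁ (∈-filter⁻ zero? {xs = Fq} y∈))))) E-degree E-top

        4E′+J≈0 : four₁ ⊗ E′ ⊕ J ≈ 0S
        4E′+J≈0 = too-many-roots good good-unique (All.tabulate root)
          (Deg-⊕ (Deg-⊗ (Deg-const {four}) E′-degree ℕₚ.≤-refl) J-degree)
          (ℕₚ.+-cancelˡ-≤ (suc r) r (length good) (ℕₚ.≤-trans (ℕₚ.≤-reflexive (sym q≡2r+1)) (many-good det)))
          where
          root : ∀ {y} → y ∈ good → Ev (four₁ ⊗ E′ ⊕ J) y 0#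
          root {y} y∈ = Ev-value (trans (cong (_+ ev r J y) (cong (_* ev r E′ y)
              (trans (solve 1 (λ f → f := (:1 :+ (:1 :+ :1)) :* (:0 :* :0) :+ f) refl four)
                (cong (λ z → three * (z * z) + four) (sym (middle-undetermined (proj₂ (good-undetermined y∈))))))))
              (pointwise-derivative (∈Fq (proj₁ (good-undetermined y∈)))))
            (Ev-⊕ (Ev-⊗ (Ev-const four) (Ev-total E′-degree)) (Ev-total J-degree))

        8E′-J≈0 : const (four + four) ⊗ E′ ⊕ ⊖ J ≈ 0S
        8E′-J≈0 = too-many-roots nonzeros (Unique.filter⁺ (λ y → ¬? (middle (e + d * y) ≟ 0#)) Fq-unique) (All.tabulate root)
          (Deg-⊕ (Deg-⊗ (Deg-const {four + four}) E′-degree ℕₚ.≤-refl) (Deg-⊖ J-degree)) many-nonzeros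
          where
          square : ∀ {y} → y ∈ nonzeros → middle (e + d * y) * middle (e + d * y) ≡ - four
          square {y} y∈ = go (tame (proj₁ split)) (proj₂ split)
            where
            split : y ∈ Fq × ¬ (middle (e + d * y) ≡ 0#)
            split = ∈-filter⁻ (λ y → ¬? (middle (e + d * y) ≟ 0#)) {xs = Fq} y∈
            go : ∀ {y} → Tame (e + d * y) → ¬ (middle (e + d * y) ≡ 0#) → middle (e + d * y) * middle (e + d * y) ≡ - four
            go (inj₁ z) ne = contradiction z ne
            go (inj₂ z) _ = z
          root : ∀ {y} → y ∈ nonzeros → Ev (const (four + four) ⊗ E′ ⊕ ⊖ J) y 0#
          root {y} y∈ = Ev-value (trans (solve 2 (λ ε′ j → let o = :1 ; f = (o :+ o) :+ (o :+ o) in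
                (f :+ f) :* ε′ :+ :- j := :- (((o :+ (o :+ o)) :* :- f :+ f) :* ε′ :+ j)) refl (ev r E′ y) (ev r J y))
              (trans (cong (λ z → - ((three * z + four) * ev r E′ y + ev r J y)) (sym (square y∈)))
                (trans (cong -_ (pointwise-derivative (proj₁ (∈-filter⁻ (λ y → ¬? (middle (e + d * y) ≟ 0#)) {xs = Fq} y∈)))) -0≡0)))
            (Ev-⊕ (Ev-⊗ (Ev-const (four + four)) (Ev-total E′-degree)) (Ev-⊖ (Ev-total J-degree)))

        -- Adding the two identities cancels J. The coefficient of 12 E′ in degree r - 1 is 12 r
        -- times the leading coefficient of E, and q ≥ 5 is prime, so no factor vanishes.
        impossible : ⊥
        impossible = go r 1≤r refl
          where
          go : ∀ r′ → 1 ℕ.≤ r′ → r ≡ r′ → ⊥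
          go (suc r′) _ e = *≢0 twelve≢0 (*≢0 (ι≢0 (ℕ.s≤s ℕ.z≤n) (subst (ℕ._< q) e r<q)) (subst (λ i → E i ≢ 0#) e E-top)) (begin
            (four + (four + four)) * E′ r′
              ≡⟨ solve 3 (λ f x j → (f :+ (f :+ f)) :* x := (f :* x :+ j) :+ ((f :+ f) :* x :- j)) refl four (E′ r′) (J r′) ⟩
            (four * E′ r′ + J r′) + ((four + four) * E′ r′ - J r′)
              ≡⟨ cong₂ _+_ (trans (cong (_+ J r′) (sym (const-⊗ four E′ r′))) (at 4E′+J≈0 r′))
                           (trans (cong (_- J r′) (sym (const-⊗ (four + four) E′ r′))) (at 8E′-J≈0 r′)) ⟩
            0# + 0#
              ≡⟨ +-identityˡ 0# ⟩
            0# ∎)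
            where
            open ≡-Reasoning
            4<q : 4 ℕ.< q
            4<q = ℕₚ.≤-trans (ℕ.s≤s (ℕₚ.+-mono-≤ 2≤r 2≤r)) (ℕₚ.≤-reflexive (sym q≡2r+1))
            twelve≢0 : four + (four + four) ≢ 0#
            twelve≢0 z = *≢0 (*≢0 ι2≢0 ι2≢0) (ι≢0 {3} (ℕ.s≤s ℕ.z≤n) (ℕₚ.<-trans (ℕₚ.n<1+n 3) 4<q))
              (trans (solve 0 (let o = :1 ; z = :0 ; f = (o :+ o) :+ (o :+ o) in
                (o :+ (o :+ z)) :* (o :+ (o :+ z)) :* (o :+ (o :+ (o :+ z))) := f :+ (f :+ f)) refl) z)
              where
              ι2≢0 : ι 2 ≢ 0#
              ι2≢0 = ι≢0 (ℕ.s≤s ℕ.z≤n) (ℕₚ.<-trans (ℕₚ.<-trans (ℕₚ.n<1+n 2) (ℕₚ.n<1+n 3)) 4<q)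

    abstract
      -- By `NoTypeB` some member of the pencil e + d y is not tame. It belongs to the graph, since
      -- its middle coefficient is nonzero, and it is not parallel to d, which is the point at
      -- infinity of the pencil.
      other-typeB : ∀ {d e} → Determined d → form e d ≢ 0# → ∃ λ d′ → Determined d′ × TypeB d′ × form d′ d ≢ 0#
      other-typeB {d} {e} det ed≢0 = go (All.all? (λ y → tame? (e + d * y)) Fq)
        where
        go : Dec (All (λ y → Tame (e + d * y)) Fq) → ∃ λ d′ → Determined d′ × TypeB d′ × form d′ d ≢ 0#
        go (yes tame) = contradiction (NoTypeB.impossible d e det ed≢0 (All.lookup tame)) λ ()
        go (no ¬tame) = witness (find (All.¬All⇒Any¬ (λ y → tame? (e + d * y)) Fq ¬tame))
          where
          witness : (∃ λ y → y ∈ Fq × ¬ Tame (e + d * y)) → ∃ λ d′ → Determined d′ × TypeB d′ × form d′ d ≢ 0#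
          witness (y , y∈ , wild) = w , det′ (Fin.any? (λ k → form (c k) w ≟ 0#)) , typeB (Shape.typeA-or-B (det′ (Fin.any? (λ k → form (c k) w ≟ 0#)))) , wd≢0
            where
            w : Carrier
            w = e + d * y
            dw : form d w ≡ form d e
            dw = trans (form-combineʳ d e d (∈Fq⁻ y∈)) (trans (cong (form d e +_) (zeroed (inj₁ (form-alternating d)))) (+-identityʳ _))
            wd≢0 : form w d ≢ 0#
            wd≢0 z = ed≢0 (form-flip (trans (sym dw) (trans (form-antisymmetric d w) (trans (cong -_ z) -0≡0))))
            w≢0 : w ≢ 0#
            w≢0 z = wd≢0 (trans (cong (λ t → form t d) z) (trans (cong (λ t → 0# * conj d - t * d) conj-0)
              (solve 2 (λ d d′ → :0 :* d′ :- :0 :* d := :0) refl d (conj d))))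
            det′ : Dec (∃ λ k → form (c k) w ≡ 0#) → Determined w
            det′ (yes (k , e)) = determined w≢0 k e
            det′ (no und) = contradiction (inj₁ (middle-undetermined (λ k e → und (k , e)))) wild
            typeB : TypeA w ⊎ TypeB w → TypeB w
            typeB (inj₁ A) = contradiction (inj₂ A) wild
            typeB (inj₂ B) = B

      -- The pencil is used twice: the direction of type B found first is placed at infinity to
      -- obtain a second one that is not parallel to it.
      two-typeB : ∃ λ d₁ → ∃ λ d₂ → TypeB d₁ × TypeB d₂ × form d₂ d₁ ≢ 0#
      two-typeB = first (other-typeB det₀ (independent {suc zero} {zero} λ ()))
        where
        det₀ : Determined (c zero)
        det₀ = determined (nonzero zero) zero (form-alternating (c zero))
        swap : ∀ {a b} → form a b ≢ 0# → form b a ≢ 0#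
        swap {a} {b} ne z = ne (form-flip z)
        first : (∃ λ d′ → Determined d′ × TypeB d′ × form d′ (c zero) ≢ 0#) → ∃ λ d₁ → ∃ λ d₂ → TypeB d₁ × TypeB d₂ × form d₂ d₁ ≢ 0#
        first (d₁ , det₁ , B₁ , ne) = second (other-typeB det₁ (swap ne))
          where
          second : (∃ λ d′ → Determined d′ × TypeB d′ × form d′ d₁ ≢ 0#) → ∃ λ d₁ → ∃ λ d₂ → TypeB d₁ × TypeB d₂ × form d₂ d₁ ≢ 0#
          second (d₂ , _ , B₂ , ne₂) = d₁ , d₂ , B₁ , B₂ , ne₂

-- Two lines with at least k + 1 points each and at most one point in common cover 2 (k + 1) - 1 =
-- 2k + 1 points, which is everything.
two-large-filters : ∀ {A : Set} {P Q : A → Set} (P? : Decidable P) (Q? : Decidable Q) L k → Unique L → length L ℕ.≤ suc (k ℕ.+ k) →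
  suc k ℕ.≤ length (filter P? L) → suc k ℕ.≤ length (filter Q? L) →
  (∀ x y → P x → Q x → P y → Q y → x ≡ y) → ∀ x → x ∈ L → P x ⊎ Q x
two-large-filters {P = P} {Q} P? Q? L k uL L≤ kP kQ once x x∈ with P? x | Q? x
... | yes px | _ = inj₁ px
... | no _ | yes qx = inj₂ qx
... | no ¬px | no ¬qx = contradiction (∈-nonempty x∈rest′) (ℕₚ.<⇒≱ (ℕ.s≤s empty))
  where
  A : List _
  A = filter P? L
  rest : List _
  rest = filter (λ z → ¬? (P? z)) L
  rest≤ : length rest ℕ.≤ k
  rest≤ = ℕₚ.+-cancelˡ-≤ (suc k) (length rest) k (ℕₚ.≤-trans (ℕₚ.+-monoˡ-≤ (length rest) kP)
    (ℕₚ.≤-trans (ℕₚ.≤-reflexive (length-filter-¬ P? L)) L≤))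
  common : length (filter Q? A) ℕ.≤ 1
  common = length-filter-unique Q? A (Unique.filter⁺ P? uL)
    (λ y z y∈ z∈ qy qz → once y z (proj₂ (∈-filter⁻ P? {xs = L} y∈)) qy (proj₂ (∈-filter⁻ P? {xs = L} z∈)) qz)
  k≤ : k ℕ.≤ length (filter Q? rest)
  k≤ = ℕₚ.≤-pred (ℕₚ.≤-trans kQ (ℕₚ.≤-trans (ℕₚ.≤-reflexive (filter-split Q? P? L)) (ℕₚ.+-monoˡ-≤ _ common)))
  empty : length (filter (λ z → ¬? (Q? z)) rest) ℕ.≤ 0
  empty = ℕₚ.+-cancelˡ-≤ k _ 0 (ℕₚ.≤-trans (ℕₚ.+-monoˡ-≤ _ k≤) (ℕₚ.≤-trans (ℕₚ.≤-reflexive (length-filter-¬ Q? rest))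
    (ℕₚ.≤-trans rest≤ (ℕₚ.≤-reflexive (sym (ℕₚ.+-identityʳ k))))))
  x∈rest′ : x ∈ filter (λ z → ¬? (Q? z)) rest
  x∈rest′ = ∈-filter⁺ (λ z → ¬? (Q? z)) (∈-filter⁺ (λ z → ¬? (P? z)) x∈ ¬px) ¬qx

-- The normal form of the set of directions.

module NormalForm (𝕂 : Setting) {m : ℕ} (Γ : Graph 𝕂 m) (k : ℕ) where
  open QuadraticField 𝕂
  open PeisertData Γ

  -- In the coordinates w ↦ (form w d₁, form w d₂) the directions are the two axes and the slopes that are squares.
  OnNormal : Carrier → Carrier → Carrier → Set
  OnNormal d₁ d₂ w = form w d₁ ≡ 0# ⊎ form w d₂ ≡ 0# ⊎ form w d₂ ^ k ≡ form w d₁ ^ k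

  Normal : Carrier → Carrier → Set
  Normal d₁ d₂ = form d₂ d₁ ≢ 0# × (∀ j → OnNormal d₁ d₂ (c j))

  normal? : ∀ d₁ d₂ → Dec (Normal d₁ d₂)
  normal? d₁ d₂ = ¬? (form d₂ d₁ ≟ 0#) ×-dec Fin.all? (λ j → (form (c j) d₁ ≟ 0#) ⊎-dec (form (c j) d₂ ≟ 0#) ⊎-dec ((form (c j) d₂ ^ k) ≟ (form (c j) d₁ ^ k)))

  HasNormalForm : Set
  HasNormalForm = ∃ λ d₁ → ∃ λ d₂ → Normal d₁ d₂

  abstract
    -- Decidability is what `from-non-strict` asks for, since non-strictness alone exhibits no
    -- clique.
    hasNormalForm? : Dec HasNormalForm
    hasNormalForm? = over (λ d₁ → over (normal? d₁))
      where
      over : ∀ {P : Carrier → Set} → Decidable P → Dec (∃ P)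
      over {P} P? with Fin.any? (λ i → P? (element i))
      ... | yes (i , h) = yes (element i , h)
      ... | no none = no λ { (x , h) → none (Inverse.to enum x , subst P (sym (Inverse.strictlyInverseʳ enum x)) h) }
        where open import Function using (Inverse)

module Normalisation (𝕂 : Setting) (q≡p : Setting.q 𝕂 ≡ Setting.p 𝕂)
  (r′ : ℕ) (Γ : Graph 𝕂 (suc (suc (suc r′)))) (C : Clique 𝕂 Γ) where
  r : ℕ
  r = suc r′
  open TwoAxes 𝕂 q≡p r Γ C
  open NormalForm 𝕂 Γ r

  -- The normal form before d₂ is rescaled, with separate constants on the two sides.
  Slope : Carrier → Carrier → Carrier → Carrier → Carrier → Set
  Slope d₁ d₂ α β w = form w d₁ ≡ 0# ⊎ form w d₂ ≡ 0# ⊎ α * form w d₂ ^ r ≡ β * form w d₁ ^ r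

  module _ {d₁ d₂ α β : Carrier} (ne : form d₂ d₁ ≢ 0#) (β≢0 : β ≢ 0#) (slopes : ∀ j → Slope d₁ d₂ α β (c j)) where
    private
      zero-form : ∀ {d} → form d 0# ≡ 0#
      zero-form {d} = trans (cong (λ z → d * z - conj d * 0#) conj-0) (solve 2 (λ d d′ → d :* :0 :- d′ :* :0 := :0) refl d (conj d))

      d₁≢0 : d₁ ≢ 0#
      d₁≢0 refl = ne zero-form

      d₂≢0 : d₂ ≢ 0#
      d₂≢0 refl = ne (form-flip zero-form)

      Axis : Fin m → Set
      Axis j = form (c j) d₁ ≡ 0# ⊎ form (c j) d₂ ≡ 0#

      axis? : ∀ j → Dec (Axis j)
      axis? j = (form (c j) d₁ ≟ 0#) ⊎-dec (form (c j) d₂ ≟ 0#)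

      not-both : ∀ {d i j} → d ≢ 0# → i ≢ j → form (c i) d ≡ 0# → form (c j) d ≢ 0#
      not-both d≢0 i≢j e = parallel-≢ d≢0 e (i≢j ∘ sym)

      -- Distinct directions cannot share an axis, so two axes take up at most two of the first
      -- three directions.
      off-axis : ∃ λ j → ¬ Axis j
      off-axis with axis? zero | axis? (suc zero) | axis? (suc (suc zero))
      ... | no h | _ | _ = zero , h
      ... | yes _ | no h | _ = suc zero , h
      ... | yes _ | yes _ | no h = suc (suc zero) , h
      ... | yes (inj₁ a) | yes (inj₁ b) | yes _ = contradiction b (not-both d₁≢0 (λ ()) a)
      ... | yes (inj₂ a) | yes (inj₂ b) | yes _ = contradiction b (not-both d₂≢0 (λ ()) a)
      ... | yes (inj₁ a) | yes (inj₂ b) | yes (inj₁ e) = contradiction e (not-both d₁≢0 (λ ()) a)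
      ... | yes (inj₁ a) | yes (inj₂ b) | yes (inj₂ e) = contradiction e (not-both d₂≢0 (λ ()) b)
      ... | yes (inj₂ a) | yes (inj₁ b) | yes (inj₁ e) = contradiction e (not-both d₁≢0 (λ ()) b)
      ... | yes (inj₂ a) | yes (inj₁ b) | yes (inj₂ e) = contradiction e (not-both d₂≢0 (λ ()) a)

    abstract
      -- A direction `c j` off the axes fixes the scale: y is chosen so that d₁ and d₂ y have the
      -- same value of the form on it. Its own slope equation then reads α = β yʳ, which removes the
      -- constants from all the other equations.
      normalise : HasNormalForm
      normalise = go off-axis
        where
        go : (∃ λ j → ¬ Axis j) → HasNormalForm
        go (j , off) = d₁ , d₂ * y , (λ z → *≢0 ne y≢0 (trans (sym (form-scaleˡ d₂ d₁ fy)) z)) , λ i → on (slopes i)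
          where
          f₁ f₂ y : Carrier
          f₁ = form (c j) d₁
          f₂ = form (c j) d₂
          f₁≢0 : f₁ ≢ 0#
          f₁≢0 = off ∘ inj₁
          f₂≢0 : f₂ ≢ 0#
          f₂≢0 = off ∘ inj₂
          y = f₁ * inv f₂ f₂≢0
          f₂y : f₂ * y ≡ f₁
          f₂y = trans (solve 3 (λ a b i → b :* (a :* i) := a :* (b :* i)) refl f₁ f₂ _) (trans (cong (f₁ *_) (*-inv f₂ f₂≢0)) (*-identityʳ f₁))
          y≢0 : y ≢ 0#
          y≢0 z = f₁≢0 (trans (sym f₂y) (zeroed (inj₂ z)))
          fy : Fixed y
          fy = *-cancelˡ f₂≢0 (begin
            f₂ * conj y              ≡⟨ solve 2 (λ f y → f :* y := :- (:- f :* y)) refl f₂ (conj y) ⟩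
            - (- f₂ * conj y)        ≡⟨ cong (λ z → - (z * conj y)) (sym (form-conj (c j) d₂)) ⟩
            - (conj f₂ * conj y)     ≡⟨ cong -_ (trans (sym (conj-* f₂ y)) (trans (cong conj f₂y) (form-conj (c j) d₁))) ⟩
            - - f₁                   ≡⟨ solve 1 (λ x → :- (:- x) := x) refl f₁ ⟩
            f₁                       ≡⟨ f₂y ⟨
            f₂ * y                   ∎)
            where open ≡-Reasoning
          α≡ : α ≡ β * y ^ r
          α≡ = *-cancelˡ (^≢0 r f₂≢0) (trans (*-comm _ α) (trans (slope (slopes j))
              (trans (cong (β *_) (trans (cong (_^ r) (sym f₂y)) (*-^ f₂ y r))) (solve 3 (λ b s t → b :* (s :* t) := s :* (b :* t)) refl β (f₂ ^ r) (y ^ r)))))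
            where
            slope : Slope d₁ d₂ α β (c j) → α * f₂ ^ r ≡ β * f₁ ^ r
            slope (inj₁ z) = contradiction z f₁≢0
            slope (inj₂ (inj₁ z)) = contradiction z f₂≢0
            slope (inj₂ (inj₂ e)) = e
          on : ∀ {w} → Slope d₁ d₂ α β w → OnNormal d₁ (d₂ * y) w
          on (inj₁ z) = inj₁ z
          on {w} (inj₂ (inj₁ z)) = inj₂ (inj₁ (trans (form-scaleʳ w d₂ fy) (zeroed (inj₁ z))))
          on {w} (inj₂ (inj₂ e)) = inj₂ (inj₂ (*-cancelˡ β≢0 (begin
            β * form w (d₂ * y) ^ r            ≡⟨ cong (λ z → β * z ^ r) (form-scaleʳ w d₂ fy) ⟩
            β * (form w d₂ * y) ^ r            ≡⟨ cong (β *_) (*-^ (form w d₂) y r) ⟩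
            β * (form w d₂ ^ r * y ^ r)        ≡⟨ solve 3 (λ b s t → b :* (s :* t) := (b :* t) :* s) refl β _ (y ^ r) ⟩
            (β * y ^ r) * form w d₂ ^ r        ≡⟨ cong (_* form w d₂ ^ r) (sym α≡) ⟩
            α * form w d₂ ^ r                  ≡⟨ e ⟩
            β * form w d₁ ^ r                  ∎)))
            where open ≡-Reasoning

  module _ (all-determined : AllDetermined) (not-collinear : NotCollinear) (q≡2r+1 : q ≡ suc (r ℕ.+ r)) where

    module Large (2≤r : 2 ℕ.≤ r) where
      open Bound.Classification all-determined not-collinear q≡2r+1 2≤r
      open TypeB

      sign : Carrier
      sign = (- 1#) ^ r

      sign² : sign * sign ≡ 1#
      sign² = trans (sym (*-^ (- 1#) (- 1#) r)) (trans (cong (_^ r) (solve 0 (:- :1 :* :- :1 := :1) refl)) (1^ r))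

      neg-^ : ∀ x → (- x) ^ r ≡ sign * x ^ r
      neg-^ x = trans (cong (_^ r) (solve 1 (λ x → :- x := :- :1 :* x) refl x)) (*-^ (- 1#) x r)

      module _ {d : Carrier} (B : TypeB d) where
        At : Fin q → Set
        At i = form (v i) d ≡ t B

        at? : ∀ i → Dec (At i)
        at? i = form (v i) d ≟ t B

        abstract
          many-at : suc r ℕ.≤ length (filter at? (allFin q))
          many-at = ℕₚ.≤-trans (multiplicity≤count (t B) (suc r) (values d)
            (Finite-⊕ (Finite-lin↑ (t B) r) (Finite-⊖ (1 , Deg-const))) (factor B))
            (ℕₚ.≤-reflexive (count-tabulate (λ i → form (v i) d) (t B)))

          root-power : ∀ i → ¬ At i → (form (v i) d - t B) ^ r ≡ γ B
          root-power i off = go (*≡0 (Ev-unique (S.sym (factor B))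
              (Ev-⊗ (Ev-↑ (suc r) (Ev-lin (t B))) (Ev-⊕ (Ev-↑ r (Ev-lin (t B))) (Ev-⊖ (Ev-const (γ B)))))
              (Ev-prod-root (values d) (∈-tabulate⁺ i))))
            where
            go : (form (v i) d - t B) ^ suc r ≡ 0# ⊎ (form (v i) d - t B) ^ r - γ B ≡ 0# → (form (v i) d - t B) ^ r ≡ γ B
            go (inj₁ z) = contradiction (-≡0 (^≡0 (suc r) z)) off
            go (inj₂ z) = -≡0 z

      -- Every point lies on one of the two heavy lines. If `v i` is only on the first and `v j`
      -- only on the second, the factorisations of h give γ₂ for the r-th power of the form of their
      -- difference with d₂, and (-1)ʳ γ₁ for the one with d₁. Interchanging i and j multiplies both
      -- by (-1)ʳ, so the ratio is constant.
      normal-form : HasNormalForm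
      normal-form = go (two-typeB all-determined not-collinear q≡2r+1 2≤r)
        where
        go : (∃ λ d₁ → ∃ λ d₂ → TypeB d₁ × TypeB d₂ × form d₂ d₁ ≢ 0#) → HasNormalForm
        go (d₁ , d₂ , B₁ , B₂ , ne) = normalise {d₁} {d₂} {γ B₁ * sign} {γ B₂} ne γ₂≢0 λ j → transfer j (all-determined j)
          where
          γ₂≢0 : γ B₂ ≢ 0#
          γ₂≢0 z = 1≢0 (neg≡0 (trans (sym (γ² B₂)) (zeroed (inj₁ z))))
          on-axes : ∀ i → At B₁ i ⊎ At B₂ i
          on-axes i = two-large-filters (at? B₁) (at? B₂) (allFin q) r (Unique.allFin⁺ q)
            (ℕₚ.≤-reflexive (trans (length-tabulate (λ i → i)) q≡2r+1)) (many-at B₁) (many-at B₂)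
            (λ x y a b a′ b′ → separated (λ z → ne (form-flip z)) x y (trans a (sym a′)) (trans b (sym b′))) i (∈-allFin i)
          shift : ∀ i j d s → form (v i - v j) d ≡ (form (v i) d - s) - (form (v j) d - s)
          shift i j d s = trans (form-sub (v i) (v j) d) (solve 3 (λ a b s → a :- b := (a :- s) :- (b :- s)) refl _ _ s)
          at-zero : ∀ {d} (B : TypeB d) i → At B i → form (v i) d - t B ≡ 0#
          at-zero B i e = trans (cong (_- t B) e) (-self _)
          right : ∀ i j {d} (B : TypeB d) → At B j → ¬ At B i → form (v i - v j) d ^ r ≡ γ B
          right i j {d} B aj ¬ai = trans (cong (_^ r) (trans (shift i j d (t B)) (trans (cong (λ z → (form (v i) d - t B) - z) (at-zero B j aj))
            (sub-zero _)))) (root-power B i ¬ai)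
          left : ∀ i j {d} (B : TypeB d) → At B i → ¬ At B j → form (v i - v j) d ^ r ≡ sign * γ B
          left i j {d} B ai ¬aj = trans (cong (_^ r) (trans (shift i j d (t B)) (trans (cong (λ z → z - (form (v j) d - t B)) (at-zero B i ai)) (+-identityˡ _))))
            (trans (neg-^ _) (cong (sign *_) (root-power B j ¬aj)))
          same : ∀ i j {d} (B : TypeB d) → At B i → At B j → form (v i - v j) d ≡ 0#
          same i j {d} B ai aj = trans (form-sub (v i) (v j) d) (trans (cong₂ _-_ ai aj) (-self _))
          slope : ∀ i j → Slope d₁ d₂ (γ B₁ * sign) (γ B₂) (v i - v j)
          slope i j with at? B₁ i | at? B₂ i | at? B₁ j | at? B₂ j
          ... | yes a | _ | yes b | _ = inj₁ (same i j B₁ a b)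
          ... | _ | yes a | _ | yes b = inj₂ (inj₁ (same i j B₂ a b))
          ... | yes a | no ¬a | no ¬b | yes b = inj₂ (inj₂ (trans (cong (γ B₁ * sign *_) (right i j B₂ b ¬a))
                (trans (solve 3 (λ x s y → x :* s :* y := y :* (s :* x)) refl (γ B₁) sign (γ B₂)) (cong (γ B₂ *_) (sym (left i j B₁ a ¬b))))))
          ... | no ¬a | yes a | yes b | no ¬b = inj₂ (inj₂ (trans (cong (γ B₁ * sign *_) (left i j B₂ a ¬b))
                (trans (solve 3 (λ x s y → x :* s :* (s :* y) := y :* (x :* (s :* s))) refl (γ B₁) sign (γ B₂))
                  (cong (γ B₂ *_) (trans (cong (γ B₁ *_) sign²) (trans (*-identityʳ _) (sym (right i j B₁ b ¬a))))))))
          ... | no ¬a | no ¬a′ | _ | _ = contradiction′ (on-axes i)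
            where
            contradiction′ : At B₁ i ⊎ At B₂ i → _
            contradiction′ (inj₁ h) = contradiction h ¬a
            contradiction′ (inj₂ h) = contradiction h ¬a′
          ... | _ | _ | no ¬b | no ¬b′ = contradiction′ (on-axes j)
            where
            contradiction′ : At B₁ j ⊎ At B₂ j → _
            contradiction′ (inj₁ h) = contradiction h ¬b
            contradiction′ (inj₂ h) = contradiction h ¬b′
          -- Every direction of the graph is proportional to a difference of the clique, and the
          -- slope condition is homogeneous of degree r.
          transfer : ∀ k → (∃ λ i → ∃ λ j → i ≢ j × form (v i) (c k) ≡ form (v j) (c k)) → Slope d₁ d₂ (γ B₁ * sign) (γ B₂) (c k)
          transfer k (i , j , i≢j , e) = scale (form-zero {v i - v j} (nonzero k) (trans (form-sub (v i) (v j) (c k)) (trans (cong (_- form (v j) (c k)) e) (-self _)))) (slope i j)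
            where
            scale : (∃ λ a → Fixed a × v i - v j ≡ c k * a) → Slope d₁ d₂ (γ B₁ * sign) (γ B₂) (v i - v j) → Slope d₁ d₂ (γ B₁ * sign) (γ B₂) (c k)
            scale (a , fa , w≡) = go′
              where
              a≢0 : a ≢ 0#
              a≢0 z = i≢j (inj i j (-≡0 (trans w≡ (zeroed (inj₂ z)))))
              scaled : ∀ d → form (v i - v j) d ≡ form (c k) d * a
              scaled d = trans (cong (λ w → form w d) w≡) (form-scaleˡ (c k) d fa)
              drop : ∀ {x} → x * a ≡ 0# → x ≡ 0#
              drop {x} e = *-cancelˡ a≢0 (trans (*-comm a x) (trans e (sym (zeroʳ a))))
              go′ : Slope d₁ d₂ (γ B₁ * sign) (γ B₂) (v i - v j) → Slope d₁ d₂ (γ B₁ * sign) (γ B₂) (c k)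
              go′ (inj₁ z) = inj₁ (drop (trans (sym (scaled d₁)) z))
              go′ (inj₂ (inj₁ z)) = inj₂ (inj₁ (drop (trans (sym (scaled d₂)) z)))
              go′ (inj₂ (inj₂ z)) = inj₂ (inj₂ (*-cancelˡ (^≢0 r a≢0) (trans (pull (γ B₁ * sign) d₂) (trans z (sym (pull (γ B₂) d₁))))))
                where
                pull : ∀ α d → a ^ r * (α * form (c k) d ^ r) ≡ α * form (v i - v j) d ^ r
                pull α d = trans (solve 3 (λ s α x → s :* (α :* x) := α :* (x :* s)) refl (a ^ r) α (form (c k) d ^ r))
                  (cong (α *_) (trans (sym (*-^ (form (c k) d) a r)) (cong (_^ r) (sym (scaled d)))))

  -- The classification needs r ≥ 2. For r = 1 there are three directions and the slope condition is
  -- linear: two directions serve as axes and the constants are read off from the third.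
  normal-form-three : r′ ≡ 0 → HasNormalForm
  normal-form-three refl = normalise {c zero} {c (suc zero)} {form (c (suc (suc zero))) (c zero)} {form (c (suc (suc zero))) (c (suc zero))}
    (independent {suc zero} {zero} λ ()) (independent {suc (suc zero)} {suc zero} λ ()) on
    where
    on : ∀ j → Slope (c zero) (c (suc zero)) (form (c (suc (suc zero))) (c zero)) (form (c (suc (suc zero))) (c (suc zero))) (c j)
    on zero = inj₁ (form-alternating (c zero))
    on (suc zero) = inj₂ (inj₁ (form-alternating (c (suc zero))))
    on (suc (suc zero)) = inj₂ (inj₂ (solve 2 (λ x y → x :* (y :* :1) := y :* (x :* :1)) refl _ _))

  normal-form : AllDetermined → NotCollinear → q ≡ suc (r ℕ.+ r) → HasNormalForm
  normal-form all-determined not-collinear q≡2r+1 = go r′ refl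
    where
    go : ∀ s → r′ ≡ s → HasNormalForm
    go zero e = normal-form-three e
    go (suc s) refl = Large.normal-form all-determined not-collinear q≡2r+1 (ℕ.s≤s (ℕ.s≤s ℕ.z≤n))

-- A normal form determines the graph up to isomorphism.

module Characterisation (𝕂 : Setting) (k : ℕ) (1≤k : 1 ℕ.≤ k) (Γ : Graph 𝕂 (suc (suc k))) where
  open QuadraticField 𝕂
  open PeisertDirections 𝕂 Γ
  open NormalForm 𝕂 Γ k
  open PeisertData Γ

  module _ {d₁ d₂ : Carrier} (normal : Normal d₁ d₂) where
    private
      f₁ f₂ : Carrier → Carrier
      f₁ u = form u d₁
      f₂ u = form u d₂

      ne : form d₁ d₂ ≢ 0#
      ne z = proj₁ normal (form-flip z)

      -- The determinant in the coordinates f₁, f₂ is a nonzero multiple of the form, so independent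
      -- vectors off the axis have different ratios.
      grassmann : ∀ u w → f₁ u * f₂ w - f₂ u * f₁ w ≡ form u w * form d₁ d₂
      grassmann u w = solve 8 (λ u u′ w w′ a a′ b b′ →
        (u :* a′ :- u′ :* a) :* (w :* b′ :- w′ :* b) :- (u :* b′ :- u′ :* b) :* (w :* a′ :- w′ :* a)
          := (u :* w′ :- u′ :* w) :* (a :* b′ :- a′ :* b)) refl u (conj u) w (conj w) d₁ (conj d₁) d₂ (conj d₂)

      combine : ∀ {u w x} → f₁ u * f₂ w - f₂ u * f₁ w ≡ x → x ≡ 0# → form u w ≢ 0# → ⊥
      combine {u} {w} e x≡0 uw≢0 = *≢0 uw≢0 ne (trans (sym (grassmann u w)) (trans e x≡0))

      Good : Carrier → Set
      Good u = f₁ u ≢ 0#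

      good? : ∀ u → Dec (Good u)
      good? u = ¬? (f₁ u ≟ 0#)

      ratio : Carrier → Carrier
      ratio u with f₁ u ≟ 0#
      ... | yes _ = 0#
      ... | no ne = f₂ u * inv (f₁ u) ne

      ratio-* : ∀ {u} → Good u → ratio u * f₁ u ≡ f₂ u
      ratio-* {u} good with f₁ u ≟ 0#
      ... | yes z = contradiction z good
      ... | no ne = trans (*-assoc _ _ _) (trans (cong (f₂ u *_) (inv* (f₁ u) ne)) (*-identityʳ _))

      ratio-injective : ∀ {u w} → Good u → Good w → form u w ≢ 0# → ratio u ≢ ratio w
      ratio-injective {u} {w} gu gw uw≢0 e = combine {u} {w} refl (trans (cong₂ (λ a b → f₁ u * a - b * f₁ w) (sym (ratio-* gw)) (sym (ratio-* gu)))
        (trans (cong (λ z → f₁ u * (ratio w * f₁ w) - z * f₁ u * f₁ w) e)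
          (solve 3 (λ a b z → a :* (z :* b) :- z :* a :* b := :0) refl (f₁ u) (f₁ w) (ratio w)))) uw≢0

      slopePoly : Ser
      slopePoly = X ⊗ (X ↑ k ⊕ ⊖ 1S)

      ratio-root : ∀ {u} → Good u → OnNormal d₁ d₂ u → Ev slopePoly (ratio u) 0#
      ratio-root {u} gu on = Ev-value (zeroed (root on)) (Ev-⊗ Ev-X (Ev-⊕ (Ev-↑ k Ev-X) (Ev-⊖ (Ev-const 1#))))
        where
        root : OnNormal d₁ d₂ u → ratio u ≡ 0# ⊎ ratio u ^ k - 1# ≡ 0#
        root (inj₁ z) = contradiction z gu
        root (inj₂ (inj₁ z)) = inj₁ (*-cancelˡ gu (trans (*-comm _ _) (trans (ratio-* gu) (trans z (sym (zeroʳ _))))))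
        root (inj₂ (inj₂ e)) = inj₂ (trans (cong (_- 1#) (*-cancelˡ (^≢0 k gu)
          (trans (*-comm _ _) (trans (sym (*-^ (ratio u) (f₁ u) k)) (trans (cong (_^ k) (ratio-* gu)) (trans e (sym (*-identityʳ _)))))))) (-self 1#))

      all-pairs : ∀ {P : Carrier → Set} {R S : Carrier → Carrier → Set} → (∀ {x y} → P x → P y → R x y → S x y) →
        ∀ {L} → All P L → AllPairs R L → AllPairs S L
      all-pairs h [] [] = []
      all-pairs h (px ∷ pL) (r ∷ rs) = All.zipWith (λ { (py , rxy) → h px py rxy }) (pL , r) ∷ all-pairs h pL rs

    abstract
      -- At most one direction lies on the axis f₁ = 0. The others have distinct ratios f₂/f₁, all
      -- of them roots of X (Xᵏ - 1), so there are at most k + 1 of them.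
      few-normal : ∀ L → AllPairs (λ u w → form u w ≢ 0#) L → All (OnNormal d₁ d₂) L → length L ℕ.≤ suc (suc k)
      few-normal L pairs on = ℕₚ.≤-trans (ℕₚ.≤-reflexive (sym (length-filter-¬ (λ u → f₁ u ≟ 0#) L))) (ℕₚ.+-mono-≤ axis off)
        where
        at-most-one : ∀ M → AllPairs (λ u w → form u w ≢ 0#) M → All (λ u → f₁ u ≡ 0#) M → length M ℕ.≤ 1
        at-most-one [] _ _ = ℕ.z≤n
        at-most-one (_ ∷ []) _ _ = ℕ.s≤s ℕ.z≤n
        at-most-one (u ∷ w ∷ _) ((uw≢0 ∷ _) ∷ _) (zu ∷ zw ∷ _) = contradiction
          (trans (cong₂ (λ a b → a * f₂ w - f₂ u * b) zu zw) (solve 2 (λ a b → :0 :* a :- b :* :0 := :0) refl (f₂ w) (f₂ u)))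
          (λ z → combine {u} {w} refl z uw≢0)
        axis : length (filter (λ u → f₁ u ≟ 0#) L) ℕ.≤ 1
        axis = at-most-one _ (AllPairs.filter⁺ (λ u → f₁ u ≟ 0#) pairs) (All.all-filter (λ u → f₁ u ≟ 0#) L)
        off : length (filter good? L) ℕ.≤ suc k
        off = subst (ℕ._≤ suc k) (length-map ratio (filter good? L)) (root-bound {slopePoly} {suc k} {1} (map ratio (filter good? L))
          (AllPairs.map⁺ (all-pairs (λ gu gw uw → ratio-injective gu gw uw) (All.all-filter good? L) (AllPairs.filter⁺ good? pairs)))
          (All.map⁺ (All.zipWith (λ { (gu , on) → ratio-root gu on }) (All.all-filter good? L , All.filter⁺ good? on)))
          (Deg-⊗ Deg-X (Deg-⊕ (Deg-X↑ k) (Deg-⊖ (Deg-mono (ℕ.s≤s ℕ.z≤n) Deg-const))) ℕₚ.≤-refl)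
          (λ e → 1≢0 (neg≡0 (trans (sym (trans (X⊗-suc (X ↑ k ⊕ ⊖ 1S) 0) (trans (cong (_+ - 1#) (X↑-other k 0 (ℕₚ.<⇒≢ 1≤k))) (+-identityˡ _)))) e))))

      connected : ∀ {w} → InS q K Γ w → w ≢ 0# × OnNormal d₁ d₂ w
      connected {w} (i , a , (fa , a≢0) , refl) = *≢0 (nonzero i) a≢0 , scale (proj₂ normal i)
        where
        scale : OnNormal d₁ d₂ (c i) → OnNormal d₁ d₂ (c i * a)
        scale (inj₁ z) = inj₁ (trans (form-scaleˡ (c i) d₁ fa) (zeroed (inj₁ z)))
        scale (inj₂ (inj₁ z)) = inj₂ (inj₁ (trans (form-scaleˡ (c i) d₂ fa) (zeroed (inj₁ z))))
        scale (inj₂ (inj₂ e)) = inj₂ (inj₂ (trans (pull d₂) (trans (cong (_* a ^ k) e) (sym (pull d₁)))))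
          where
          pull : ∀ d → form (c i * a) d ^ k ≡ form (c i) d ^ k * a ^ k
          pull d = trans (cong (_^ k) (form-scaleˡ (c i) d fa)) (*-^ (form (c i) d) a k)

      -- The k + 2 directions of the graph exhaust the bound of `few-normal`, so w is parallel to
      -- one of them. Together with `connected` this describes adjacency by d₁ and d₂ alone.
      connects : ∀ {w} → w ≢ 0# → OnNormal d₁ d₂ w → InS q K Γ w
      connects {w} w≢0 on = go (Fin.any? (λ i → form (c i) w ≟ 0#))
        where
        go : Dec (∃ λ i → form (c i) w ≡ 0#) → InS q K Γ w
        go (yes (i , e)) with parallel w≢0 e
        ... | a , fa , a≢0 , w≡ = i , a , (fa , a≢0) , w≡
        go (no none) = contradiction (few-normal (w ∷ tabulate c)
            (All.tabulate⁺ (λ i z → none (i , form-flip z)) ∷ AllPairs.tabulate⁺ independent)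
            (on ∷ All.tabulate⁺ (proj₂ normal)))
          (ℕₚ.<⇒≱ (ℕ.s≤s (ℕₚ.≤-reflexive (sym (length-tabulate c)))))

module CoordinateChange (𝕂 : Setting) where
  open QuadraticField 𝕂

  module _ (d₁ d₂ d₁′ d₂′ : Carrier) (ne : form d₂ d₁ ≢ 0#) where
    private
      i : Carrier
      i = inv (form d₂ d₁) ne

    -- The linear map whose coordinates with respect to (d₁′, d₂′) are those of x with respect to (d₁, d₂).
    change : Carrier → Carrier
    change x = d₂′ * (form x d₁ * i) - d₁′ * (form x d₂ * i)

    abstract
      -- Values of the form and i are both negated by `conj`, so their products are coordinates in
      -- 𝔽_q.
      conj-i : conj i ≡ - i
      conj-i = *-cancelˡ ne (begin
        form d₂ d₁ * conj i            ≡⟨ solve 2 (λ f j → f :* j := :- (j :* :- f)) refl (form d₂ d₁) (conj i) ⟩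
        - (conj i * - form d₂ d₁)      ≡⟨ cong (λ z → - (conj i * z)) (sym (form-conj d₂ d₁)) ⟩
        - (conj i * conj (form d₂ d₁)) ≡⟨ cong -_ (conj-inv (form d₂ d₁) ne) ⟩
        - 1#                           ≡⟨ cong -_ (sym (*-inv (form d₂ d₁) ne)) ⟩
        - (form d₂ d₁ * i)             ≡⟨ solve 2 (λ f i → :- (f :* i) := f :* :- i) refl (form d₂ d₁) i ⟩
        form d₂ d₁ * - i               ∎)
        where open ≡-Reasoning

      coordinate-fixed : ∀ x d → Fixed (form x d * i)
      coordinate-fixed x d = trans (conj-* _ _) (trans (cong₂ _*_ (form-conj x d) conj-i) (solve 2 (λ a b → :- a :* :- b := a :* b) refl _ _))

      change-sub : ∀ x y → change (x - y) ≡ change x - change y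
      change-sub x y = trans (cong₂ (λ a b → d₂′ * (a * i) - d₁′ * (b * i)) (form-sub x y d₁) (form-sub x y d₂))
        (solve 7 (λ e d a b a′ b′ i → e :* ((a :- b) :* i) :- d :* ((a′ :- b′) :* i) := (e :* (a :* i) :- d :* (a′ :* i)) :- (e :* (b :* i) :- d :* (b′ :* i)))
          refl d₂′ d₁′ (form x d₁) (form y d₁) (form x d₂) (form y d₂) i)

      -- The second coordinate picks up the same factor, hence the homogeneous condition of the
      -- normal form is preserved.
      form-change₁ : ∀ x → form (change x) d₁′ ≡ form x d₁ * (i * form d₂′ d₁′)
      form-change₁ x = begin
        form (change x) d₁′
          ≡⟨ form-sub (d₂′ * (form x d₁ * i)) (d₁′ * (form x d₂ * i)) d₁′ ⟩
        form (d₂′ * (form x d₁ * i)) d₁′ - form (d₁′ * (form x d₂ * i)) d₁′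
          ≡⟨ cong₂ _-_ (form-scaleˡ d₂′ d₁′ (coordinate-fixed x d₁)) (trans (form-scaleˡ d₁′ d₁′ (coordinate-fixed x d₂)) (zeroed (inj₁ (form-alternating d₁′)))) ⟩
        form d₂′ d₁′ * (form x d₁ * i) - 0#
          ≡⟨ solve 3 (λ f a i → f :* (a :* i) :- :0 := a :* (i :* f)) refl (form d₂′ d₁′) (form x d₁) i ⟩
        form x d₁ * (i * form d₂′ d₁′) ∎
        where open ≡-Reasoning

      form-change₂ : ∀ x → form (change x) d₂′ ≡ form x d₂ * (i * form d₂′ d₁′)
      form-change₂ x = begin
        form (change x) d₂′
          ≡⟨ form-sub (d₂′ * (form x d₁ * i)) (d₁′ * (form x d₂ * i)) d₂′ ⟩
        form (d₂′ * (form x d₁ * i)) d₂′ - form (d₁′ * (form x d₂ * i)) d₂′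
          ≡⟨ cong₂ _-_ (trans (form-scaleˡ d₂′ d₂′ (coordinate-fixed x d₁)) (zeroed (inj₁ (form-alternating d₂′))))
                       (trans (form-scaleˡ d₁′ d₂′ (coordinate-fixed x d₂)) (cong (_* (form x d₂ * i)) (form-antisymmetric d₁′ d₂′))) ⟩
        0# - (- form d₂′ d₁′) * (form x d₂ * i)
          ≡⟨ solve 3 (λ f a i → :0 :- (:- f) :* (a :* i) := a :* (i :* f)) refl (form d₂′ d₁′) (form x d₂) i ⟩
        form x d₂ * (i * form d₂′ d₁′) ∎
        where open ≡-Reasoning

      change-OnNormal : ∀ k {w} → form w d₁ ≡ 0# ⊎ form w d₂ ≡ 0# ⊎ form w d₂ ^ k ≡ form w d₁ ^ k →
        form (change w) d₁′ ≡ 0# ⊎ form (change w) d₂′ ≡ 0# ⊎ form (change w) d₂′ ^ k ≡ form (change w) d₁′ ^ k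
      change-OnNormal k {w} (inj₁ z) = inj₁ (trans (form-change₁ w) (zeroed (inj₁ z)))
      change-OnNormal k {w} (inj₂ (inj₁ z)) = inj₂ (inj₁ (trans (form-change₂ w) (zeroed (inj₁ z))))
      change-OnNormal k {w} (inj₂ (inj₂ e)) = inj₂ (inj₂ (trans (cong (_^ k) (form-change₂ w)) (trans (*-^ (form w d₂) μ k)
          (trans (cong (_* μ ^ k) e) (trans (sym (*-^ (form w d₁) μ k)) (cong (_^ k) (sym (form-change₁ w))))))))
        where
        μ : Carrier
        μ = i * form d₂′ d₁′

      change-zero : change 0# ≡ 0#
      change-zero = trans (cong change (sym (-self 0#))) (trans (change-sub 0# 0#) (-self _))

  module _ (d₁ d₂ d₁′ d₂′ : Carrier) (ne : form d₂ d₁ ≢ 0#) (ne′ : form d₂′ d₁′ ≢ 0#) where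
    abstract
      -- The factors of the two changes cancel, and the Plücker relation rebuilds x from its
      -- coordinates.
      change-inverse : ∀ x → change d₁′ d₂′ d₁ d₂ ne′ (change d₁ d₂ d₁′ d₂′ ne x) ≡ x
      change-inverse x = begin
        d₂ * (form y d₁′ * j) - d₁ * (form y d₂′ * j)
          ≡⟨ cong₂ (λ a b → d₂ * (a * j) - d₁ * (b * j)) (form-change₁ d₁ d₂ d₁′ d₂′ ne x) (form-change₂ d₁ d₂ d₁′ d₂′ ne x) ⟩
        d₂ * (form x d₁ * (i * θ′) * j) - d₁ * (form x d₂ * (i * θ′) * j)
          ≡⟨ solve 7 (λ e d a b i t j → e :* (a :* (i :* t) :* j) :- d :* (b :* (i :* t) :* j) := i :* (a :* e :- b :* d) :* (t :* j)) refl d₂ d₁ (form x d₁) (form x d₂) i θ′ j ⟩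
        i * (form x d₁ * d₂ - form x d₂ * d₁) * (θ′ * j)
          ≡⟨ cong₂ (λ a b → i * a * b) (sym (form-plücker x d₂ d₁)) (*-inv θ′ ne′) ⟩
        i * (form d₂ d₁ * x) * 1#
          ≡⟨ solve 3 (λ i t x → i :* (t :* x) :* :1 := (i :* t) :* x) refl i (form d₂ d₁) x ⟩
        i * form d₂ d₁ * x
          ≡⟨ trans (cong (_* x) (inv* (form d₂ d₁) ne)) (*-identityˡ x) ⟩
        x ∎
        where
        open ≡-Reasoning
        y i j θ′ : Carrier
        y = change d₁ d₂ d₁′ d₂′ ne x
        i = inv (form d₂ d₁) ne
        θ′ = form d₂′ d₁′
        j = inv θ′ ne′

module NormalIsomorphism (𝕂 : Setting) (k : ℕ) (1≤k : 1 ℕ.≤ k) where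
  open QuadraticField 𝕂
  open CoordinateChange 𝕂
  module N = NormalForm 𝕂
  module Char = Characterisation 𝕂 k 1≤k

  preserves-adjacency : ∀ (Γ Γ′ : PeisertData q K (suc (suc k))) {d₁ d₂ d₁′ d₂′} (N : N.Normal Γ k d₁ d₂) (N′ : N.Normal Γ′ k d₁′ d₂′) →
    ∀ {w} → InS q K Γ w → InS q K Γ′ (change d₁ d₂ d₁′ d₂′ (proj₁ N) w)
  preserves-adjacency Γ Γ′ {d₁} {d₂} {d₁′} {d₂′} N N′ {w} w∈ = Char.connects Γ′ N′ nonzero
      (change-OnNormal d₁ d₂ d₁′ d₂′ (proj₁ N) k {w} (proj₂ (Char.connected Γ N w∈)))
    where
    nonzero : change d₁ d₂ d₁′ d₂′ (proj₁ N) w ≢ 0#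
    nonzero z = proj₁ (Char.connected Γ N w∈) (trans (sym (change-inverse d₁ d₂ d₁′ d₂′ (proj₁ N) (proj₁ N′) w))
      (trans (cong (change d₁′ d₂′ d₁ d₂ (proj₁ N′)) z) (change-zero d₁′ d₂′ d₁ d₂ (proj₁ N′))))

  isomorphic : ∀ (Γ Γ′ : PeisertData q K (suc (suc k))) → N.HasNormalForm Γ k → N.HasNormalForm Γ′ k → Isomorphic q K Γ Γ′
  isomorphic Γ Γ′ (d₁ , d₂ , N) (d₁′ , d₂′ , N′) =
    mk↔ₛ′ f g (change-inverse d₁′ d₂′ d₁ d₂ (proj₁ N′) (proj₁ N)) g∘f ,
    λ x y → (λ adj → subst (InS q K Γ′) (change-sub d₁ d₂ d₁′ d₂′ (proj₁ N) x y) (preserves-adjacency Γ Γ′ N N′ adj)) ,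
            (λ adj → subst (InS q K Γ) (trans (change-sub d₁′ d₂′ d₁ d₂ (proj₁ N′) (f x) (f y)) (cong₂ _-_ (g∘f x) (g∘f y)))
                       (preserves-adjacency Γ′ Γ N′ N adj))
    where
    f g : Carrier → Carrier
    f = change d₁ d₂ d₁′ d₂′ (proj₁ N)
    g = change d₁′ d₂′ d₁ d₂ (proj₁ N′)
    g∘f : ∀ x → g (f x) ≡ x
    g∘f = change-inverse d₁ d₂ d₁′ d₂′ (proj₁ N) (proj₁ N′)

-- Extremal graphs and the theorem.

half-or-odd : ∀ n → ∃ λ k → n ≡ k ℕ.+ k ⊎ n ≡ suc (k ℕ.+ k)
half-or-odd zero = 0 , inj₁ refl
half-or-odd (suc n) with half-or-odd n
... | k , inj₁ e = k , inj₂ (cong suc e)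
... | k , inj₂ e = suc k , inj₁ (trans (cong suc e) (cong suc (sym (ℕₚ.+-suc k k))))

odd-prime : ∀ {p} → Prime p → 3 ℕ.≤ p → ∃ λ k → p ≡ suc (k ℕ.+ k)
odd-prime {p} pp 3≤p with half-or-odd p
... | k , inj₂ e = k , e
... | k , inj₁ e with prime⇒irreducible pp {2} (divides k (trans e (trans (cong (k ℕ.+_) (sym (ℕₚ.+-identityʳ k))) (ℕₚ.*-comm 2 k))))
...   | inj₂ 2≡p = contradiction 2≡p (ℕₚ.<⇒≢ 3≤p)

[2k+1+3]/2 : ∀ k → (suc (k ℕ.+ k) ℕ.+ 3) ℕ./ 2 ≡ suc (suc k)
[2k+1+3]/2 k = trans (cong (ℕ._/ 2) (solve 1 (λ k → (con 1 :+ (k :+ k)) :+ con 3 := (con 2 :+ k) :* con 2) refl k))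
  (DM.m*n/n≡m (suc (suc k)) 2)
  where open +-*-Solver

module ExtremalGraphs (𝕂 : Setting) where
  open QuadraticField 𝕂

  first second : Fin q
  first = Fin.fromℕ< 0<q
  second = Fin.fromℕ< 1<q

  first≢second : first ≢ second
  first≢second e = contradiction (trans (sym (Fin.toℕ-fromℕ< 0<q)) (trans (cong Fin.toℕ e) (Fin.toℕ-fromℕ< 1<q))) λ ()

  module _ {m : ℕ} (Γ : PeisertData q K m) where
    open PeisertData Γ

    Collinear : MaxClique q K Γ → Fin m → Set
    Collinear C k = ∀ i j → form (MaxClique.v C i) (c k) ≡ form (MaxClique.v C j) (c k)

    collinear? : ∀ C → Dec (∃ (Collinear C))
    collinear? C = Fin.any? λ k → Fin.all? λ i → Fin.all? λ j → form (MaxClique.v C i) (c k) ≟ form (MaxClique.v C j) (c k)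

    abstract
      collinear⇒canonical : ∀ C → ∃ (Collinear C) → Canonical q K Γ C
      collinear⇒canonical C (k , same) = v first , k , λ j → on (form-zero {v j - v first} (nonzero k)
          (trans (form-sub (v j) (v first) (c k)) (trans (cong (_- form (v first) (c k)) (same j first)) (-self _))))
        where
        open MaxClique C
        on : ∀ {j} → (∃ λ a → Fixed a × v j - v first ≡ c k * a) → ∃ λ a → Fixed a × v j ≡ v first + c k * a
        on {j} (a , fa , e) = a , fa , trans (solve 2 (λ x y → x := y :+ (x :- y)) refl (v j) (v first)) (cong (v first +_) e)

      canonical⇒collinear : ∀ C → Canonical q K Γ C → ∃ (Collinear C)
      canonical⇒collinear C (x , k , on-line) = k , λ i j → trans (through i) (sym (through j))
        where
        open MaxClique C
        through : ∀ i → form (v i) (c k) ≡ form x (c k)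
        through i = trans (cong (λ w → form w (c k)) (proj₂ (proj₂ (on-line i)))) (form-on-line x (c k) (proj₁ (proj₂ (on-line i))))

      -- If G failed, no clique could be non-collinear, because collinearity is decidable; then
      -- every clique would be canonical.
      from-non-strict : ∀ {G : Set} → Dec G → ¬ StrictEKR q K Γ → (∀ C → (∀ k → ¬ Collinear C k) → G) → G
      from-non-strict (yes g) _ _ = g
      from-non-strict {G} (no ¬g) ¬strict h = contradiction strict ¬strict
        where
        strict : StrictEKR q K Γ
        strict C with collinear? C
        ... | yes col = collinear⇒canonical C col
        ... | no ¬col = ⊥-elim (¬g (h C (λ k col → ¬col (k , col))))

  strict-0 : (Γ : PeisertData q K 0) → StrictEKR q K Γ
  strict-0 Γ C with proj₁ (MaxClique.clique C first second first≢second)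
  ... | ()

  strict-1 : (Γ : PeisertData q K 1) → StrictEKR q K Γ
  strict-1 Γ C = collinear⇒canonical Γ C (zero , same)
    where
    open PeisertData Γ
    open MaxClique C
    same : ∀ i j → form (v i) (c zero) ≡ form (v j) (c zero)
    same i j with i Fin.≟ j
    ... | yes refl = refl
    ... | no i≢j = -≡0 (trans (sym (form-sub (v i) (v j) (c zero))) (go (clique i j i≢j)))
      where
      go : InS q K Γ (v i - v j) → form (v i - v j) (c zero) ≡ 0#
      go (zero , a , (fa , _) , e) = trans (cong (λ w → form w (c zero)) e)
        (trans (form-scaleˡ (c zero) (c zero) fa) (trans (cong (_* a) (form-alternating (c zero))) (zeroˡ a)))

  module _ {r : ℕ} (Γ : PeisertData q K (suc (suc r))) (minimal : (Δ : PeisertData q K (suc r)) → StrictEKR q K Δ)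
    (C : MaxClique q K Γ) (not-collinear : ∀ k → ¬ Collinear Γ C k) where
    open PeisertData Γ
    open MaxClique C

    -- Otherwise the clique survives in the graph without the k-th coset.
    all-determined : ∀ k → ∃ λ i → ∃ λ j → i ≢ j × form (v i) (c k) ≡ form (v j) (c k)
    all-determined k with Fin.any? (λ i → Fin.any? (λ j → ¬? (i Fin.≟ j) ×-dec (form (v i) (c k) ≟ form (v j) (c k))))
    ... | yes h = h
    ... | no none = ⊥-elim (go (canonical⇒collinear Δ C′ (minimal Δ C′)))
      where
      Δ : PeisertData q K (suc r)
      Δ = record
        { c = c ∘ punchIn k
        ; m≤q = ℕₚ.≤-trans (ℕₚ.n≤1+n _) m≤q
        ; nonzero = nonzero ∘ punchIn k
        ; distinct = λ i j i≢j → distinct (punchIn k i) (punchIn k j) (i≢j ∘ Fin.punchIn-injective k i j) }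
      remaining : ∀ i j → i ≢ j → InS q K Γ (v i - v j) → InS q K Δ (v i - v j)
      remaining i j i≢j (l , a , (fa , a≢0) , e) = punchOut k≢l , a , (fa , a≢0) ,
          trans e (cong (λ t → c t * a) (sym (Fin.punchIn-punchOut k≢l)))
        where
        k≢l : k ≢ l
        k≢l refl = none (i , j , i≢j , -≡0 (trans (sym (form-sub (v i) (v j) (c k))) (trans (cong (λ w → form w (c k)) e)
          (trans (form-scaleˡ (c k) (c k) fa) (trans (cong (_* a) (form-alternating (c k))) (zeroˡ a))))))
      C′ : MaxClique q K Δ
      C′ = record { v = v ; inj = inj ; clique = λ i j i≢j → remaining i j i≢j (clique i j i≢j) }
      go : ∃ (Collinear Δ C′) → ⊥
      go (i , col) = not-collinear (punchIn k i) col

  type≥2 : ∀ {m} {Γ : PeisertData q K m} → ¬ StrictEKR q K Γ → ∃ λ r → m ≡ suc (suc r)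
  type≥2 {zero} {Γ} ns = contradiction (strict-0 Γ) ns
  type≥2 {suc zero} {Γ} ns = contradiction (strict-1 Γ) ns
  type≥2 {suc (suc r)} _ = r , refl

  module PrimePowerCase (k : ℕ) (k∣n : k ∣ n) (k<n : k ℕ.< n) (largest : ∀ d → d ∣ n → d ℕ.< n → d ℕ.≤ k) (1<n : 1 ℕ.< n) where

    1≤k : 1 ℕ.≤ k
    1≤k = largest 1 (1∣ n) 1<n

    quotient : ∃ λ t → 1 ℕ.≤ t × n ≡ k ℕ.* suc t
    quotient = go k∣n
      where
      go : k ∣ n → ∃ λ t → 1 ℕ.≤ t × n ≡ k ℕ.* suc t
      go (divides zero e) = contradiction e (ℕₚ.>⇒≢ 1≤n)
      go (divides (suc zero) e) = contradiction (trans (sym (ℕₚ.+-identityʳ k)) (sym e)) (ℕₚ.<⇒≢ k<n)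
      go (divides (suc (suc t)) e) = suc t , ℕ.s≤s ℕ.z≤n , trans e (ℕₚ.*-comm (suc (suc t)) k)

    t : ℕ
    t = proj₁ quotient

    module T = TraceGraph 𝕂 k t 1≤k (proj₁ (proj₂ quotient)) (proj₂ (proj₂ quotient))

    power≡ : (p ℕ.^ k) ℕ.^ t ≡ p ℕ.^ (n ℕ.∸ k)
    power≡ = trans (ℕₚ.^-*-assoc p k t) (cong (p ℕ.^_) (sym (trans (cong (ℕ._∸ k) (trans (proj₂ (proj₂ quotient)) (ℕₚ.*-suc k t))) (ℕₚ.m+n∸m≡n k (k ℕ.* t)))))

    -- Otherwise the trace graph can be padded to type r + 1, against minimality.
    upper : ∀ {r} → suc r ℕ.≤ q → ((Δ : PeisertData q K (suc r)) → StrictEKR q K Δ) → r ℕ.< p ℕ.^ (n ℕ.∸ k)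
    upper {r} r<q minimal with suc r ℕ.≤? p ℕ.^ (n ℕ.∸ k)
    ... | yes h = h
    ... | no h = contradiction (minimal (proj₁ graph)) (proj₂ graph)
      where
      graph : ∃ λ Δ → ¬ StrictEKR q K Δ
      graph = T.trace-graph r (ℕₚ.≤-trans (ℕₚ.≤-reflexive power≡) (ℕₚ.≮⇒≥ h)) r<q

    -- If 2m ≤ q, the subfield bound applies with a proper divisor e ≤ k of n. If 2m > q, then m >
    -- q/2, which is at least q/pᵏ because pᵏ ≥ 2.
    lower : ∀ {r} (Γ : PeisertData q K (suc (suc r))) → ((Δ : PeisertData q K (suc r)) → StrictEKR q K Δ) → (C : MaxClique q K Γ) →
      (∀ k → ¬ Collinear Γ C k) → p ℕ.^ (n ℕ.∸ k) ℕ.< suc (suc r)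
    lower {r} Γ minimal C not-collinear with suc (suc r) ℕ.+ suc (suc r) ℕ.≤? q
    ... | yes few = go (SubfieldBound.subfield-bound 𝕂 r Γ C (all-determined Γ minimal C not-collinear) not-collinear few)
      where
      go : (∃ λ e → e ∣ n × e ℕ.< n × p ℕ.^ (n ℕ.∸ e) ℕ.< suc (suc r)) → p ℕ.^ (n ℕ.∸ k) ℕ.< suc (suc r)
      go (e , e∣n , e<n , h) = ℕₚ.≤-<-trans (ℕₚ.^-monoʳ-≤ p {{nonZero 1<p}} (ℕₚ.∸-monoʳ-≤ n (largest e e∣n e<n))) h
    ... | no many = ℕₚ.≰⇒> λ m≤ → many (begin
        m ℕ.+ m                              ≤⟨ ℕₚ.+-mono-≤ m≤ m≤ ⟩
        p ℕ.^ (n ℕ.∸ k) ℕ.+ p ℕ.^ (n ℕ.∸ k)  ≡⟨ cong (p ℕ.^ (n ℕ.∸ k) ℕ.+_) (ℕₚ.+-identityʳ _) ⟨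
        2 ℕ.* p ℕ.^ (n ℕ.∸ k)                ≤⟨ ℕₚ.*-monoˡ-≤ (p ℕ.^ (n ℕ.∸ k)) T.1<s ⟩
        p ℕ.^ k ℕ.* p ℕ.^ (n ℕ.∸ k)          ≡⟨ ℕₚ.^-distribˡ-+-* p k (n ℕ.∸ k) ⟨
        p ℕ.^ (k ℕ.+ (n ℕ.∸ k))              ≡⟨ cong (p ℕ.^_) (ℕₚ.m+[n∸m]≡n (ℕₚ.<⇒≤ k<n)) ⟩
        p ℕ.^ n                              ≡⟨ q≡pⁿ ⟨
        q                                    ∎)
      where
      open ℕₚ.≤-Reasoning
      m : ℕ
      m = suc (suc r)

    type : ∀ {m} (Γ : PeisertData q K m) → Extremal q K Γ → m ≡ p ℕ.^ (n ℕ.∸ k) ℕ.+ 1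
    type {m} Γ (ns , minimal) with type≥2 ns
    ... | r , refl = trans (ℕₚ.≤-antisym (ℕ.s≤s (upper (ℕₚ.≤-trans (ℕₚ.n≤1+n _) (PeisertData.m≤q Γ)) minimal))
          (from-non-strict Γ (suc (p ℕ.^ (n ℕ.∸ k)) ℕ.≤? suc (suc r)) ns (lower Γ minimal))) (ℕₚ.+-comm 1 _)

  module PrimeCase (q≡p : q ≡ p) (k : ℕ) (q≡2k+1 : q ≡ suc (k ℕ.+ k)) where
    module Sq = SquareGraph 𝕂 k q≡2k+1

    upper : ∀ {r} → suc r ℕ.≤ q → ((Δ : PeisertData q K (suc r)) → StrictEKR q K Δ) → r ℕ.≤ k
    upper {r} r<q minimal with r ℕ.≤? k
    ... | yes h = h
    ... | no h = contradiction (minimal (proj₁ graph)) (proj₂ graph)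
      where
      graph : ∃ λ Δ → ¬ StrictEKR q K Δ
      graph = Sq.square-graph r (ℕₚ.≰⇒> h) r<q

    lower : ∀ {r} (Γ : PeisertData q K (suc (suc r))) → ((Δ : PeisertData q K (suc r)) → StrictEKR q K Δ) → (C : MaxClique q K Γ) →
      (∀ k → ¬ Collinear Γ C k) → k ℕ.≤ r
    lower {r} Γ minimal C not-collinear = ℕₚ.≮⇒≥ λ r<k →
      PrimeDirections.Bound.many-directions 𝕂 q≡p r Γ C (all-determined Γ minimal C not-collinear) not-collinear (begin
        suc (suc (r ℕ.+ suc r))   ≤⟨ ℕ.s≤s (ℕₚ.+-mono-≤ r<k r<k) ⟩
        suc (k ℕ.+ k)             ≡⟨ q≡2k+1 ⟨
        q                         ≤⟨ ℕₚ.n≤1+n q ⟩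
        suc q                     ∎)
      where open ℕₚ.≤-Reasoning

    type : ∀ {m} (Γ : PeisertData q K m) → Extremal q K Γ → m ≡ suc (suc k)
    type Γ (ns , minimal) with type≥2 ns
    ... | r , refl = cong (λ t → suc (suc t)) (ℕₚ.≤-antisym (upper (ℕₚ.≤-trans (ℕₚ.n≤1+n _) (PeisertData.m≤q Γ)) minimal)
          (from-non-strict Γ (k ℕ.≤? r) ns (lower Γ minimal)))

    normal-form : (Γ : PeisertData q K (suc (suc k))) → Extremal q K Γ → NormalForm.HasNormalForm 𝕂 Γ k
    -- k is exposed as a successor because `Normalisation` is stated for at least three directions.
    normal-form = go k Sq.1≤k q≡2k+1
      where
      go : ∀ k → 1 ℕ.≤ k → q ≡ suc (k ℕ.+ k) → (Γ : PeisertData q K (suc (suc k))) → Extremal q K Γ → NormalForm.HasNormalForm 𝕂 Γ k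
      go (suc k′) _ q≡ Γ (ns , minimal) = from-non-strict Γ (NormalForm.hasNormalForm? 𝕂 Γ (suc k′)) ns
        (λ C not-collinear → Normalisation.normal-form 𝕂 q≡p k′ Γ C (all-determined Γ minimal C not-collinear) not-collinear q≡)

    unique : ∀ {m m′} (Γ : PeisertData q K m) (Γ′ : PeisertData q K m′) → Extremal q K Γ → Extremal q K Γ′ → Isomorphic q K Γ Γ′
    unique Γ Γ′ ext ext′ with type Γ ext | type Γ′ ext′
    ... | refl | refl = NormalIsomorphism.isomorphic 𝕂 k Sq.1≤k Γ Γ′ (normal-form Γ ext) (normal-form Γ′ ext′)

open import Data.Nat using (ℕ; _+_; _*_; _^_; _∸_; _≤_; _<_; _/_)
open import Data.Nat.Divisibility using (_∣_)
open import Data.Nat.Primality using (Prime)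
open import Data.Product using (_×_)
open import Relation.Binary.PropositionalEquality using (_≡_)

theorem1p3 : (p n : ℕ) → Prime p → 1 ≤ n →
    (K : FiniteField ((p ^ n) * (p ^ n))) →
    (m : ℕ) (X : PeisertData (p ^ n) K m) → Extremal (p ^ n) K X →
    ((n ≡ 1 → 3 ≤ p →
    (m ≡ (p + 3) / 2)
    × (∀ (m' : ℕ) (X' : PeisertData (p ^ n) K m') → Extremal (p ^ n) K X' → Isomorphic (p ^ n) K X X'))
    × (1 < n → ∀ (k : ℕ) → k ∣ n → k < n → (∀ (d : ℕ) → d ∣ n → d < n → d ≤ k) →
    m ≡ p ^ (n ∸ k) + 1))
theorem1p3 p n pp 1≤n K m X ext = prime-case , λ 1<n k k∣n k<n largest → E.PrimePowerCase.type k k∣n k<n largest 1<n X ext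
  where
  𝕂 : Setting
  𝕂 = record { p = p ; n = n ; q = p ^ n ; q≡pⁿ = refl ; pp = pp ; 1≤n = 1≤n ; K = K }
  module E = ExtremalGraphs 𝕂
  prime-case : n ≡ 1 → 3 ≤ p →
    (m ≡ (p + 3) / 2)
    × (∀ (m' : ℕ) (X' : PeisertData (p ^ n) K m') → Extremal (p ^ n) K X' → Isomorphic (p ^ n) K X X')
  prime-case n≡1 3≤p = odd (odd-prime pp 3≤p)
    where
    q≡p : p ^ n ≡ p
    q≡p = trans (cong (p ^_) n≡1) (ℕₚ.^-identityʳ p)
    odd : (∃ λ k → p ≡ suc (k + k)) →
      (m ≡ (p + 3) / 2)
      × (∀ (m' : ℕ) (X' : PeisertData (p ^ n) K m') → Extremal (p ^ n) K X' → Isomorphic (p ^ n) K X X')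
    odd (k , p≡) = trans (P.type X ext) (sym (trans (cong (λ t → (t + 3) / 2) p≡) ([2k+1+3]/2 k))) ,
      λ m' X' ext' → P.unique X X' ext ext'
      where module P = E.PrimeCase q≡p k (trans q≡p p≡)
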